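{- Let $\mathcal{C}^B_6$ be the set of bordered $6$-cycles. Then \[ \mathrm{ex}_<(n,\mathcal{C}^B_6)=\Theta(n^{4/3})\qquad (n\to\infty). \]
   Context: An ordered graph is a finite simple graph together with a linear ordering of its vertex set. An ordered graph $G$ contains an ordered graph $H$ as an ordered subgraph if there is an injective, order-preserving map from the vertices of $H$ to the vertices of $G$ that maps edges of $H$ to edges of $G$ (the copy need not be induced). For a set $\mathcal{H}$ of ordered graphs, $\mathrm{ex}_<(n,\mathcal{H})$ is the maximum number of edges of an ordered graph on $n$ vertices that contains no $H\in\mathcal{H}$ as an ordered subgraph. The interval chromatic number of an ordered graph is the minimum number of intervals into which its linearly ordered vertex set can be partitioned so that no two vertices in the same interval are adjacent. In an ordered graph with interval chromatic number $2$ and intervals $U$ and $V$ ($U$ preceding $V$), an edge joining the first vertex of $U$ to the last vertex of $V$ is called an outer border, and an edge joining the last vertex of $U$ to the first vertex of $V$ is called an inner border. A bordered cycle is an ordered cycle (an ordered graph whose underlying graph is a cycle) with interval chromatic number $2$ that contains both an inner border and an outer border. $\mathcal{C}^B_{6}$ is the set of all bordered cycles of length $6$ (up to order-preserving isomorphism; there are three of them). -}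

module Defs where

open import Data.Bool.Base using (Bool; T)
open import Data.Fin.Base using (Fin; zero; suc; toℕ; _≤_)
open import Data.Fin.Properties using (_<?_)
open import Data.Fin.Permutation using (Permutation′; _⟨$⟩ʳ_)
open import Data.List.Base using (length; filter; allFin; cartesianProduct)
import Data.Nat.Base as ℕ
open ℕ using (ℕ; NonZero; _^_; _*_)
open import Data.Product.Base using (_×_; _,_; ∃-syntax; Σ-syntax)
open import Data.Sum.Base using (_⊎_)
open import Function.Bundles using (_⇔_)
open import Function.Definitions using (Injective; StrictlySurjective)
open import Level using (0ℓ)
open import Relation.Binary.Definitions using (Symmetric; Irreflexive; Monotonic₁)
open import Relation.Binary.PropositionalEquality.Core using (_≡_)
open import Relation.Nullary.Decidable using (_×-dec_; T?)
open import Relation.Nullary.Negation using (¬_)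
open import Relation.Unary using (Pred)

private
  variable
    k n : ℕ

-- An n-element linear order is uniquely isomorphic to Fin n, so the vertex
-- set is taken to be Fin n with its usual order.
record OrderedGraph (n : ℕ) : Set where
  field
    adj : Fin n → Fin n → Bool

  _~_ : Fin n → Fin n → Set
  i ~ j = T (adj i j)

  field
    ~-sym    : Symmetric _~_
    ~-irrefl : Irreflexive _≡_ _~_

open OrderedGraph using (adj)

Adj : OrderedGraph n → Fin n → Fin n → Set
Adj = OrderedGraph._~_

-- Each edge is counted once, at its increasing pair of endpoints.
edgeCount : OrderedGraph n → ℕ
edgeCount {n} G =
  length (filter (λ (i , j) → i <? j ×-dec T? (adj G i j))
                 (cartesianProduct (allFin n) (allFin n)))

record _ContainsSubgraph_ (G : OrderedGraph n) (H : OrderedGraph k) : Set where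
  field
    embed      : Fin k → Fin n
    injective  : Injective _≡_ _≡_ embed
    monotone   : Monotonic₁ _≤_ _≤_ embed
    edge       : ∀ {i j} → Adj H i j → Adj G (embed i) (embed j)

Family : Set₁
Family = ∀ {k} → OrderedGraph k → Set

_AvoidsFamily_ : OrderedGraph n → Family → Set
G AvoidsFamily 𝓗 = ∀ {k} (H : OrderedGraph k) → 𝓗 H → ¬ (G ContainsSubgraph H)

-- IsEx n 𝓗 m  says  m = ex_<(n, 𝓗).
record IsEx (n : ℕ) (𝓗 : Family) (m : ℕ) : Set where
  field
    attained : Σ[ G ∈ OrderedGraph n ] (G AvoidsFamily 𝓗) × (edgeCount G ≡ m)
    maximal  : ∀ (G : OrderedGraph n) → G AvoidsFamily 𝓗 → edgeCount G ℕ.≤ m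

CyclicSuc : Fin n → Fin n → Set
CyclicSuc {n} i j =
  (toℕ j ≡ ℕ.suc (toℕ i)) ⊎ (ℕ.suc (toℕ i) ≡ n × toℕ j ≡ 0)

-- σ lists the vertices in their order around the cycle.
IsCycle : OrderedGraph n → Set
IsCycle {n} G =
  3 ℕ.≤ n ×
  (Σ[ σ ∈ Permutation′ n ]
     (∀ i j → Adj G (σ ⟨$⟩ʳ i) (σ ⟨$⟩ʳ j) ⇔ (CyclicSuc i j ⊎ CyclicSuc j i)))

-- The intervals are the fibres of a monotone map onto Fin c; surjectivity
-- makes all of them nonempty.
record IntervalPartition (G : OrderedGraph n) (c : ℕ) : Set where
  field
    part        : Fin n → Fin c
    monotone    : Monotonic₁ _≤_ _≤_ part
    surjective  : StrictlySurjective _≡_ part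
    independent : ∀ {i j} → part i ≡ part j → ¬ Adj G i j

  Interval : Fin c → Pred (Fin n) 0ℓ
  Interval a i = part i ≡ a

record HasIntervalChromaticNumber (G : OrderedGraph n) (c : ℕ) : Set where
  field
    partition : IntervalPartition G c
    minimal   : ∀ c′ → IntervalPartition G c′ → c ℕ.≤ c′

FirstOf LastOf : Pred (Fin n) 0ℓ → Pred (Fin n) 0ℓ
FirstOf P i = P i × (∀ j → P j → i ≤ j)
LastOf  P i = P i × (∀ j → P j → j ≤ i)

module _ {G : OrderedGraph n} (𝓟 : IntervalPartition G 2) where
  private
    U V : Pred (Fin n) 0ℓ
    U = IntervalPartition.Interval 𝓟 zero
    V = IntervalPartition.Interval 𝓟 (suc zero)

  HasOuterBorder HasInnerBorder : Set
  HasOuterBorder = ∃[ u ] ∃[ v ] FirstOf U u × LastOf V v × Adj G u v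
  HasInnerBorder = ∃[ u ] ∃[ v ] LastOf U u × FirstOf V v × Adj G u v

-- In a graph without isolated vertices there is at most one partition into
-- two independent intervals, so for cycles the existential below is about
-- "the" intervals U and V.
record IsBorderedCycle (G : OrderedGraph n) : Set where
  field
    isCycle  : IsCycle G
    χ<≡2     : HasIntervalChromaticNumber G 2
    bordered : Σ[ 𝓟 ∈ IntervalPartition G 2 ] HasInnerBorder 𝓟 × HasOuterBorder 𝓟

𝓒ᴮ : ℕ → Family
𝓒ᴮ ℓ {k} G = k ≡ ℓ × IsBorderedCycle G

-- Growth compared with n^(p/q).  Both sides of  f n ≤ C · n^(p/q)  and
-- n^(p/q) ≤ C · f n  are raised to the q-th power to stay in ℕ.  Positive real
-- constants may be weakened to C and 1/C with C a positive natural.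
module _ (f : ℕ → ℕ) (p q : ℕ) .{{_ : NonZero q}} where

  IsO IsΩ IsΘ : Set
  IsO = ∃[ C ] 0 ℕ.< C × (∃[ N ] ∀ n → N ℕ.≤ n → f n ^ q ℕ.≤ C ^ q * n ^ p)
  IsΩ = ∃[ C ] 0 ℕ.< C × (∃[ N ] ∀ n → N ℕ.≤ n → n ^ p ℕ.≤ (C * f n) ^ q)
  IsΘ = IsO × IsΩ

{-# OPTIONS --safe #-}
module Submission where

-- A bordered six-cycle consists of u₁ < u₂ < u₃, followed by the vertices v₁, v₂, v₃ opposite to them, with v₁ < v₃;
-- the place of v₂ is arbitrary.
--
-- Upper bound: cutting the vertex set into 8 intervals recursively reduces the claim to a d³ × d³ zero-one matrix.
-- Divide the entries of every row and every column into blocks of d.  From an entry (a , b) go to an entry (r , b) in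
-- the next block of column b and to an entry (a , c) in the next block of row a.  Except near the ends of rows and
-- columns each entry is the corner of d² such paths.  Two paths with the same end (r , c) whose corners differ in both
-- coordinates form a bordered six-cycle, so an end of many paths comes from a row r sharing many entries of one block
-- with row a (or the same for columns).  Any two entries of a block are shared with at most one such row r, so these
-- paths are few, and the number of paths is O(d⁶).
--
-- Lower bound: for a prime p, Wenger's graph joins the point (x , y , z) to the line (m , c , d) over ℤ/p if
-- y + x m + c = 0 and z + x² m + d = 0.  It has p⁴ edges on 2 p³ vertices and no six-cycles at all.  A suitable prime
-- lies in (4ᵘ , 4ᵘ⁺¹]: a common multiple of 1, …, N is at least 2 ^ (N − 1) because the entries n (n−1 C k) of the
-- Leibniz triangle divide it, whereas the absence of such primes would produce a smaller one.

open import Defs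
open import Data.Bool.Base using (Bool; true; false; T; _∧_; _∨_; not; if_then_else_)
open import Data.Bool.Properties using (T-∧; T-∨; T?)
open import Data.Empty using (⊥; ⊥-elim)
open import Data.Fin.Base as Fin using (Fin; zero; suc; toℕ; fromℕ<; inject₁; splitAt)
open import Data.Fin.Patterns
open import Data.Fin.Permutation as Permutation using (Permutation′; permutation; _⟨$⟩ʳ_; _⟨$⟩ˡ_)
import Data.Fin.Properties as Fin
open import Data.Integer.Base as ℤ using () renaming (+_ to pos)
import Data.Integer.Divisibility.Signed as ℤ∣
import Data.Integer.Properties as ℤ
import Data.Integer.Tactic.RingSolver as ℤSolver
open import Data.List.Base using (List; []; _∷_; _++_; map; length; filter; tabulate; cartesianProduct; cartesianProductWith)
open import Data.List.Membership.Propositional using (_∈_)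
open import Data.List.Membership.Propositional.Properties using (∈-cartesianProductWith⁺; ∈-map⁺; ∈-filter⁺)
open import Data.List.Properties using (filter-++; length-++)
open import Data.List.Relation.Unary.All as All using (_∷_)
open import Data.List.Relation.Unary.All.Properties using (all-filter)
open import Data.List.Relation.Unary.Any using (here; there)
open import Data.Nat.Base using (ℕ; zero; suc; 2+; pred; _+_; _*_; _∸_; _^_; _/_; _%_; _!; _≤_; _<_; z≤n; s≤s; _≡ᵇ_; _<ᵇ_; _≤ᵇ_; NonZero; >-nonZero; >-nonZero⁻¹; nonTrivial⇒n>1)
open import Data.Nat.Combinatorics using (_C_; nCk≡nC[n∸k]; nCn≡1; nC1≡n; nCk+nC[k+1]≡[n+1]C[k+1]; k>n⇒nCk≡0; nCk≡n!/k![n-k]!; k![n∸k]!∣n!)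
open import Data.Nat.DivMod
open import Data.Nat.Divisibility
open import Data.Nat.ListAction using (product)
open import Data.Nat.Primality
open import Data.Nat.Primality.Factorisation using (factorise)
open import Data.Nat.Properties
open import Data.List.Extrema ≤-totalOrder using (argmax; argmax-all; f[xs]≤f[argmax])
open import Data.Nat.Tactic.RingSolver using (solve-∀)
open import Data.Product.Base using (Σ-syntax; ∃-syntax; _×_; _,_; proj₁; proj₂)
open import Data.Sum.Base as Sum using (_⊎_; inj₁; inj₂)
open import Data.Unit.Base using (tt)
open import Data.Vec.Base using (Vec; []; _∷_; lookup)
open import Data.Vec.Functional using () renaming (_∷_ to _◂_)
open import Function.Base using (_∘_; flip)
open import Function.Bundles using (Equivalence; _⇔_; mk⇔)
open import Level using (0ℓ)
open import Relation.Binary.Definitions using (tri<; tri≈; tri>)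
open import Relation.Binary.PropositionalEquality hiding ([_])
open import Relation.Nullary.Decidable.Core using (Dec; yes; no; does; _×-dec_; _⊎-dec_; _→-dec_; ¬?; map′; from-yes; True; toWitness)
open import Relation.Nullary.Negation using (¬_; contradiction)
open import Relation.Unary using (Pred; Decidable)

-- Finite sums

-- A matrix of side `d³` with `d⁴` entries has `d` entries per line on average; hence blocks of `d`.
-- Then `d²` paths per entry against `d⁶` ends yield `O(d⁴)` entries, once boundedly many paths
-- share an end. The obstacle is that all corners belonging to one end may lie in a single row or
-- column: two rows can share any number of columns without a hexagon, so this can only be charged,
-- not excluded. The cutoff five serves the charge. A thick step then takes part in four pairs, so
-- thick paths of either direction amount to at most a quarter of `entries · d²`; together they cost
-- one half, which is absorbed on the left.
--
-- In the lower bound, losing a constant factor in the prime is harmless, and the factor four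
-- instead of Bertrand's two permits crude estimates. The primorial of `n` is bounded by `4ⁿ` only.
-- Against `2 ^ (N − 1)` with `N = 2n` this would leave nothing to spare, whereas `N = 4n` leaves
-- half of the exponent for the power of `s !`.

⟦_⟧ : Bool → ℕ
⟦ true ⟧  = 1
⟦ false ⟧ = 0

⟦⟧≤1 : ∀ p → ⟦ p ⟧ ≤ 1
⟦⟧≤1 true  = s≤s z≤n
⟦⟧≤1 false = z≤n

⟦⟧-mono : ∀ {p q} → (T p → T q) → ⟦ p ⟧ ≤ ⟦ q ⟧
⟦⟧-mono {false}         _ = z≤n
⟦⟧-mono {true}  {true}  _ = s≤s z≤n
⟦⟧-mono {true}  {false} f = ⊥-elim (f tt)

⟦⟧-false : ∀ {p} → ¬ T p → ⟦ p ⟧ ≡ 0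
⟦⟧-false {false} _ = refl
⟦⟧-false {true}  f = ⊥-elim (f tt)

⟦⟧-true : ∀ {p} → T p → ⟦ p ⟧ ≡ 1
⟦⟧-true {true} _ = refl

⟦∧⟧ : ∀ p q → ⟦ p ∧ q ⟧ ≡ ⟦ p ⟧ * ⟦ q ⟧
⟦∧⟧ true  q = sym (+-identityʳ ⟦ q ⟧)
⟦∧⟧ false q = refl

split : ∀ {p q} → T (p ∧ q) → T p × T q
split = Equivalence.to T-∧

join : ∀ {p q} → T p → T q → T (p ∧ q)
join x y = Equivalence.from T-∧ (x , y)

T-not : ∀ {p} → ¬ T p → T (not p)
T-not {false} _ = tt
T-not {true}  f = ⊥-elim (f tt)

T-not⁻ : ∀ {p} → T (not p) → ¬ T p
T-not⁻ {false} _ ()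

∑ : ℕ → (ℕ → ℕ) → ℕ
∑ zero    f = 0
∑ (suc n) f = ∑ n f + f n

infixr 8 ∑
syntax ∑ n (λ i → e) = ∑[ i < n ] e

∑-cong : ∀ n {f g : ℕ → ℕ} → (∀ i → f i ≡ g i) → ∑ n f ≡ ∑ n g
∑-cong zero    _ = refl
∑-cong (suc n) h = cong₂ _+_ (∑-cong n h) (h n)

∑-mono< : ∀ n {f g : ℕ → ℕ} → (∀ i → i < n → f i ≤ g i) → ∑ n f ≤ ∑ n g
∑-mono< zero    _ = z≤n
∑-mono< (suc n) h = +-mono-≤ (∑-mono< n (λ i i<n → h i (m≤n⇒m≤1+n i<n))) (h n ≤-refl)

∑-mono : ∀ n {f g : ℕ → ℕ} → (∀ i → f i ≤ g i) → ∑ n f ≤ ∑ n g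
∑-mono n h = ∑-mono< n (λ i _ → h i)

∑-const : ∀ n c → ∑ n (λ _ → c) ≡ n * c
∑-const zero    c = refl
∑-const (suc n) c = trans (cong (_+ c) (∑-const n c)) (+-comm (n * c) c)

∑-zero : ∀ n → ∑ n (λ _ → 0) ≡ 0
∑-zero n = trans (∑-const n 0) (*-zeroʳ n)

∑-≤-const : ∀ n {f : ℕ → ℕ} c → (∀ i → f i ≤ c) → ∑ n f ≤ n * c
∑-≤-const n c h = ≤-trans (∑-mono n h) (≤-reflexive (∑-const n c))

∑-+ : ∀ n (f g : ℕ → ℕ) → ∑ n (λ i → f i + g i) ≡ ∑ n f + ∑ n g
∑-+ zero    f g = refl
∑-+ (suc n) f g = trans (cong (_+ (f n + g n)) (∑-+ n f g)) (interchange (∑ n f) (∑ n g) (f n) (g n))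
  where
  interchange : ∀ a b c d → (a + b) + (c + d) ≡ (a + c) + (b + d)
  interchange = solve-∀

∑-*ˡ : ∀ n c (f : ℕ → ℕ) → ∑ n (λ i → c * f i) ≡ c * ∑ n f
∑-*ˡ zero    c f = sym (*-zeroʳ c)
∑-*ˡ (suc n) c f = trans (cong (_+ c * f n) (∑-*ˡ n c f)) (sym (*-distribˡ-+ c (∑ n f) (f n)))

∑-*ʳ : ∀ n (f : ℕ → ℕ) c → ∑ n (λ i → f i * c) ≡ ∑ n f * c
∑-*ʳ n f c = trans (∑-cong n (λ i → *-comm (f i) c)) (trans (∑-*ˡ n c f) (*-comm c (∑ n f)))

∑-swap : ∀ m n (f : ℕ → ℕ → ℕ) → ∑[ i < m ] (∑[ j < n ] f i j) ≡ ∑[ j < n ] (∑[ i < m ] f i j)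
∑-swap zero    n f = sym (∑-zero n)
∑-swap (suc m) n f = trans (cong (_+ ∑ n (f m)) (∑-swap m n f)) (sym (∑-+ n (λ j → ∑[ i < m ] f i j) (f m)))

∑-×-∑ : ∀ m n (f g : ℕ → ℕ) → ∑ m f * ∑ n g ≡ ∑[ i < m ] (∑[ j < n ] (f i * g j))
∑-×-∑ m n f g = trans (sym (∑-*ʳ m f (∑ n g))) (∑-cong m (λ i → sym (∑-*ˡ n (f i) g)))

term≤∑ : ∀ n (f : ℕ → ℕ) {i} → i < n → f i ≤ ∑ n f
term≤∑ (suc n) f {i} (s≤s i≤n) with m≤n⇒m<n∨m≡n i≤n
... | inj₁ i<n  = ≤-trans (term≤∑ n f i<n) (m≤m+n _ _)
... | inj₂ refl = m≤n+m (f n) _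

∑-prefix : ∀ {m n} (f : ℕ → ℕ) → m ≤ n → ∑ m f ≤ ∑ n f
∑-prefix {m} {zero}  f z≤n = z≤n
∑-prefix {m} {suc n} f m≤1+n with m≤n⇒m<n∨m≡n m≤1+n
... | inj₁ (s≤s m≤n) = ≤-trans (∑-prefix f m≤n) (m≤m+n _ _)
... | inj₂ refl      = ≤-refl

∑-front : ∀ n (f : ℕ → ℕ) → ∑ (suc n) f ≡ f 0 + ∑ n (f ∘ suc)
∑-front zero    f = +-comm 0 (f 0)
∑-front (suc n) f = trans (cong (_+ f (suc n)) (∑-front n f)) (+-assoc (f 0) _ _)

∑-append : ∀ m n (f : ℕ → ℕ) → ∑ (m + n) f ≡ ∑ m f + ∑[ i < n ] f (m + i)
∑-append m zero    f = trans (cong (λ k → ∑ k f) (+-identityʳ m)) (sym (+-identityʳ _))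
∑-append m (suc n) f = trans (cong (λ k → ∑ k f) (+-suc m n))
  (trans (cong (_+ f (m + n)) (∑-append m n f)) (+-assoc (∑ m f) _ _))

∑-digits : ∀ a b (f : ℕ → ℕ) → ∑ (a * b) f ≡ ∑[ q < a ] (∑[ r < b ] f (q * b + r))
∑-digits zero    b f = refl
∑-digits (suc a) b f = trans (cong (λ k → ∑ k f) (+-comm b (a * b)))
  (trans (∑-append (a * b) b f) (cong (_+ ∑[ r < b ] f (a * b + r)) (∑-digits a b f)))

∑-empty : ∀ n {Q : ℕ → Bool} → (∀ i → ¬ T (Q i)) → ∑[ i < n ] ⟦ Q i ⟧ ≡ 0
∑-empty n none = trans (∑-cong n (λ i → ⟦⟧-false (none i))) (∑-zero n)

∑-atMostOne : ∀ n {Q : ℕ → Bool} → (∀ i j → i < n → j < n → T (Q i) → T (Q j) → i ≡ j) → ∑[ i < n ] ⟦ Q i ⟧ ≤ 1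
∑-atMostOne zero    unique = z≤n
∑-atMostOne (suc n) {Q} unique with T? (Q n)
... | no ¬Qn = ≤-trans (≤-reflexive (trans (cong (∑ n (⟦_⟧ ∘ Q) +_) (⟦⟧-false ¬Qn)) (+-identityʳ _)))
                (∑-atMostOne n (λ i j i<n j<n → unique i j (m≤n⇒m≤1+n i<n) (m≤n⇒m≤1+n j<n)))
... | yes Qn = ≤-trans (+-mono-≤ {y = 0} (≤-trans (∑-mono< n others) (≤-reflexive (∑-zero n))) (⟦⟧≤1 (Q n))) ≤-refl
  where
  others : ∀ i → i < n → ⟦ Q i ⟧ ≤ 0
  others i i<n = ≤-reflexive (⟦⟧-false (λ Qi → <⇒≢ i<n (unique i n (m≤n⇒m≤1+n i<n) ≤-refl Qi Qn)))

∑-point : ∀ n x → ∑[ i < n ] ⟦ i ≡ᵇ x ⟧ ≤ 1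
∑-point n x = ∑-atMostOne n (λ i j _ _ p q → trans (≡ᵇ⇒≡ i x p) (sym (≡ᵇ⇒≡ j x q)))

∑-positive : ∀ n {f : ℕ → ℕ} → 0 < ∑ n f → ∃[ i ] 0 < f i
∑-positive (suc n) {f} h with f n in eq
... | suc _ = n , subst (0 <_) (sym eq) (s≤s z≤n)
... | zero  = ∑-positive n (subst (0 <_) (+-identityʳ (∑ n f)) h)

⟦⟧-positive : ∀ {p} → 0 < ⟦ p ⟧ → T p
⟦⟧-positive {true} _ = tt

third : ∀ n {Q : ℕ → Bool} x y → 3 ≤ ∑[ i < n ] ⟦ Q i ⟧ → ∃[ i ] T (Q i) × i ≢ x × i ≢ y
third n {Q} x y h = let (i , p) = ∑-positive n positive
                        (Qi , q) = split {Q i} (⟦⟧-positive p)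
                        (r , s) = split {not (i ≡ᵇ x)} q
                    in i , Qi , (λ e → T-not⁻ r (≡⇒≡ᵇ i x e)) , (λ e → T-not⁻ s (≡⇒≡ᵇ i y e))
  where
  Q′ : ℕ → Bool
  Q′ i = Q i ∧ (not (i ≡ᵇ x) ∧ not (i ≡ᵇ y))
  pointwise : ∀ p q r → ⟦ p ⟧ ≤ ⟦ p ∧ (not q ∧ not r) ⟧ + (⟦ q ⟧ + ⟦ r ⟧)
  pointwise false _ _ = z≤n
  pointwise true true  _ = s≤s z≤n
  pointwise true false true = s≤s z≤n
  pointwise true false false = s≤s z≤n
  bound : ∑[ i < n ] ⟦ Q i ⟧ ≤ ∑[ i < n ] ⟦ Q′ i ⟧ + 2
  bound = begin
    ∑[ i < n ] ⟦ Q i ⟧ ≤⟨ ∑-mono n (λ i → pointwise (Q i) (i ≡ᵇ x) (i ≡ᵇ y)) ⟩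
    ∑[ i < n ] (⟦ Q′ i ⟧ + (⟦ i ≡ᵇ x ⟧ + ⟦ i ≡ᵇ y ⟧)) ≡⟨ ∑-+ n _ _ ⟩
    ∑[ i < n ] ⟦ Q′ i ⟧ + ∑[ i < n ] (⟦ i ≡ᵇ x ⟧ + ⟦ i ≡ᵇ y ⟧) ≡⟨ cong (∑ n (⟦_⟧ ∘ Q′) +_) (∑-+ n _ _) ⟩
    ∑[ i < n ] ⟦ Q′ i ⟧ + (∑[ i < n ] ⟦ i ≡ᵇ x ⟧ + ∑[ i < n ] ⟦ i ≡ᵇ y ⟧) ≤⟨ +-monoʳ-≤ (∑ n (⟦_⟧ ∘ Q′)) (+-mono-≤ (∑-point n x) (∑-point n y)) ⟩
    ∑[ i < n ] ⟦ Q′ i ⟧ + 2 ∎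
    where open ≤-Reasoning
  positive : 0 < ∑[ i < n ] ⟦ Q′ i ⟧
  positive = +-cancelʳ-≤ 2 1 _ (≤-trans h bound)

rank : (ℕ → Bool) → ℕ → ℕ
rank P n = ∑[ i < n ] ⟦ P i ⟧

rank-mono : ∀ P {m n} → m ≤ n → rank P m ≤ rank P n
rank-mono P = ∑-prefix (⟦_⟧ ∘ P)

-- Along the entries of `P` below `n` the rank takes each value below `rank P n` exactly once.
-- Entries are thus counted by position without being listed.
∑-rank : ∀ P n (f : ℕ → ℕ) → ∑[ i < n ] (⟦ P i ⟧ * f (rank P i)) ≡ ∑ (rank P n) f
∑-rank P zero    f = refl
∑-rank P (suc n) f with P n
... | true  = trans (cong₂ _+_ (∑-rank P n f) (+-identityʳ (f (rank P n)))) (cong (λ k → ∑ k f) (+-comm 1 (rank P n)))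
... | false = trans (cong (_+ 0) (∑-rank P n f)) (trans (+-identityʳ _) (cong (λ k → ∑ k f) (sym (+-identityʳ (rank P n)))))

[q*d+r]/d≡q : ∀ q d {r} .{{_ : NonZero d}} → r < d → (q * d + r) / d ≡ q
[q*d+r]/d≡q q d {r} r<d = begin
  (q * d + r) / d     ≡⟨ +-distrib-/-∣ˡ r (divides-refl q) ⟩
  q * d / d + r / d   ≡⟨ cong₂ _+_ (m*n/n≡m q d) (m<n⇒m/n≡0 r<d) ⟩
  q + 0               ≡⟨ +-identityʳ q ⟩
  q                   ∎
  where open ≡-Reasoning

[q*d+r]%d≡r : ∀ q d {r} .{{_ : NonZero d}} → r < d → (q * d + r) % d ≡ r
[q*d+r]%d≡r q d {r} r<d = begin
  (q * d + r) % d  ≡⟨ cong (_% d) (+-comm (q * d) r) ⟩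
  (r + q * d) % d  ≡⟨ [m+kn]%n≡m%n r q d ⟩
  r % d            ≡⟨ m<n⇒m%n≡m r<d ⟩
  r                ∎
  where open ≡-Reasoning

∑-tail≤ : ∀ m t → ∑[ j < m ] ⟦ not (j + t ≤ᵇ m) ⟧ ≤ t
∑-tail≤ m t with ≤-total m t
... | inj₁ m≤t = ≤-trans (∑-≤-const m 1 (λ j → ⟦⟧≤1 _)) (≤-trans (≤-reflexive (*-identityʳ m)) m≤t)
... | inj₂ t≤m with m≤n⇒∃[o]m+o≡n t≤m
...   | s , refl = begin
  ∑ (t + s) f               ≡⟨ cong (λ k → ∑ k f) (+-comm t s) ⟩
  ∑ (s + t) f               ≡⟨ ∑-append s t f ⟩
  ∑ s f + ∑[ i < t ] f (s + i) ≤⟨ +-mono-≤ (∑-mono< s early) (∑-≤-const t 1 (λ i → ⟦⟧≤1 _)) ⟩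
  ∑[ i < s ] 0 + t * 1      ≡⟨ cong₂ _+_ (∑-zero s) (*-identityʳ t) ⟩
  t                         ∎
  where
  open ≤-Reasoning
  f : ℕ → ℕ
  f j = ⟦ not (j + t ≤ᵇ t + s) ⟧
  early : ∀ j → j < s → f j ≤ 0
  early j j<s = ≤-reflexive (⟦⟧-false (λ p → T-not⁻ p (≤⇒≤ᵇ (≤-trans (≤-reflexive (+-comm j t)) (+-monoʳ-≤ t (<⇒≤ j<s))))))

-- Blocks of `d` consecutive entries of a row or column

module Blocks (d : ℕ) .{{_ : NonZero d}} where

  open ≤-Reasoning

  ∑-quotient≡ : ∀ m k → ∑[ j < m * d ] ⟦ j / d ≡ᵇ k ⟧ ≡ ∑[ q < m ] ⟦ q ≡ᵇ k ⟧ * d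
  ∑-quotient≡ m k = begin-equality
    ∑[ j < m * d ] ⟦ j / d ≡ᵇ k ⟧                     ≡⟨ ∑-digits m d _ ⟩
    ∑[ q < m ] ∑[ r < d ] ⟦ (q * d + r) / d ≡ᵇ k ⟧    ≡⟨ ∑-cong m row ⟩
    ∑[ q < m ] (⟦ q ≡ᵇ k ⟧ * d)                       ≡⟨ ∑-*ʳ m _ d ⟩
    ∑[ q < m ] ⟦ q ≡ᵇ k ⟧ * d                         ∎
    where
    row : ∀ q → ∑[ r < d ] ⟦ (q * d + r) / d ≡ᵇ k ⟧ ≡ ⟦ q ≡ᵇ k ⟧ * d
    row q = ≤-antisym
      (begin
        ∑[ r < d ] ⟦ (q * d + r) / d ≡ᵇ k ⟧  ≤⟨ ∑-mono< d (λ r r<d → ≤-reflexive (cong (λ z → ⟦ z ≡ᵇ k ⟧) ([q*d+r]/d≡q q d r<d))) ⟩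
        ∑[ r < d ] ⟦ q ≡ᵇ k ⟧                ≡⟨ ∑-const d _ ⟩
        d * ⟦ q ≡ᵇ k ⟧                       ≡⟨ *-comm d _ ⟩
        ⟦ q ≡ᵇ k ⟧ * d                       ∎)
      (begin
        ⟦ q ≡ᵇ k ⟧ * d                       ≡⟨ *-comm _ d ⟩
        d * ⟦ q ≡ᵇ k ⟧                       ≡⟨ ∑-const d _ ⟨
        ∑[ r < d ] ⟦ q ≡ᵇ k ⟧                ≤⟨ ∑-mono< d (λ r r<d → ≤-reflexive (cong (λ z → ⟦ z ≡ᵇ k ⟧) (sym ([q*d+r]/d≡q q d r<d)))) ⟩
        ∑[ r < d ] ⟦ (q * d + r) / d ≡ᵇ k ⟧  ∎)

  blk : (ℕ → Bool) → ℕ → ℕ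
  blk P c = rank P c / d

  inBlock : (ℕ → Bool) → ℕ → ℕ → Bool
  inBlock P k c = P c ∧ (blk P c ≡ᵇ k)

  -- If `k` is the block of `c`, then `k * d ≤ rank P c`, so `2 * d` further ranks reach the end
  -- `(k + 2) * d` of block `k + 1`, which is therefore complete.
  early : (ℕ → Bool) → ℕ → ℕ → Bool
  early P n c = rank P c + 2 * d ≤ᵇ rank P n

  ∑-inBlock : ∀ P n k → ∑[ c < n ] ⟦ inBlock P k c ⟧ ≡ ∑[ j < rank P n ] ⟦ j / d ≡ᵇ k ⟧
  ∑-inBlock P n k = trans (∑-cong n (λ c → ⟦∧⟧ (P c) _)) (∑-rank P n (λ j → ⟦ j / d ≡ᵇ k ⟧))

  ∑-inBlock≤ : ∀ P n k → ∑[ c < n ] ⟦ inBlock P k c ⟧ ≤ d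
  ∑-inBlock≤ P n k = begin
    ∑[ c < n ] ⟦ inBlock P k c ⟧          ≡⟨ ∑-inBlock P n k ⟩
    ∑[ j < rank P n ] ⟦ j / d ≡ᵇ k ⟧      ≤⟨ ∑-prefix _ (m≤m*n (rank P n) d) ⟩
    ∑[ j < rank P n * d ] ⟦ j / d ≡ᵇ k ⟧  ≡⟨ ∑-quotient≡ (rank P n) k ⟩
    ∑[ q < rank P n ] ⟦ q ≡ᵇ k ⟧ * d      ≤⟨ *-monoˡ-≤ d (∑-point (rank P n) k) ⟩
    1 * d                                 ≡⟨ *-identityˡ d ⟩
    d                                     ∎

  d≤∑-nextBlock : ∀ P n {b} → T (early P n b) → d ≤ ∑[ c < n ] ⟦ inBlock P (suc (blk P b)) c ⟧
  d≤∑-nextBlock P n {b} p = begin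
    d                                      ≡⟨ *-identityˡ d ⟨
    1 * d                                  ≡⟨ cong (_* d) (⟦⟧-true (≡⇒≡ᵇ k k refl)) ⟨
    ⟦ k ≡ᵇ k ⟧ * d                         ≤⟨ *-monoˡ-≤ d (term≤∑ (suc k) (λ q → ⟦ q ≡ᵇ k ⟧) ≤-refl) ⟩
    ∑[ q < suc k ] ⟦ q ≡ᵇ k ⟧ * d          ≡⟨ ∑-quotient≡ (suc k) k ⟨
    ∑[ j < suc k * d ] ⟦ j / d ≡ᵇ k ⟧      ≤⟨ ∑-prefix _ room ⟩
    ∑[ j < rank P n ] ⟦ j / d ≡ᵇ k ⟧       ≡⟨ ∑-inBlock P n k ⟨
    ∑[ c < n ] ⟦ inBlock P k c ⟧           ∎
    where
    k : ℕ
    k = suc (blk P b)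
    rearrange : ∀ q e → (2 + q) * e ≡ q * e + 2 * e
    rearrange = solve-∀
    room : suc k * d ≤ rank P n
    room = begin
      suc k * d                        ≡⟨ rearrange (blk P b) d ⟩
      rank P b / d * d + 2 * d         ≤⟨ +-monoˡ-≤ (2 * d) (m/n*n≤m (rank P b) d) ⟩
      rank P b + 2 * d                 ≤⟨ ≤ᵇ⇒≤ _ _ p ⟩
      rank P n                         ∎

  ∑-late≤ : ∀ P n → ∑[ c < n ] ⟦ P c ∧ not (early P n c) ⟧ ≤ 2 * d
  ∑-late≤ P n = begin
    ∑[ c < n ] ⟦ P c ∧ not (early P n c) ⟧                ≡⟨ ∑-cong n (λ c → ⟦∧⟧ (P c) _) ⟩
    ∑[ c < n ] (⟦ P c ⟧ * ⟦ not (early P n c) ⟧)          ≡⟨ ∑-rank P n (λ j → ⟦ not (j + 2 * d ≤ᵇ rank P n) ⟧) ⟩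
    ∑[ j < rank P n ] ⟦ not (j + 2 * d ≤ᵇ rank P n) ⟧     ≤⟨ ∑-tail≤ (rank P n) (2 * d) ⟩
    2 * d                                                 ∎

  nextBlock⇒< : ∀ P b c → T (inBlock P (suc (blk P b)) c) → b < c
  nextBlock⇒< P b c p = ≰⇒> λ c≤b → <⇒≱ (≤-reflexive (sym (≡ᵇ⇒≡ _ _ (proj₂ (split {P c} p))))) (/-monoˡ-≤ d (rank-mono P c≤b))

-- Zero-one matrices without bordered hexagons

-- Indices range over all of `ℕ`, so that cutting out and shifting a window is mere addition; the
-- size enters only through the sums.
Matrix : Set
Matrix = ℕ → ℕ → Bool

-- Column `cᵢ` is the one that row `rᵢ` skips. Rows and columns are not compared with each other:
-- the matrix stands for the edges between two disjoint intervals.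
HexagonFree : Matrix → Set
HexagonFree E = ∀ {r₁ r₂ r₃ c₁ c₂ c₃} → r₁ < r₂ → r₂ < r₃ → c₁ < c₃ → c₂ ≢ c₁ → c₂ ≢ c₃ →
  T (E r₁ c₂) → T (E r₁ c₃) → T (E r₂ c₁) → T (E r₂ c₃) → T (E r₃ c₁) → T (E r₃ c₂) → ⊥

ThickFree : Matrix → Set
ThickFree E = ∀ {a s r b b′ x} → a < s → s < r → b ≢ b′ → x ≢ b → x ≢ b′ →
  T (E a b) → T (E a b′) → T (E a x) → T (E s b) → T (E s b′) → T (E r b) → T (E r b′) → T (E r x) → ⊥

-- Row `s` is known to contain `b` and `b′` only, so it becomes the middle row, opposite `x`, whose
-- place is arbitrary. Row `a` skips the smaller and row `r` the larger of `b` and `b′`.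
thickFree : ∀ {E} → HexagonFree E → ThickFree E
thickFree free {b = b} {b′} a<s s<r b≢b′ x≢b x≢b′ ab ab′ ax sb sb′ rb rb′ rx with <-cmp b b′
... | tri< b<b′ _ _ = free a<s s<r b<b′ x≢b x≢b′ ax ab′ sb sb′ rb rx
... | tri≈ _ b≡b′ _ = b≢b′ b≡b′
... | tri> _ _ b′<b = free a<s s<r b′<b x≢b′ x≢b ax ab sb′ sb rb′ rx

-- Line `x` is again opposite `s`, but now the place of `x` among the rows matters. In each case `a`
-- and `r` are assigned so that the column skipped by the first row precedes the one skipped by the
-- last row: `s < r`, `a < r` and `a < s` respectively.
thickFree-flip-sorted : ∀ {E} → HexagonFree E → ∀ {a s r b b′ x} → b < b′ → x ≢ b → x ≢ b′ → a < s → s < r →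
  T (E b a) → T (E b′ a) → T (E x a) → T (E b s) → T (E b′ s) → T (E b r) → T (E b′ r) → T (E x r) → ⊥
thickFree-flip-sorted free {b = b} {b′} {x} b<b′ x≢b x≢b′ a<s s<r ab ab′ ax sb sb′ rb rb′ rx with <-cmp x b | <-cmp x b′
... | tri< x<b _ _ | _             = free x<b b<b′ s<r (<⇒≢ a<s) (<⇒≢ (<-trans a<s s<r)) ax rx sb rb sb′ ab′
... | tri≈ _ x≡b _ | _             = x≢b x≡b
... | tri> _ _ b<x | tri< x<b′ _ _ = free b<x x<b′ (<-trans a<s s<r) (≢-sym (<⇒≢ a<s)) (<⇒≢ s<r) sb rb ax rx ab′ sb′
... | tri> _ _ b<x | tri≈ _ x≡b′ _ = x≢b′ x≡b′
... | tri> _ _ b<x | tri> _ _ b′<x = free b<b′ b′<x a<s (≢-sym (<⇒≢ (<-trans a<s s<r))) (≢-sym (<⇒≢ s<r)) rb sb ab′ sb′ ax rx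

thickFree-flip : ∀ {E} → HexagonFree E → ThickFree (flip E)
thickFree-flip {E} free {b = b} {b′} a<s s<r b≢b′ x≢b x≢b′ ab ab′ ax sb sb′ rb rb′ rx with <-cmp b b′
... | tri< b<b′ _ _ = thickFree-flip-sorted free b<b′ x≢b x≢b′ a<s s<r ab ab′ ax sb sb′ rb rb′ rx
... | tri≈ _ b≡b′ _ = b≢b′ b≡b′
... | tri> _ _ b′<b = thickFree-flip-sorted free b′<b x≢b′ x≢b a<s s<r ab′ ab ax sb′ sb rb′ rb rx

-- If `b ≠ b′` and, say, `a < a′`, then the rows `a < a′ < r` skip the columns `b′`, `b` and `c`,
-- and `b′ < c` is the order that a hexagon requires. This is why paths lead forward in both
-- directions.
corners-share : ∀ {E} → HexagonFree E → ∀ {a b a′ b′ r c} → a < r → b < c → a′ < r → b′ < c →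
  T (E a b) → T (E r b) → T (E a c) → T (E a′ b′) → T (E r b′) → T (E a′ c) → a ≡ a′ ⊎ b ≡ b′
corners-share free {a} {b} {a′} {b′} a<r b<c a′<r b′<c ab rb ac ab′ rb′ ac′ with b ≟ b′ | <-cmp a a′
... | yes b≡b′ | _              = inj₂ b≡b′
... | no b≢b′  | tri< a<a′ _ _  = ⊥-elim (free a<a′ a′<r b′<c b≢b′ (<⇒≢ b<c) ab ac ab′ ac′ rb′ rb)
... | no b≢b′  | tri≈ _ a≡a′ _  = inj₁ a≡a′
... | no b≢b′  | tri> _ _ a′<a  = ⊥-elim (free a′<a a<r b<c (≢-sym b≢b′) (<⇒≢ b′<c) ab′ ac′ ab ac rb rb′)

-- Paths from an entry into the next blocks of its row and column

module Paths (d : ℕ) .{{_ : NonZero d}} (n : ℕ) where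

  open Blocks d public
  open ≤-Reasoning

  -- Columns are always treated as rows of `flip E`, so that one argument serves both directions.
  right up : Matrix → ℕ → ℕ → ℕ → Bool
  right E a b = inBlock (E a) (suc (blk (E a) b))
  up E a b r = right (flip E) b a r

  sameBlock : Matrix → ℕ → ℕ → ℕ → Bool
  sameBlock E a b = inBlock (E a) (blk (E a) b)

  -- For paths with a common end `(r , c)`, `c` lies in the block following that of each corner.
  -- Corners of one row `a` therefore lie in one block, which is why only `b′` in the block of `b`
  -- are counted.
  multiplicity : Matrix → ℕ → ℕ → ℕ → ℕ
  multiplicity E a b r = ∑[ b′ < n ] ⟦ sameBlock E a b b′ ∧ up E a b′ r ⟧

  thick : Matrix → ℕ → ℕ → ℕ → Bool
  thick E a b r = 5 ≤ᵇ multiplicity E a b r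

  module _ (E : Matrix) where

    right⇒edge : ∀ a b c → T (right E a b c) → T (E a c)
    right⇒edge a b c p = proj₁ (split {E a c} p)

    right⇒< : ∀ a b c → T (right E a b c) → b < c
    right⇒< a b c = nextBlock⇒< (E a) b c

    right⇒sameBlock : ∀ {a b b′ c} → T (E a b′) → T (right E a b c) → T (right E a b′ c) → T (sameBlock E a b b′)
    right⇒sameBlock {a} {b} {b′} {c} e p q = join {E a b′} e (≡⇒≡ᵇ (blk (E a) b′) (blk (E a) b) (suc-injective (trans
      (sym (≡ᵇ⇒≡ (blk (E a) c) (suc (blk (E a) b′)) (proj₂ (split {E a c} q)))) (≡ᵇ⇒≡ (blk (E a) c) (suc (blk (E a) b)) (proj₂ (split {E a c} p))))))

    thick⇒third : ∀ {a b r} → T (thick E a b r) → ∀ y z → ∃[ x ] T (E a x) × T (up E a x r) × x ≢ y × x ≢ z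
    thick⇒third {a} {b} {r} t y z =
      let (x , p , x≢y , x≢z) = third n y z (≤-trans (s≤s (s≤s (s≤s z≤n))) (≤ᵇ⇒≤ 5 _ t))
          (q , u) = split {sameBlock E a b x} p
      in x , proj₁ (split {E a x} q) , u , x≢y , x≢z

  up⇒edge : ∀ E a b r → T (up E a b r) → T (E r b)
  up⇒edge E a b r = right⇒edge (flip E) b a r

  up⇒< : ∀ E a b r → T (up E a b r) → a < r
  up⇒< E a b r = right⇒< (flip E) b a r

  -- If the rows differ, thickness of the larger one supplies a third column `x` that it shares with
  -- row `a`; the smaller one is then the middle row of `ThickFree`.
  thick-unique : ∀ {E} → ThickFree E → ∀ {a b b′ r s} → b ≢ b′ → T (E a b) → T (E a b′) →
    T (up E a b r) → T (up E a b′ r) → T (thick E a b r) →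
    T (up E a b s) → T (up E a b′ s) → T (thick E a b s) → r ≡ s
  thick-unique {E} free {a} {b} {b′} {r} {s} b≢b′ ab ab′ ur ur′ tr us us′ ts with <-cmp r s
  ... | tri< r<s _ _ = let (x , ax , ux , x≢b , x≢b′) = thick⇒third E {b = b} ts b b′ in
    ⊥-elim (free (up⇒< E a b r ur) r<s b≢b′ x≢b x≢b′ ab ab′ ax (up⇒edge E a b r ur) (up⇒edge E a b′ r ur′) (up⇒edge E a b s us) (up⇒edge E a b′ s us′) (up⇒edge E a x s ux))
  ... | tri≈ _ r≡s _ = r≡s
  ... | tri> _ _ s<r = let (x , ax , ux , x≢b , x≢b′) = thick⇒third E {b = b} tr b b′ in
    ⊥-elim (free (up⇒< E a b s us) s<r b≢b′ x≢b x≢b′ ab ab′ ax (up⇒edge E a b s us) (up⇒edge E a b′ s us′) (up⇒edge E a b r ur) (up⇒edge E a b′ r ur′) (up⇒edge E a x r ux))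

  thickStep : Matrix → ℕ → ℕ → ℕ → Bool
  thickStep E a b r = E a b ∧ (up E a b r ∧ thick E a b r)

  entries : Matrix → ℕ
  entries E = ∑[ a < n ] ∑[ b < n ] ⟦ E a b ⟧

  -- A pair of entries b, b′ in one block of row a lies in at most one thick row, and every thick step
  -- from b takes part in at least four such pairs.
  ∑-thickStep-row : ∀ {E} → ThickFree E → ∀ a → 4 * ∑[ b < n ] ∑[ r < n ] ⟦ thickStep E a b r ⟧ ≤ ∑[ b < n ] ⟦ E a b ⟧ * d
  ∑-thickStep-row {E} free a = begin
    4 * ∑[ b < n ] ∑[ r < n ] ⟦ thickStep E a b r ⟧               ≡⟨ ∑-*ˡ n 4 _ ⟨
    ∑[ b < n ] (4 * ∑[ r < n ] ⟦ thickStep E a b r ⟧)             ≡⟨ ∑-cong n (λ b → sym (∑-*ˡ n 4 _)) ⟩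
    ∑[ b < n ] ∑[ r < n ] (4 * ⟦ thickStep E a b r ⟧)             ≤⟨ ∑-mono n (λ b → ∑-mono n (λ r → fourPairs b r)) ⟩
    ∑[ b < n ] ∑[ r < n ] ∑[ b′ < n ] ⟦ pair b b′ r ⟧             ≡⟨ ∑-cong n (λ b → ∑-swap n n _) ⟩
    ∑[ b < n ] ∑[ b′ < n ] ∑[ r < n ] ⟦ pair b b′ r ⟧             ≤⟨ ∑-mono n (λ b → ∑-mono n (λ b′ → oneRow b b′)) ⟩
    ∑[ b < n ] ∑[ b′ < n ] (⟦ E a b ⟧ * ⟦ sameBlock E a b b′ ⟧)   ≡⟨ ∑-cong n (λ b → ∑-*ˡ n ⟦ E a b ⟧ _) ⟩
    ∑[ b < n ] (⟦ E a b ⟧ * ∑[ b′ < n ] ⟦ sameBlock E a b b′ ⟧)   ≤⟨ ∑-mono n (λ b → *-monoʳ-≤ ⟦ E a b ⟧ (∑-inBlock≤ (E a) n _)) ⟩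
    ∑[ b < n ] (⟦ E a b ⟧ * d)                                    ≡⟨ ∑-*ʳ n _ d ⟩
    ∑[ b < n ] ⟦ E a b ⟧ * d                                      ∎
    where
    pair : ℕ → ℕ → ℕ → Bool
    pair b b′ r = not (b′ ≡ᵇ b) ∧ ((E a b ∧ sameBlock E a b b′) ∧ (up E a b′ r ∧ (up E a b r ∧ thick E a b r)))

    fourPairs : ∀ b r → 4 * ⟦ thickStep E a b r ⟧ ≤ ∑[ b′ < n ] ⟦ pair b b′ r ⟧
    fourPairs b r with T? (thickStep E a b r)
    ... | no ¬p = ≤-trans (≤-reflexive (cong (4 *_) (⟦⟧-false ¬p))) z≤n
    -- One of the five corners may be `b` itself, so five are needed for four genuine pairs.
    ... | yes p = ≤-trans (*-monoʳ-≤ 4 (⟦⟧≤1 (thickStep E a b r))) (+-cancelʳ-≤ 1 4 _ (begin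
      5                                                                     ≤⟨ ≤ᵇ⇒≤ 5 _ t ⟩
      ∑[ b′ < n ] ⟦ sameBlock E a b b′ ∧ up E a b′ r ⟧                      ≤⟨ ∑-mono n cover ⟩
      ∑[ b′ < n ] (⟦ pair b b′ r ⟧ + ⟦ b′ ≡ᵇ b ⟧)                           ≡⟨ ∑-+ n _ _ ⟩
      ∑[ b′ < n ] ⟦ pair b b′ r ⟧ + ∑[ b′ < n ] ⟦ b′ ≡ᵇ b ⟧                 ≤⟨ +-monoʳ-≤ _ (∑-point n b) ⟩
      ∑[ b′ < n ] ⟦ pair b b′ r ⟧ + 1                                       ∎))
      where
      e : T (E a b)
      e = proj₁ (split {E a b} p)
      u : T (up E a b r)
      u = proj₁ (split {up E a b r} (proj₂ (split {E a b} p)))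
      t : T (thick E a b r)
      t = proj₂ (split {up E a b r} (proj₂ (split {E a b} p)))
      cover : ∀ b′ → ⟦ sameBlock E a b b′ ∧ up E a b′ r ⟧ ≤ ⟦ pair b b′ r ⟧ + ⟦ b′ ≡ᵇ b ⟧
      cover b′ with T? (b′ ≡ᵇ b)
      ... | yes eq = ≤-trans (⟦⟧≤1 (sameBlock E a b b′ ∧ up E a b′ r)) (≤-trans (≤-reflexive (sym (⟦⟧-true eq))) (m≤n+m _ _))
      ... | no neq = ≤-trans (⟦⟧-mono {sameBlock E a b b′ ∧ up E a b′ r} {pair b b′ r} (λ q →
              let (sb , ub′) = split {sameBlock E a b b′} q in
              join {not (b′ ≡ᵇ b)} (T-not neq) (join {E a b ∧ sameBlock E a b b′} (join {E a b} e sb)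
                (join {up E a b′ r} ub′ (join {up E a b r} u t))))) (m≤m+n _ _)

    oneRow : ∀ b b′ → ∑[ r < n ] ⟦ pair b b′ r ⟧ ≤ ⟦ E a b ⟧ * ⟦ sameBlock E a b b′ ⟧
    oneRow b b′ with T? (E a b ∧ sameBlock E a b b′)
    ... | no ¬p = ≤-trans (≤-reflexive (∑-empty n (λ r q → ¬p (proj₁ (split {E a b ∧ sameBlock E a b b′} (proj₂ (split {not (b′ ≡ᵇ b)} q))))))) z≤n
    ... | yes p = ≤-trans (∑-atMostOne n unique) (≤-reflexive (sym (trans (sym (⟦∧⟧ (E a b) _)) (⟦⟧-true p))))
      where
      unique : ∀ r s → r < n → s < n → T (pair b b′ r) → T (pair b b′ s) → r ≡ s
      unique r s _ _ pr ps =
        let (b′≢b , qr) = split {not (b′ ≡ᵇ b)} pr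
            (ab , sb)   = split {E a b} p
            ab′         = proj₁ (split {E a b′} sb)
            (ur′ , vr)  = split {up E a b′ r} (proj₂ (split {E a b ∧ sameBlock E a b b′} qr))
            (ur , tr)   = split {up E a b r} vr
            (us′ , vs)  = split {up E a b′ s} (proj₂ (split {E a b ∧ sameBlock E a b b′} (proj₂ (split {not (b′ ≡ᵇ b)} ps))))
            (us , ts)   = split {up E a b s} vs
        in thick-unique {E} free (λ eq → T-not⁻ b′≢b (≡⇒≡ᵇ b′ b (sym eq))) ab ab′ ur ur′ tr us us′ ts

  thickPaths : Matrix → ℕ
  thickPaths E = ∑[ a < n ] ∑[ b < n ] ∑[ r < n ] ∑[ c < n ] (⟦ thickStep E a b r ⟧ * ⟦ right E a b c ⟧)

  thickPaths≤ : ∀ {E} → ThickFree E → 4 * thickPaths E ≤ entries E * (d * d)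
  thickPaths≤ {E} free = begin
    4 * thickPaths E                                                   ≤⟨ *-monoʳ-≤ 4 (∑-mono n (λ a → ∑-mono n (λ b → ∑-mono n (λ r → inner a b r)))) ⟩
    4 * ∑[ a < n ] ∑[ b < n ] ∑[ r < n ] (⟦ thickStep E a b r ⟧ * d)   ≡⟨ cong (4 *_) (∑-cong n (λ a → trans (∑-cong n (λ b → ∑-*ʳ n _ d)) (∑-*ʳ n _ d))) ⟩
    4 * ∑[ a < n ] (∑[ b < n ] ∑[ r < n ] ⟦ thickStep E a b r ⟧ * d)   ≡⟨ ∑-*ˡ n 4 _ ⟨
    ∑[ a < n ] (4 * (∑[ b < n ] ∑[ r < n ] ⟦ thickStep E a b r ⟧ * d)) ≡⟨ ∑-cong n (λ a → *-assoc 4 (∑[ b < n ] ∑[ r < n ] ⟦ thickStep E a b r ⟧) d) ⟨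
    ∑[ a < n ] (4 * ∑[ b < n ] ∑[ r < n ] ⟦ thickStep E a b r ⟧ * d)   ≤⟨ ∑-mono n (λ a → *-monoˡ-≤ d (∑-thickStep-row free a)) ⟩
    ∑[ a < n ] (∑[ b < n ] ⟦ E a b ⟧ * d * d)                          ≡⟨ ∑-cong n (λ a → *-assoc (∑[ b < n ] ⟦ E a b ⟧) d d) ⟩
    ∑[ a < n ] (∑[ b < n ] ⟦ E a b ⟧ * (d * d))                        ≡⟨ ∑-*ʳ n _ (d * d) ⟩
    entries E * (d * d)                                                ∎
    where
    inner : ∀ a b r → ∑[ c < n ] (⟦ thickStep E a b r ⟧ * ⟦ right E a b c ⟧) ≤ ⟦ thickStep E a b r ⟧ * d
    inner a b r = ≤-trans (≤-reflexive (∑-*ˡ n ⟦ thickStep E a b r ⟧ _)) (*-monoʳ-≤ ⟦ thickStep E a b r ⟧ (∑-inBlock≤ (E a) n _))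

  path thinPath : Matrix → ℕ → ℕ → ℕ → ℕ → Bool
  path E a b r c = E a b ∧ (up E a b r ∧ right E a b c)
  thinPath E a b r c = path E a b r c ∧ (not (thick E a b r) ∧ not (thick (flip E) b a c))

  module _ {E : Matrix} (free : HexagonFree E) where

    thinPath-unpack : ∀ {a b r c} → T (thinPath E a b r c) →
      T (E a b) × T (up E a b r) × T (right E a b c) × multiplicity E a b r ≤ 4 × multiplicity (flip E) b a c ≤ 4
    thinPath-unpack {a} {b} {r} {c} p =
      let (q , s) = split {path E a b r c} p
          (e , q′) = split {E a b} q
          (u , v) = split {up E a b r} q′
          (t , t′) = split {not (thick E a b r)} s
      in e , u , v , thin t , thin t′
      where
      thin : ∀ {m} → T (not (5 ≤ᵇ m)) → m ≤ 4
      thin t = ≤-pred (≰⇒> (λ 5≤m → T-not⁻ t (≤⇒≤ᵇ 5≤m)))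

    -- Fix one corner `(a₀ , b₀)`. By `corners-share` every other corner lies in row `a₀` or column
    -- `b₀`, and thinness of the fixed path bounds each of these two sets by four.
    ∑-thinPath : ∀ r c → ∑[ a < n ] ∑[ b < n ] ⟦ thinPath E a b r c ⟧ ≤ 8
    ∑-thinPath r c with ∑[ a < n ] ∑[ b < n ] ⟦ thinPath E a b r c ⟧ in eq
    ... | zero  = z≤n
    ... | suc _ with ∑-positive n (subst (0 <_) (sym eq) (s≤s z≤n))
    ...   | a₀ , p₀ with ∑-positive n p₀
    ...     | b₀ , q₀ = begin
      _                                                   ≡⟨ eq ⟨
      ∑[ a < n ] ∑[ b < n ] ⟦ Q a b ⟧                     ≤⟨ ∑-mono n (λ a → ∑-mono n (λ b → cross a b)) ⟩
      ∑[ a < n ] ∑[ b < n ] (⟦ a ≡ᵇ a₀ ⟧ * ⟦ Q a₀ b ⟧ + ⟦ Q a b₀ ⟧ * ⟦ b ≡ᵇ b₀ ⟧)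
        ≡⟨ trans (∑-cong n (λ a → ∑-+ n _ _)) (∑-+ n _ _) ⟩
      ∑[ a < n ] ∑[ b < n ] (⟦ a ≡ᵇ a₀ ⟧ * ⟦ Q a₀ b ⟧) + ∑[ a < n ] ∑[ b < n ] (⟦ Q a b₀ ⟧ * ⟦ b ≡ᵇ b₀ ⟧)
        ≡⟨ cong₂ _+_ (sym (∑-×-∑ n n _ _)) (sym (∑-×-∑ n n _ _)) ⟩
      ∑[ a < n ] ⟦ a ≡ᵇ a₀ ⟧ * ∑[ b < n ] ⟦ Q a₀ b ⟧ + ∑[ a < n ] ⟦ Q a b₀ ⟧ * ∑[ b < n ] ⟦ b ≡ᵇ b₀ ⟧
        ≤⟨ +-mono-≤ (*-mono-≤ (∑-point n a₀) rowBound) (*-mono-≤ columnBound (∑-point n b₀)) ⟩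
      1 * 4 + 4 * 1                                       ∎
      where
      Q : Matrix
      Q a b = thinPath E a b r c
      Q₀ = thinPath-unpack {a₀} {b₀} (⟦⟧-positive q₀)
      cross : ∀ a b → ⟦ Q a b ⟧ ≤ ⟦ a ≡ᵇ a₀ ⟧ * ⟦ Q a₀ b ⟧ + ⟦ Q a b₀ ⟧ * ⟦ b ≡ᵇ b₀ ⟧
      cross a b with T? (Q a b)
      ... | no ¬q = ≤-trans (≤-reflexive (⟦⟧-false ¬q)) z≤n
      ... | yes q = shared (corners-share {E} free (up⇒< E a b r u) (right⇒< E a b c v) (up⇒< E a₀ b₀ r u₀) (right⇒< E a₀ b₀ c v₀)
                             e (up⇒edge E a b r u) (right⇒edge E a b c v) e₀ (up⇒edge E a₀ b₀ r u₀) (right⇒edge E a₀ b₀ c v₀))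
        where
        Q₁ = thinPath-unpack {a} {b} q
        e = proj₁ Q₁
        u = proj₁ (proj₂ Q₁)
        v = proj₁ (proj₂ (proj₂ Q₁))
        e₀ = proj₁ Q₀
        u₀ = proj₁ (proj₂ Q₀)
        v₀ = proj₁ (proj₂ (proj₂ Q₀))
        shared : a ≡ a₀ ⊎ b ≡ b₀ → ⟦ Q a b ⟧ ≤ ⟦ a ≡ᵇ a₀ ⟧ * ⟦ Q a₀ b ⟧ + ⟦ Q a b₀ ⟧ * ⟦ b ≡ᵇ b₀ ⟧
        shared (inj₁ refl) = ≤-trans (≤-reflexive (sym (trans (cong (_* ⟦ Q a b ⟧) (⟦⟧-true (≡⇒≡ᵇ a a refl))) (*-identityˡ _)))) (m≤m+n _ _)
        shared (inj₂ refl) = ≤-trans (≤-reflexive (sym (trans (cong (⟦ Q a b ⟧ *_) (⟦⟧-true (≡⇒≡ᵇ b b refl))) (*-identityʳ _)))) (m≤n+m _ _)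
      rowBound : ∑[ b < n ] ⟦ Q a₀ b ⟧ ≤ 4
      rowBound = ≤-trans (∑-mono n (λ b → ⟦⟧-mono {Q a₀ b} {sameBlock E a₀ b₀ b ∧ up E a₀ b r} (λ q →
          let (e , u , v , _) = thinPath-unpack {a₀} {b} q in
          join {sameBlock E a₀ b₀ b} (right⇒sameBlock E {a₀} {b₀} {b} {c} e (proj₁ (proj₂ (proj₂ Q₀))) v) u)))
        (proj₁ (proj₂ (proj₂ (proj₂ Q₀))))
      columnBound : ∑[ a < n ] ⟦ Q a b₀ ⟧ ≤ 4
      columnBound = ≤-trans (∑-mono n (λ a → ⟦⟧-mono {Q a b₀} {sameBlock (flip E) b₀ a₀ a ∧ right E a b₀ c} (λ q →
          let (e , u , v , _) = thinPath-unpack {a} {b₀} q in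
          join {sameBlock (flip E) b₀ a₀ a} (right⇒sameBlock (flip E) {b₀} {a₀} {a} {r} e (proj₁ (proj₂ Q₀)) u) v)))
        (proj₂ (proj₂ (proj₂ (proj₂ Q₀))))

    private
      lateInRow lateInColumn : Matrix
      lateInRow a b = E a b ∧ not (early (E a) n b)
      lateInColumn a b = E a b ∧ not (early (flip E b) n a)

      square : ℕ
      square = d * d

    -- An entry that is early in both its row and its column has `d` choices in each direction; any
    -- other entry pays for its missing paths with `square`, and there are few such entries.
    square≤paths : ∀ a b → ⟦ E a b ⟧ * square ≤
      ∑[ r < n ] ∑[ c < n ] ⟦ path E a b r c ⟧ + (⟦ lateInRow a b ⟧ + ⟦ lateInColumn a b ⟧) * square
    square≤paths a b = cases (E a b) (early (E a) n b) (early (flip E b) n a) λ e p q → begin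
      d * d                                                             ≤⟨ *-mono-≤ (d≤∑-nextBlock (flip E b) n {a} q) (d≤∑-nextBlock (E a) n {b} p) ⟩
      ∑[ r < n ] ⟦ up E a b r ⟧ * ∑[ c < n ] ⟦ right E a b c ⟧          ≡⟨ ∑-×-∑ n n _ _ ⟩
      ∑[ r < n ] ∑[ c < n ] (⟦ up E a b r ⟧ * ⟦ right E a b c ⟧)        ≤⟨ ∑-mono n (λ r → ∑-mono n (λ c → ≤-reflexive (sym (⟦∧⟧ (up E a b r) (right E a b c))))) ⟩
      ∑[ r < n ] ∑[ c < n ] ⟦ up E a b r ∧ right E a b c ⟧              ≤⟨ ∑-mono n (λ r → ∑-mono n (λ c → ⟦⟧-mono {up E a b r ∧ right E a b c} {path E a b r c} (join {E a b} e))) ⟩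
      ∑[ r < n ] ∑[ c < n ] ⟦ path E a b r c ⟧                          ∎
      where
      cases : ∀ e p q {m} → (T e → T p → T q → square ≤ m) → ⟦ e ⟧ * square ≤ m + (⟦ e ∧ not p ⟧ + ⟦ e ∧ not q ⟧) * square
      cases false _     _     _ = z≤n
      cases true  false q     {m} _ = ≤-trans (*-monoˡ-≤ square (m≤m+n 1 ⟦ not q ⟧)) (m≤n+m _ m)
      cases true  true  false {m} _ = m≤n+m (1 * square) m
      cases true  true  true  h = ≤-trans (≤-reflexive (*-identityˡ square)) (≤-trans (h tt tt tt) (m≤m+n _ _))

    path≤ : ∀ a b r c → ⟦ path E a b r c ⟧ ≤ ⟦ thinPath E a b r c ⟧ +
      (⟦ thickStep E a b r ⟧ * ⟦ right E a b c ⟧ + ⟦ thickStep (flip E) b a c ⟧ * ⟦ right (flip E) b a r ⟧)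
    path≤ a b r c = cases (E a b) (up E a b r) (right E a b c) (thick E a b r) (thick (flip E) b a c)
      where
      cases : ∀ e u v t t′ → ⟦ e ∧ (u ∧ v) ⟧ ≤ ⟦ (e ∧ (u ∧ v)) ∧ (not t ∧ not t′) ⟧ + (⟦ e ∧ (u ∧ t) ⟧ * ⟦ v ⟧ + ⟦ e ∧ (v ∧ t′) ⟧ * ⟦ u ⟧)
      cases false _     _     _     _     = z≤n
      cases true  false _     _     _     = z≤n
      cases true  true  false _     _     = z≤n
      cases true  true  true  true  _     = s≤s z≤n
      cases true  true  true  false true  = s≤s z≤n
      cases true  true  true  false false = s≤s z≤n

    ∑-path≤ : ∑[ a < n ] ∑[ b < n ] ∑[ r < n ] ∑[ c < n ] ⟦ path E a b r c ⟧ ≤ n * (n * 8) + (thickPaths E + thickPaths (flip E))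
    ∑-path≤ = begin
      ∑[ a < n ] ∑[ b < n ] ∑[ r < n ] ∑[ c < n ] ⟦ path E a b r c ⟧
        ≤⟨ ∑-mono n (λ a → ∑-mono n (λ b → ∑-mono n (λ r → ∑-mono n (λ c → path≤ a b r c)))) ⟩
      ∑[ a < n ] ∑[ b < n ] ∑[ r < n ] ∑[ c < n ] (X a b r c + (Y a b r c + Z a b r c))
        ≡⟨ trans (∑⁴-+ X (λ a b r c → Y a b r c + Z a b r c)) (cong (∑⁴ X +_) (∑⁴-+ Y Z)) ⟩
      ∑⁴ X + (∑⁴ Y + ∑⁴ Z)
        ≡⟨ cong₂ (λ x z → x + (∑⁴ Y + z)) (∑⁴-rotate X) (∑⁴-flip Z) ⟩
      ∑[ r < n ] ∑[ c < n ] ∑[ a < n ] ∑[ b < n ] X a b r c + (thickPaths E + thickPaths (flip E))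
        ≤⟨ +-monoˡ-≤ _ (∑-≤-const n (n * 8) (λ r → ∑-≤-const n 8 (λ c → ∑-thinPath r c))) ⟩
      n * (n * 8) + (thickPaths E + thickPaths (flip E)) ∎
      where
      ∑⁴ : (ℕ → ℕ → ℕ → ℕ → ℕ) → ℕ
      ∑⁴ f = ∑[ a < n ] ∑[ b < n ] ∑[ r < n ] ∑[ c < n ] f a b r c
      X Y Z : ℕ → ℕ → ℕ → ℕ → ℕ
      X a b r c = ⟦ thinPath E a b r c ⟧
      Y a b r c = ⟦ thickStep E a b r ⟧ * ⟦ right E a b c ⟧
      Z a b r c = ⟦ thickStep (flip E) b a c ⟧ * ⟦ right (flip E) b a r ⟧
      ∑⁴-+ : ∀ f g → ∑⁴ (λ a b r c → f a b r c + g a b r c) ≡ ∑⁴ f + ∑⁴ g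
      ∑⁴-+ f g = trans (∑-cong n (λ a → trans (∑-cong n (λ b → trans (∑-cong n (λ r → ∑-+ n _ _)) (∑-+ n _ _))) (∑-+ n _ _))) (∑-+ n _ _)
      ∑⁴-rotate : ∀ f → ∑⁴ f ≡ ∑[ r < n ] ∑[ c < n ] ∑[ a < n ] ∑[ b < n ] f a b r c
      ∑⁴-rotate f = begin-equality
        ∑⁴ f                                                            ≡⟨ ∑-cong n (λ a → ∑-swap n n _) ⟩
        ∑[ a < n ] ∑[ r < n ] ∑[ b < n ] ∑[ c < n ] f a b r c           ≡⟨ ∑-swap n n _ ⟩
        ∑[ r < n ] ∑[ a < n ] ∑[ b < n ] ∑[ c < n ] f a b r c           ≡⟨ ∑-cong n (λ r → ∑-cong n (λ a → ∑-swap n n _)) ⟩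
        ∑[ r < n ] ∑[ a < n ] ∑[ c < n ] ∑[ b < n ] f a b r c           ≡⟨ ∑-cong n (λ r → ∑-swap n n _) ⟩
        ∑[ r < n ] ∑[ c < n ] ∑[ a < n ] ∑[ b < n ] f a b r c           ∎
      ∑⁴-flip : ∀ f → ∑⁴ f ≡ ∑[ b < n ] ∑[ a < n ] ∑[ c < n ] ∑[ r < n ] f a b r c
      ∑⁴-flip f = trans (∑-swap n n _) (∑-cong n (λ b → ∑-cong n (λ a → ∑-swap n n _)))

    ∑-late≤₂ : ∑[ a < n ] ∑[ b < n ] (⟦ lateInRow a b ⟧ + ⟦ lateInColumn a b ⟧) ≤ n * (2 * d) + n * (2 * d)
    ∑-late≤₂ = begin
      ∑[ a < n ] ∑[ b < n ] (⟦ lateInRow a b ⟧ + ⟦ lateInColumn a b ⟧)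
        ≡⟨ trans (∑-cong n (λ a → ∑-+ n _ _)) (∑-+ n _ _) ⟩
      ∑[ a < n ] ∑[ b < n ] ⟦ lateInRow a b ⟧ + ∑[ a < n ] ∑[ b < n ] ⟦ lateInColumn a b ⟧
        ≡⟨ cong (∑[ a < n ] ∑[ b < n ] ⟦ lateInRow a b ⟧ +_) (∑-swap n n _) ⟩
      ∑[ a < n ] ∑[ b < n ] ⟦ lateInRow a b ⟧ + ∑[ b < n ] ∑[ a < n ] ⟦ lateInColumn a b ⟧
        ≤⟨ +-mono-≤ (∑-≤-const n (2 * d) (λ a → ∑-late≤ (E a) n)) (∑-≤-const n (2 * d) (λ b → ∑-late≤ (flip E b) n)) ⟩
      n * (2 * d) + n * (2 * d) ∎

    entries*square≤ : entries E * square ≤ (n * (n * 8) + (thickPaths E + thickPaths (flip E))) + (n * (2 * d) + n * (2 * d)) * square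
    entries*square≤ = begin
      entries E * square
        ≡⟨ trans (sym (∑-*ʳ n _ square)) (∑-cong n (λ a → sym (∑-*ʳ n _ square))) ⟩
      ∑[ a < n ] ∑[ b < n ] (⟦ E a b ⟧ * square)
        ≤⟨ ∑-mono n (λ a → ∑-mono n (λ b → square≤paths a b)) ⟩
      ∑[ a < n ] ∑[ b < n ] (∑[ r < n ] ∑[ c < n ] ⟦ path E a b r c ⟧ + (⟦ lateInRow a b ⟧ + ⟦ lateInColumn a b ⟧) * square)
        ≡⟨ trans (∑-cong n (λ a → trans (∑-+ n _ _) (cong (∑[ b < n ] ∑[ r < n ] ∑[ c < n ] ⟦ path E a b r c ⟧ +_) (∑-*ʳ n _ square)))) (∑-+ n _ _) ⟩
      ∑[ a < n ] ∑[ b < n ] ∑[ r < n ] ∑[ c < n ] ⟦ path E a b r c ⟧ + ∑[ a < n ] (∑[ b < n ] (⟦ lateInRow a b ⟧ + ⟦ lateInColumn a b ⟧) * square)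
        ≡⟨ cong (∑[ a < n ] ∑[ b < n ] ∑[ r < n ] ∑[ c < n ] ⟦ path E a b r c ⟧ +_) (∑-*ʳ n _ square) ⟩
      ∑[ a < n ] ∑[ b < n ] ∑[ r < n ] ∑[ c < n ] ⟦ path E a b r c ⟧ + ∑[ a < n ] ∑[ b < n ] (⟦ lateInRow a b ⟧ + ⟦ lateInColumn a b ⟧) * square
        ≤⟨ +-mono-≤ ∑-path≤ (*-monoˡ-≤ square ∑-late≤₂) ⟩
      _ ∎

    -- Both kinds of thick paths together use up `2 * x` of `4 * x`. Those of `flip E` are bounded
    -- by `entries (flip E)`, which is `entries E` with the summations exchanged.
    entries*square≤′ : entries E * square ≤ 16 * (n * n) + 8 * (n * (d * square))
    entries*square≤′ = *-cancelˡ-≤ 2 (+-cancelʳ-≤ (2 * x) (2 * x) _ (begin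
      2 * x + 2 * x                                        ≡⟨ double x ⟩
      4 * x                                                ≤⟨ *-monoʳ-≤ 4 entries*square≤ ⟩
      4 * ((n * (n * 8) + (p + q)) + (n * (2 * d) + n * (2 * d)) * square)  ≡⟨ expand n d square p q ⟩
      (4 * p + 4 * q) + 2 * (16 * (n * n) + 8 * (n * (d * square)))         ≤⟨ +-monoˡ-≤ _ (+-mono-≤ (thickPaths≤ (thickFree {E} free)) (thickPaths≤ (thickFree-flip {E} free))) ⟩
      (x + entries (flip E) * square) + 2 * (16 * (n * n) + 8 * (n * (d * square)))  ≡⟨ cong (λ z → (x + z * square) + 2 * (16 * (n * n) + 8 * (n * (d * square)))) (∑-swap n n _) ⟩
      (x + x) + 2 * (16 * (n * n) + 8 * (n * (d * square)))               ≡⟨ collect x _ ⟩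
      2 * (16 * (n * n) + 8 * (n * (d * square))) + 2 * x    ∎))
      where
      x p q : ℕ
      x = entries E * square
      p = thickPaths E
      q = thickPaths (flip E)
      double : ∀ x → 2 * x + 2 * x ≡ 4 * x
      double = solve-∀
      expand : ∀ n d s p q → 4 * ((n * (n * 8) + (p + q)) + (n * (2 * d) + n * (2 * d)) * s) ≡ (4 * p + 4 * q) + 2 * (16 * (n * n) + 8 * (n * (d * s)))
      expand = solve-∀
      collect : ∀ x y → (x + x) + y ≡ y + 2 * x
      collect = solve-∀

-- At side `d³` the term `n²` from the ends and the term `n d³` from the late entries are both `d⁶`,
-- and 24 = 16 + 8.
entries≤ : ∀ d .{{_ : NonZero d}} {E} → HexagonFree E → ∑[ a < d * (d * d) ] ∑[ b < d * (d * d) ] ⟦ E a b ⟧ ≤ 24 * (d * (d * (d * d)))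
entries≤ d {E} free = *-cancelʳ-≤ _ _ (d * d) {{m*n≢0 d d}} (≤-trans (entries*square≤′ {E} free) (≤-reflexive (powers d)))
  where
  open Paths d (d * (d * d))
  powers : ∀ d → 16 * ((d * (d * d)) * (d * (d * d))) + 8 * ((d * (d * d)) * (d * (d * d))) ≡ 24 * (d * (d * (d * d))) * (d * d)
  powers = solve-∀

-- From ordered graphs to matrices

module _ {A : Set} {P : Pred A 0ℓ} (P? : Decidable P) where

  count : List A → ℕ
  count xs = length (filter P? xs)

  count-∷ : ∀ x xs → count (x ∷ xs) ≡ ⟦ does (P? x) ⟧ + count xs
  count-∷ x xs with does (P? x)
  ... | true  = refl
  ... | false = refl

  count-++ : ∀ xs ys → count (xs ++ ys) ≡ count xs + count ys
  count-++ xs ys = trans (cong length (filter-++ P? xs ys)) (length-++ (filter P? xs))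

  count-map-tabulate : ∀ {B : Set} n (g : B → A) (f : Fin n → B) (h : ℕ → ℕ) → (∀ i → ⟦ does (P? (g (f i))) ⟧ ≡ h (toℕ i)) →
    count (map g (tabulate f)) ≡ ∑ n h
  count-map-tabulate zero    g f h _  = refl
  count-map-tabulate (suc n) g f h eq = trans (count-∷ (g (f zero)) _)
    (trans (cong₂ _+_ (eq zero) (count-map-tabulate n g (f ∘ suc) (h ∘ suc) (eq ∘ suc))) (sym (∑-front n h)))

count-cartesianProduct : ∀ {A B : Set} {P : Pred (A × B) 0ℓ} (P? : Decidable P) m n (f : Fin m → A) (g : Fin n → B) (h : ℕ → ℕ → ℕ) →
  (∀ i j → ⟦ does (P? (f i , g j)) ⟧ ≡ h (toℕ i) (toℕ j)) →
  count P? (cartesianProduct (tabulate f) (tabulate g)) ≡ ∑[ i < m ] ∑[ j < n ] h i j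
count-cartesianProduct P? zero    n f g h _  = refl
count-cartesianProduct P? (suc m) n f g h eq = trans (count-++ P? (map (f zero ,_) (tabulate g)) _)
  (trans (cong₂ _+_ (count-map-tabulate P? n (f zero ,_) g (h 0) (eq zero)) (count-cartesianProduct P? m n (f ∘ suc) g (h ∘ suc) (eq ∘ suc)))
         (sym (∑-front m (λ i → ∑ n (h i)))))

extend : ∀ {n} → (Fin n → Bool) → ℕ → Bool
extend {n} f i with i <? n
... | yes i<n = f (fromℕ< i<n)
... | no  _   = false

extend-toℕ : ∀ {n} (f : Fin n → Bool) i → extend f (toℕ i) ≡ f i
extend-toℕ {n} f i with toℕ i <? n
... | yes i<n = cong f (Fin.fromℕ<-toℕ i i<n)
... | no  i≮n = contradiction (Fin.toℕ<n i) i≮n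

extend⁻ : ∀ {n} (f : Fin n → Bool) {i} → T (extend f i) → ∃[ k ] toℕ k ≡ i × T (f k)
extend⁻ {n} f {i} p with i <? n
... | yes i<n = fromℕ< i<n , Fin.toℕ-fromℕ< i<n , p

upper : ∀ {n} → OrderedGraph n → Matrix
upper G i j = (i <ᵇ j) ∧ extend (λ u → extend (OrderedGraph.adj G u) j) i

edgeCount≡∑ : ∀ {n} (G : OrderedGraph n) → edgeCount G ≡ ∑[ i < n ] ∑[ j < n ] ⟦ upper G i j ⟧
edgeCount≡∑ {n} G = count-cartesianProduct (λ (i , j) → i Fin.<? j ×-dec T? (OrderedGraph.adj G i j)) n n (λ i → i) (λ j → j) (λ i j → ⟦ upper G i j ⟧) (λ i j →
  cong (λ b → ⟦ (toℕ i <ᵇ toℕ j) ∧ b ⟧) (sym (trans (extend-toℕ _ i) (extend-toℕ _ j))))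

upper⇒adj : ∀ {n} (G : OrderedGraph n) {i j} → T (upper G i j) →
  i < j × Σ[ u ∈ Fin n ] Σ[ v ∈ Fin n ] toℕ u ≡ i × toℕ v ≡ j × Adj G u v
upper⇒adj G {i} {j} p =
  let (l , q)      = split {i <ᵇ j} p
      (u , eq , r) = extend⁻ _ q
      (v , eq′ , e) = extend⁻ _ r
  in <ᵇ⇒< i j l , u , v , eq , eq′ , e

record Hexagon {n} (G : OrderedGraph n) : Set where
  constructor hexagon
  field
    {u₁ u₂ u₃ v₁ v₂ v₃} : Fin n
    u₁<u₂ : u₁ Fin.< u₂
    u₂<u₃ : u₂ Fin.< u₃
    u₃<v₁ : u₃ Fin.< v₁
    u₃<v₂ : u₃ Fin.< v₂
    v₁<v₃ : v₁ Fin.< v₃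
    v₂≢v₁ : v₂ ≢ v₁
    v₂≢v₃ : v₂ ≢ v₃
    u₁v₂  : Adj G u₁ v₂
    u₁v₃  : Adj G u₁ v₃
    u₂v₁  : Adj G u₂ v₁
    u₂v₃  : Adj G u₂ v₃
    u₃v₁  : Adj G u₃ v₁
    u₃v₂  : Adj G u₃ v₂

OrderedHexagonFree : Matrix → Set
OrderedHexagonFree E = ∀ {r₁ r₂ r₃ c₁ c₂ c₃} → r₁ < r₂ → r₂ < r₃ → r₃ < c₁ → r₃ < c₂ → c₁ < c₃ → c₂ ≢ c₁ → c₂ ≢ c₃ →
  T (E r₁ c₂) → T (E r₁ c₃) → T (E r₂ c₁) → T (E r₂ c₃) → T (E r₃ c₁) → T (E r₃ c₂) → ⊥

upper-hexagonFree : ∀ {n} (G : OrderedGraph n) → ¬ Hexagon G → OrderedHexagonFree (upper G)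
upper-hexagonFree G none {r₁} {r₂} {r₃} {c₁} {c₂} {c₃} r₁<r₂ r₂<r₃ r₃<c₁ r₃<c₂ c₁<c₃ c₂≢c₁ c₂≢c₃ r₁c₂ r₁c₃ r₂c₁ r₂c₃ r₃c₁ r₃c₂
  with upper⇒adj G r₁c₂ | upper⇒adj G r₂c₁ | upper⇒adj G r₁c₃ | upper⇒adj G r₂c₃ | upper⇒adj G r₃c₁ | upper⇒adj G r₃c₂
... | _ , u₁ , v₂ , refl , refl , e₁₂ | _ , u₂ , v₁ , refl , refl , e₂₁ | _ , u₁′ , v₃ , eq₁ , refl , e₁₃
    | _ , u₂′ , v₃′ , eq₂ , eq₃ , e₂₃ | _ , u₃ , v₁′ , refl , eq₄ , e₃₁ | _ , u₃′ , v₂′ , eq₅ , eq₆ , e₃₂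
  -- Each entry brings its own two endpoints; vertices with the same number are identified here.
  with refl ← Fin.toℕ-injective eq₁ | refl ← Fin.toℕ-injective eq₂ | refl ← Fin.toℕ-injective eq₃
     | refl ← Fin.toℕ-injective eq₄ | refl ← Fin.toℕ-injective eq₅ | refl ← Fin.toℕ-injective eq₆
  = none (hexagon r₁<r₂ r₂<r₃ r₃<c₁ r₃<c₂ c₁<c₃ (c₂≢c₁ ∘ cong toℕ) (c₂≢c₃ ∘ cong toℕ) e₁₂ e₁₃ e₂₁ e₂₃ e₃₁ e₃₂)

-- Entries outside the square are cleared because `HexagonFree` quantifies over all indices.
-- Together with `s + m ≤ t` this places each row that has an entry before every column.
window : ℕ → ℕ → ℕ → Matrix → Matrix
window m s t E i j = (i <ᵇ m) ∧ ((j <ᵇ m) ∧ E (s + i) (t + j))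

window-unpack : ∀ m s t E {i j} → T (window m s t E i j) → i < m × T (E (s + i) (t + j))
window-unpack m s t E {i} {j} p =
  let (i<m , q) = split {i <ᵇ m} p in <ᵇ⇒< i m i<m , proj₂ (split {j <ᵇ m} q)

window-hexagonFree : ∀ {E} → OrderedHexagonFree E → ∀ m s t → s + m ≤ t → HexagonFree (window m s t E)
window-hexagonFree {E} free m s t s+m≤t {r₁} {r₂} {r₃} {c₁} {c₂} {c₃} r₁<r₂ r₂<r₃ c₁<c₃ c₂≢c₁ c₂≢c₃ r₁c₂ r₁c₃ r₂c₁ r₂c₃ r₃c₁ r₃c₂ =
  free (+-monoʳ-< s r₁<r₂) (+-monoʳ-< s r₂<r₃) (across c₁) (across c₂) (+-monoʳ-< t c₁<c₃)
    (c₂≢c₁ ∘ +-cancelˡ-≡ t _ _) (c₂≢c₃ ∘ +-cancelˡ-≡ t _ _)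
    (entry r₁c₂) (entry r₁c₃) (entry r₂c₁) (entry r₂c₃) (entry r₃c₁) (entry r₃c₂)
  where
  entry : ∀ {i j} → T (window m s t E i j) → T (E (s + i) (t + j))
  entry p = proj₂ (window-unpack m s t E p)
  across : ∀ c → s + r₃ < t + c
  across c = <-≤-trans (+-monoʳ-< s (proj₁ (window-unpack m s t E r₃c₁))) (≤-trans s+m≤t (m≤m+n t c))

^-distribʳ-* : ∀ k m n → (m * n) ^ k ≡ m ^ k * n ^ k
^-distribʳ-* zero    m n = refl
^-distribʳ-* (suc k) m n = trans (cong (m * n *_) (^-distribʳ-* k m n)) (interchange m n (m ^ k) (n ^ k))
  where
  interchange : ∀ a b c e → (a * b) * (c * e) ≡ (a * c) * (b * e)
  interchange = solve-∀

8^≡ : ∀ k → 8 ^ k ≡ 2 ^ k * (2 ^ k * 2 ^ k)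
8^≡ k = trans (^-distribʳ-* k 2 4) (cong (2 ^ k *_) (^-distribʳ-* k 2 2))

16^≡ : ∀ k → 16 ^ k ≡ 2 ^ k * (2 ^ k * (2 ^ k * 2 ^ k))
16^≡ k = trans (^-distribʳ-* k 2 8) (cong (2 ^ k *_) (8^≡ k))

∑-digits₂ : ∀ a m (f : ℕ → ℕ → ℕ) → ∑[ i < a * m ] ∑[ j < a * m ] f i j ≡
  ∑[ p < a ] ∑[ q < a ] ∑[ i < m ] ∑[ j < m ] f (p * m + i) (q * m + j)
∑-digits₂ a m f = trans (∑-digits a m _) (∑-cong a (λ p → trans (∑-cong m (λ i → ∑-digits a m _)) (∑-swap m a _)))

-- Recursion over eight intervals

module _ {E : Matrix} (increasing : ∀ {i j} → T (E i j) → i < j) (free : OrderedHexagonFree E) where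

  open ≤-Reasoning

  between≤ : ∀ k s t → s + 8 ^ k ≤ t → ∑[ i < 8 ^ k ] ∑[ j < 8 ^ k ] ⟦ E (s + i) (t + j) ⟧ ≤ 24 * 16 ^ k
  between≤ k s t s+m≤t = begin
    ∑[ i < 8 ^ k ] ∑[ j < 8 ^ k ] ⟦ E (s + i) (t + j) ⟧   ≤⟨ ∑-mono< (8 ^ k) (λ i i<m → ∑-mono< (8 ^ k) (λ j j<m →
                                                               ⟦⟧-mono {E (s + i) (t + j)} {W i j} (λ e → join {i <ᵇ 8 ^ k} (<⇒<ᵇ i<m) (join {j <ᵇ 8 ^ k} (<⇒<ᵇ j<m) e)))) ⟩
    ∑[ i < 8 ^ k ] ∑[ j < 8 ^ k ] ⟦ W i j ⟧               ≡⟨ cong (λ m → ∑[ i < m ] ∑[ j < m ] ⟦ W i j ⟧) (8^≡ k) ⟩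
    ∑[ i < d * (d * d) ] ∑[ j < d * (d * d) ] ⟦ W i j ⟧   ≤⟨ entries≤ d {{m^n≢0 2 k}} {W} (window-hexagonFree {E} free (8 ^ k) s t s+m≤t) ⟩
    24 * (d * (d * (d * d)))                              ≡⟨ cong (24 *_) (16^≡ k) ⟨
    24 * 16 ^ k                                           ∎
    where
    d : ℕ
    d = 2 ^ k
    W : Matrix
    W = window (8 ^ k) s t E

  -- Of the 64 blocks the eight on the diagonal recur, and every block is granted `24 * 16 ^ k`. A
  -- bound `C * 16 ^ k` reproduces itself when `8 * C + 64 * 24 = 16 * C`, whence 192. The recursion
  -- loses only a constant factor because 16, the 4/3 power of 8, exceeds 8.
  within≤ : ∀ k s → ∑[ i < 8 ^ k ] ∑[ j < 8 ^ k ] ⟦ E (s + i) (s + j) ⟧ ≤ 192 * 16 ^ k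
  within≤ zero    s = ≤-trans (≤-reflexive (⟦⟧-false (λ e → <-irrefl refl (increasing e)))) z≤n
  within≤ (suc k) s = begin
    ∑[ i < 8 * m ] ∑[ j < 8 * m ] ⟦ E (s + i) (s + j) ⟧
      ≡⟨ ∑-digits₂ 8 m (λ i j → ⟦ E (s + i) (s + j) ⟧) ⟩
    ∑[ p < 8 ] ∑[ q < 8 ] ∑[ i < m ] ∑[ j < m ] ⟦ E (s + (p * m + i)) (s + (q * m + j)) ⟧
      ≤⟨ ∑-mono 8 (λ p → ∑-mono 8 (λ q → block p q)) ⟩
    ∑[ p < 8 ] ∑[ q < 8 ] (⟦ q ≡ᵇ p ⟧ * (192 * 16 ^ k) + 24 * 16 ^ k)
      ≤⟨ ∑-≤-const 8 _ blockRow ⟩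
    8 * (1 * (192 * 16 ^ k) + 8 * (24 * 16 ^ k))
      ≡⟨ collect (16 ^ k) ⟩
    192 * (16 * 16 ^ k) ∎
    where
    m : ℕ
    m = 8 ^ k
    collect : ∀ x → 8 * (1 * (192 * x) + 8 * (24 * x)) ≡ 192 * (16 * x)
    collect = solve-∀
    blockRow : ∀ p → ∑[ q < 8 ] (⟦ q ≡ᵇ p ⟧ * (192 * 16 ^ k) + 24 * 16 ^ k) ≤ 1 * (192 * 16 ^ k) + 8 * (24 * 16 ^ k)
    blockRow p = begin
      ∑[ q < 8 ] (⟦ q ≡ᵇ p ⟧ * (192 * 16 ^ k) + 24 * 16 ^ k)               ≡⟨ ∑-+ 8 (λ q → ⟦ q ≡ᵇ p ⟧ * (192 * 16 ^ k)) (λ _ → 24 * 16 ^ k) ⟩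
      ∑[ q < 8 ] (⟦ q ≡ᵇ p ⟧ * (192 * 16 ^ k)) + ∑[ q < 8 ] (24 * 16 ^ k)  ≡⟨ cong₂ _+_ (∑-*ʳ 8 (λ q → ⟦ q ≡ᵇ p ⟧) (192 * 16 ^ k)) (∑-const 8 (24 * 16 ^ k)) ⟩
      ∑[ q < 8 ] ⟦ q ≡ᵇ p ⟧ * (192 * 16 ^ k) + 8 * (24 * 16 ^ k)           ≤⟨ +-monoˡ-≤ (8 * (24 * 16 ^ k)) (*-monoˡ-≤ (192 * 16 ^ k) (∑-point 8 p)) ⟩
      1 * (192 * 16 ^ k) + 8 * (24 * 16 ^ k)                               ∎
    shift : ∀ p → ∑[ i < m ] ∑[ j < m ] ⟦ E (s + (p * m + i)) (s + (p * m + j)) ⟧ ≡ ∑[ i < m ] ∑[ j < m ] ⟦ E (s + p * m + i) (s + p * m + j) ⟧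
    shift p = ∑-cong m (λ i → ∑-cong m (λ j → cong₂ (λ x y → ⟦ E x y ⟧) (sym (+-assoc s (p * m) i)) (sym (+-assoc s (p * m) j))))
    block : ∀ p q → ∑[ i < m ] ∑[ j < m ] ⟦ E (s + (p * m + i)) (s + (q * m + j)) ⟧ ≤ ⟦ q ≡ᵇ p ⟧ * (192 * 16 ^ k) + 24 * 16 ^ k
    block p q with <-cmp p q
    ... | tri< p<q _ _ = begin
      ∑[ i < m ] ∑[ j < m ] ⟦ E (s + (p * m + i)) (s + (q * m + j)) ⟧
        ≡⟨ ∑-cong m (λ i → ∑-cong m (λ j → cong₂ (λ x y → ⟦ E x y ⟧) (sym (+-assoc s (p * m) i)) (sym (+-assoc s (q * m) j)))) ⟩
      ∑[ i < m ] ∑[ j < m ] ⟦ E (s + p * m + i) (s + q * m + j) ⟧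
        ≤⟨ between≤ k (s + p * m) (s + q * m) (≤-trans (≤-reflexive (+-assoc s (p * m) m)) (+-monoʳ-≤ s (≤-trans (≤-reflexive (+-comm (p * m) m)) (*-monoˡ-≤ m p<q)))) ⟩
      24 * 16 ^ k
        ≤⟨ m≤n+m _ (⟦ q ≡ᵇ p ⟧ * (192 * 16 ^ k)) ⟩
      ⟦ q ≡ᵇ p ⟧ * (192 * 16 ^ k) + 24 * 16 ^ k ∎
    ... | tri≈ _ refl _ = begin
      ∑[ i < m ] ∑[ j < m ] ⟦ E (s + (p * m + i)) (s + (p * m + j)) ⟧ ≡⟨ shift p ⟩
      ∑[ i < m ] ∑[ j < m ] ⟦ E (s + p * m + i) (s + p * m + j) ⟧     ≤⟨ within≤ k (s + p * m) ⟩
      192 * 16 ^ k                                                    ≡⟨ *-identityˡ _ ⟨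
      1 * (192 * 16 ^ k)                                              ≡⟨ cong (_* (192 * 16 ^ k)) (⟦⟧-true (≡⇒≡ᵇ p p refl)) ⟨
      ⟦ p ≡ᵇ p ⟧ * (192 * 16 ^ k)                                     ≤⟨ m≤m+n _ _ ⟩
      ⟦ p ≡ᵇ p ⟧ * (192 * 16 ^ k) + 24 * 16 ^ k                       ∎
    ... | tri> _ _ q<p = begin
      ∑[ i < m ] ∑[ j < m ] ⟦ E (s + (p * m + i)) (s + (q * m + j)) ⟧ ≤⟨ ∑-mono m (λ i → ∑-mono< m (λ j j<m → ≤-reflexive (⟦⟧-false (λ e → <-asym (increasing e) (backward i j j<m))))) ⟩
      ∑[ i < m ] ∑[ j < m ] 0                                         ≡⟨ trans (∑-cong m (λ _ → ∑-zero m)) (∑-zero m) ⟩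
      0                                                               ≤⟨ z≤n ⟩
      _                                                               ∎
      where
      backward : ∀ i j → j < m → s + (q * m + j) < s + (p * m + i)
      backward i j j<m = +-monoʳ-< s (<-≤-trans (+-monoʳ-< (q * m) j<m) (≤-trans (≤-reflexive (+-comm (q * m) m)) (≤-trans (*-monoˡ-≤ m q<p) (m≤m+n _ i))))

bracket : ∀ b → 1 < b → ∀ n → 0 < n → ∃[ k ] b ^ k ≤ n × n < b ^ suc k
bracket b 1<b 1 _ = 0 , s≤s z≤n , ≤-trans 1<b (≤-reflexive (sym (*-identityʳ b)))
bracket b 1<b (suc n@(suc _)) _ with bracket b 1<b n (s≤s z≤n)
... | k , lo , hi with m≤n⇒m<n∨m≡n hi
...   | inj₁ 1+n<  = k , m≤n⇒m≤1+n lo , 1+n<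
...   | inj₂ eq    = suc k , ≤-reflexive (sym eq) , subst (_< b ^ suc (suc k)) (sym eq) (m<n*m′ )
  where
  m<n*m′ : b ^ suc k < b * b ^ suc k
  m<n*m′ = subst (_< b * b ^ suc k) (*-identityˡ _) (*-monoˡ-< (b ^ suc k) {{>-nonZero (subst (0 <_) eq (s≤s z≤n))}} 1<b)

-- `16 ^ k` is the 4/3 power of `8 ^ k`; the factor `b` accommodates the rounding of `n` up to a
-- power of eight.
cube≤ : ∀ c b k {e n} → e ≤ c * (b * 16 ^ k) → 8 ^ k ≤ n → e ^ 3 ≤ (c * b) ^ 3 * n ^ 4
cube≤ c b k {e} {n} e≤ 8ᵏ≤n = begin
  e ^ 3                                  ≤⟨ ^-monoˡ-≤ 3 e≤ ⟩
  (c * (b * 16 ^ k)) ^ 3                 ≡⟨ cong (λ x → (c * (b * x)) ^ 3) (16^≡ k) ⟩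
  (c * (b * (d * (d * (d * d))))) ^ 3    ≡⟨ powers c b d ⟩
  (c * b) ^ 3 * (d * (d * d)) ^ 4        ≡⟨ cong (λ x → (c * b) ^ 3 * x ^ 4) (8^≡ k) ⟨
  (c * b) ^ 3 * (8 ^ k) ^ 4              ≤⟨ *-monoʳ-≤ ((c * b) ^ 3) (^-monoˡ-≤ 4 8ᵏ≤n) ⟩
  (c * b) ^ 3 * n ^ 4                    ∎
  where
  open ≤-Reasoning
  d : ℕ
  d = 2 ^ k
  powers : ∀ c b x → (c * (b * (x * (x * (x * x))))) * ((c * (b * (x * (x * (x * x))))) * ((c * (b * (x * (x * (x * x))))) * 1)) ≡
    c * b * (c * b * (c * b * 1)) * ((x * (x * x)) * ((x * (x * x)) * ((x * (x * x)) * ((x * (x * x)) * 1))))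
  powers = solve-∀

edgeCount≤ : ∀ {n} (G : OrderedGraph n) → ¬ Hexagon G → ∀ k → n ≤ 8 ^ k → edgeCount G ≤ 192 * 16 ^ k
edgeCount≤ {n} G none k n≤8ᵏ = begin
  edgeCount G                                   ≡⟨ edgeCount≡∑ G ⟩
  ∑[ i < n ] ∑[ j < n ] ⟦ upper G i j ⟧         ≤⟨ ∑-prefix _ n≤8ᵏ ⟩
  ∑[ i < 8 ^ k ] ∑[ j < n ] ⟦ upper G i j ⟧     ≤⟨ ∑-mono (8 ^ k) (λ i → ∑-prefix _ n≤8ᵏ) ⟩
  ∑[ i < 8 ^ k ] ∑[ j < 8 ^ k ] ⟦ upper G i j ⟧ ≤⟨ within≤ {upper G} (proj₁ ∘ upper⇒adj G) (upper-hexagonFree G none) k 0 ⟩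
  192 * 16 ^ k                                  ∎
  where open ≤-Reasoning

abstract
  -- Keeping `K` opaque avoids evaluating its cube.
  edgeCount³≤ : ∃[ K ] 0 < K × (∀ {n} → 0 < n → (G : OrderedGraph n) → ¬ Hexagon G → edgeCount G ^ 3 ≤ K ^ 3 * n ^ 4)
  edgeCount³≤ = 192 * 16 , s≤s z≤n , λ {n} 0<n G none →
    let (k , 8ᵏ≤n , n<8ᵏ⁺¹) = bracket 8 (s≤s (s≤s z≤n)) n 0<n
    in cube≤ 192 16 k (edgeCount≤ G none (suc k) (<⇒≤ n<8ᵏ⁺¹)) 8ᵏ≤n

-- Wenger's graph

does⁻ : ∀ {P : Set} (P? : Dec P) → T (does P?) → P
does⁻ (yes p) _ = p

does⁺ : ∀ {P : Set} (P? : Dec P) → P → T (does P?)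
does⁺ (yes _) _ = tt
does⁺ (no ¬p) p = ¬p p

-- Only values of `R` at increasing pairs are read, so any Boolean table yields a graph. This serves
-- Wenger's graph, the six-vertex models and the enumeration of all graphs.
graphOf : ∀ {n} → (Fin n → Fin n → Bool) → OrderedGraph n
graphOf {n} R = record { adj = adj ; ~-sym = λ {i} {j} → adj-sym {i} {j} ; ~-irrefl = λ { {i} refl → adj-irrefl i } }
  where
  forward adj : Fin n → Fin n → Bool
  forward i j = (toℕ i <ᵇ toℕ j) ∧ R i j
  adj i j = forward i j ∨ forward j i
  adj-sym : ∀ {i j} → T (adj i j) → T (adj j i)
  adj-sym {i} {j} p with Equivalence.to (T-∨ {forward i j}) p
  ... | inj₁ q = Equivalence.from (T-∨ {forward j i}) (inj₂ q)
  ... | inj₂ q = Equivalence.from (T-∨ {forward j i}) (inj₁ q)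
  adj-irrefl : ∀ i → ¬ T (adj i i)
  adj-irrefl i p with Equivalence.to (T-∨ {forward i i}) p
  ... | inj₁ q = <-irrefl refl (<ᵇ⇒< (toℕ i) (toℕ i) (proj₁ (split {toℕ i <ᵇ toℕ i} q)))
  ... | inj₂ q = <-irrefl refl (<ᵇ⇒< (toℕ i) (toℕ i) (proj₁ (split {toℕ i <ᵇ toℕ i} q)))

graphOf⁻ : ∀ {n} (R : Fin n → Fin n → Bool) {i j} → i Fin.< j → Adj (graphOf R) i j → T (R i j)
graphOf⁻ R {i} {j} i<j p with Equivalence.to (T-∨ {(toℕ i <ᵇ toℕ j) ∧ R i j}) p
... | inj₁ q = proj₂ (split {toℕ i <ᵇ toℕ j} q)
... | inj₂ q = contradiction (<ᵇ⇒< (toℕ j) (toℕ i) (proj₁ (split {toℕ j <ᵇ toℕ i} q))) (<-asym i<j)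

graphOf⁺ : ∀ {n} (R : Fin n → Fin n → Bool) {i j} → i Fin.< j → T (R i j) → Adj (graphOf R) i j
graphOf⁺ R {i} {j} i<j r = Equivalence.from (T-∨ {(toℕ i <ᵇ toℕ j) ∧ R i j}) (inj₁ (join {toℕ i <ᵇ toℕ j} (<⇒<ᵇ i<j) r))

extend⁺ : ∀ {n} (f : Fin n → Bool) {i} → (∀ u → toℕ u ≡ i → T (f u)) → i < n → T (extend f i)
extend⁺ {n} f {i} p i<n with i <? n
... | yes i<n′ = p _ (Fin.toℕ-fromℕ< i<n′)
... | no  i≮n  = contradiction i<n i≮n

adj⇒upper : ∀ {n} (G : OrderedGraph n) {i j} → i < j → j < n →
  (∀ u v → toℕ u ≡ i → toℕ v ≡ j → Adj G u v) → T (upper G i j)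
adj⇒upper G {i} {j} i<j j<n p = join {i <ᵇ j} (<⇒<ᵇ i<j)
  (extend⁺ _ (λ u u≡i → extend⁺ _ (λ v v≡j → p u v u≡i v≡j) j<n) (<-trans i<j j<n))

∣⇒residues≡-≤ : ∀ {p a b s} → p ∣ a + s → p ∣ b + s → b < p → a ≤ b → a ≡ b
∣⇒residues≡-≤ {p} {a} {s = s} p∣a p∣b b<p a≤b with m≤n⇒∃[o]m+o≡n a≤b
... | zero  , refl = sym (+-identityʳ a)
... | suc k , refl = contradiction (∣⇒≤ (∣m+n∣m⇒∣n (subst (p ∣_) (move a k s) p∣b) p∣a)) (<⇒≱ (≤-<-trans (m≤n+m (suc k) a) b<p))
  where
  move : ∀ a k s → a + suc k + s ≡ (a + s) + suc k
  move = solve-∀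

∣⇒residues≡ : ∀ {p a b s} → p ∣ a + s → p ∣ b + s → a < p → b < p → a ≡ b
∣⇒residues≡ {a = a} {b} p∣a p∣b a<p b<p with ≤-total a b
... | inj₁ a≤b = ∣⇒residues≡-≤ p∣a p∣b b<p a≤b
... | inj₂ b≤a = sym (∣⇒residues≡-≤ p∣b p∣a a<p b≤a)

-- Around the cycle the `cᵢ` and the `dᵢ` cancel, and the weights `m₂ − m₃`, `m₃ − m₁`, `m₁ − m₂`
-- sum to zero. Hence the left side is the weighted sum of `(x − x₁)(x − x₂)` over the three
-- abscissas, in which only `x₃` survives.
vandermonde : ∀ x₁ x₂ x₃ m₁ m₂ m₃ c₁ c₂ c₃ d₁ d₂ d₃ → 
  (x₁ ℤ.* x₁ ℤ.* (m₂ ℤ.- m₃) ℤ.+ (d₂ ℤ.- d₃)) ℤ.+ (x₂ ℤ.* x₂ ℤ.* (m₃ ℤ.- m₁) ℤ.+ (d₃ ℤ.- d₁)) ℤ.+ (x₃ ℤ.* x₃ ℤ.* (m₁ ℤ.- m₂) ℤ.+ (d₁ ℤ.- d₂))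
  ℤ.- (x₁ ℤ.+ x₂) ℤ.* ((x₁ ℤ.* (m₂ ℤ.- m₃) ℤ.+ (c₂ ℤ.- c₃)) ℤ.+ (x₂ ℤ.* (m₃ ℤ.- m₁) ℤ.+ (c₃ ℤ.- c₁)) ℤ.+ (x₃ ℤ.* (m₁ ℤ.- m₂) ℤ.+ (c₁ ℤ.- c₂)))
  ≡ (x₃ ℤ.- x₁) ℤ.* ((x₃ ℤ.- x₂) ℤ.* (m₁ ℤ.- m₂))
vandermonde = ℤSolver.solve-∀

∣-difference : ∀ {p} y x m c m′ c′ → p ∣ (y + x * m) + c → p ∣ (y + x * m′) + c′ →
  pos p ℤ∣.∣ pos x ℤ.* (pos m ℤ.- pos m′) ℤ.+ (pos c ℤ.- pos c′)
∣-difference {p} y x m c m′ c′ h h′ = subst (pos p ℤ∣.∣_) (identity (pos y) (pos x) (pos m) (pos c) (pos m′) (pos c′))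
  (ℤ∣.∣m∣n⇒∣m-n (cast m c h) (cast m′ c′ h′))
  where
  cast : ∀ m c → p ∣ (y + x * m) + c → pos p ℤ∣.∣ pos y ℤ.+ pos x ℤ.* pos m ℤ.+ pos c
  cast m c h = subst (λ z → pos p ℤ∣.∣ pos y ℤ.+ z ℤ.+ pos c) (ℤ.pos-* x m) (ℤ∣.∣ᵤ⇒∣ h)
  identity : ∀ y x m c m′ c′ → (y ℤ.+ x ℤ.* m ℤ.+ c) ℤ.- (y ℤ.+ x ℤ.* m′ ℤ.+ c′) ≡ x ℤ.* (m ℤ.- m′) ℤ.+ (c ℤ.- c′)
  identity = ℤSolver.solve-∀

prime∣*⇒ : ∀ {p} → Prime p → ∀ i j → pos p ℤ∣.∣ i ℤ.* j → pos p ℤ∣.∣ i ⊎ pos p ℤ∣.∣ j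
prime∣*⇒ {p} pr i j h with euclidsLemma ℤ.∣ i ∣ ℤ.∣ j ∣ pr (subst (p ∣_) (ℤ.abs-* i j) (ℤ∣.∣⇒∣ᵤ h))
... | inj₁ p∣i = inj₁ (ℤ∣.∣ᵤ⇒∣ p∣i)
... | inj₂ p∣j = inj₂ (ℤ∣.∣ᵤ⇒∣ p∣j)

∣∸⇒≤ : ∀ {p a b} → a < p → p ∣ a ∸ b → a ≤ b
∣∸⇒≤ {a = a} {b} a<p p∣ = ≮⇒≥ λ b<a → <⇒≱ (≤-<-trans (m∸n≤m a b) a<p) (∣⇒≤ {{>-nonZero (m<n⇒0<n∸m b<a)}} p∣)

∣-⇒≡ : ∀ {p a b} → a < p → b < p → pos p ℤ∣.∣ pos a ℤ.- pos b → a ≡ b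
∣-⇒≡ {p} {a} {b} a<p b<p h with ≤-total b a
... | inj₁ b≤a = ≤-antisym (∣∸⇒≤ a<p (subst (λ z → p ∣ ℤ.∣ z ∣) (trans (ℤ.m-n≡m⊖n a b) (ℤ.⊖-≥ b≤a)) (ℤ∣.∣⇒∣ᵤ h))) b≤a
... | inj₂ a≤b = ≤-antisym a≤b (∣∸⇒≤ b<p (subst (p ∣_) (trans (cong ℤ.∣_∣ (trans (ℤ.m-n≡m⊖n a b) (ℤ.⊖-≤ a≤b))) (ℤ.∣-i∣≡∣i∣ (pos (b ∸ a)))) (ℤ∣.∣⇒∣ᵤ h)))

-- Subtracting the two equations at each point removes its `y` and `z`, and `vandermonde` leaves a
-- product divisible by `p`. Each resulting equality concerns two points on a common line or two
-- lines through a common point, as `points-equal` and `lines-equal` require.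
hexagon-degenerate : ∀ {p} → Prime p → ∀ {x₁ x₂ x₃ y₁ y₂ y₃ z₁ z₂ z₃ m₁ m₂ m₃ c₁ c₂ c₃ d₁ d₂ d₃} →
  x₁ < p → x₂ < p → x₃ < p → m₁ < p → m₂ < p →
  p ∣ (y₁ + x₁ * m₂) + c₂ → p ∣ (y₁ + x₁ * m₃) + c₃ →
  p ∣ (y₂ + x₂ * m₃) + c₃ → p ∣ (y₂ + x₂ * m₁) + c₁ →
  p ∣ (y₃ + x₃ * m₁) + c₁ → p ∣ (y₃ + x₃ * m₂) + c₂ →
  p ∣ (z₁ + x₁ * x₁ * m₂) + d₂ → p ∣ (z₁ + x₁ * x₁ * m₃) + d₃ →
  p ∣ (z₂ + x₂ * x₂ * m₃) + d₃ → p ∣ (z₂ + x₂ * x₂ * m₁) + d₁ →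
  p ∣ (z₃ + x₃ * x₃ * m₁) + d₁ → p ∣ (z₃ + x₃ * x₃ * m₂) + d₂ →
  x₃ ≡ x₁ ⊎ x₃ ≡ x₂ ⊎ m₁ ≡ m₂
hexagon-degenerate {p} pr {x₁} {x₂} {x₃} {y₁} {y₂} {y₃} {z₁} {z₂} {z₃} {m₁} {m₂} {m₃} {c₁} {c₂} {c₃} {d₁} {d₂} {d₃}
  x₁< x₂< x₃< m₁< m₂< h₁₂ h₁₃ h₂₃ h₂₁ h₃₁ h₃₂ k₁₂ k₁₃ k₂₃ k₂₁ k₃₁ k₃₂ =
  Sum.map (∣-⇒≡ x₃< x₁<) (Sum.map (∣-⇒≡ x₃< x₂<) (∣-⇒≡ m₁< m₂<) ∘ prime∣*⇒ pr (pos x₃ ℤ.- pos x₂) (pos m₁ ℤ.- pos m₂))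
    (prime∣*⇒ pr (pos x₃ ℤ.- pos x₁) ((pos x₃ ℤ.- pos x₂) ℤ.* (pos m₁ ℤ.- pos m₂)) divides-product)
  where
  square : ∀ z x m d m′ d′ → p ∣ (z + x * x * m) + d → p ∣ (z + x * x * m′) + d′ →
    pos p ℤ∣.∣ pos x ℤ.* pos x ℤ.* (pos m ℤ.- pos m′) ℤ.+ (pos d ℤ.- pos d′)
  square z x m d m′ d′ k k′ = subst (λ w → pos p ℤ∣.∣ w ℤ.* (pos m ℤ.- pos m′) ℤ.+ (pos d ℤ.- pos d′)) (ℤ.pos-* x x)
    (∣-difference z (x * x) m d m′ d′ k k′)
  divides-product : pos p ℤ∣.∣ (pos x₃ ℤ.- pos x₁) ℤ.* ((pos x₃ ℤ.- pos x₂) ℤ.* (pos m₁ ℤ.- pos m₂))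
  divides-product = subst (pos p ℤ∣.∣_)
    (vandermonde (pos x₁) (pos x₂) (pos x₃) (pos m₁) (pos m₂) (pos m₃) (pos c₁) (pos c₂) (pos c₃) (pos d₁) (pos d₂) (pos d₃))
    (ℤ∣.∣m∣n⇒∣m-n
      (ℤ∣.∣m∣n⇒∣m+n (ℤ∣.∣m∣n⇒∣m+n (square z₁ x₁ m₂ d₂ m₃ d₃ k₁₂ k₁₃) (square z₂ x₂ m₃ d₃ m₁ d₁ k₂₃ k₂₁)) (square z₃ x₃ m₁ d₁ m₂ d₂ k₃₁ k₃₂))
      (ℤ∣.∣n⇒∣m*n (pos x₁ ℤ.+ pos x₂)
        (ℤ∣.∣m∣n⇒∣m+n (ℤ∣.∣m∣n⇒∣m+n (∣-difference y₁ x₁ m₂ c₂ m₃ c₃ h₁₂ h₁₃) (∣-difference y₂ x₂ m₃ c₃ m₁ c₁ h₂₃ h₂₁)) (∣-difference y₃ x₃ m₁ c₁ m₂ c₂ h₃₁ h₃₂))))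

module Wenger {p : ℕ} (pr : Prime p) where

  instance
    p≢0 : NonZero p
    p≢0 = prime⇒nonZero pr

  q : ℕ
  q = p * p * p

  -- The same base-`p` digits encode points `(x , y , z)` and lines `(m , c , d)`: applied to a
  -- line, `x` is its slope `m`. The top digit `z` is not reduced, so it is a residue only below
  -- `q`.
  x y z : ℕ → ℕ
  x i = i % p
  y i = i / p % p
  z i = i / p / p

  Incident : ℕ → ℕ → Set
  Incident i l = (p ∣ (y i + x i * x l) + y l) × (p ∣ (z i + x i * x i * x l) + z l)

  incident? : ∀ i l → Dec (Incident i l)
  incident? i l = (p ∣? (y i + x i * x l) + y l) ×-dec (p ∣? (z i + x i * x i * x l) + z l)

  z< : ∀ {i} → i < q → z i < p
  z< i<q = m<n*o⇒m/o<n (m<n*o⇒m/o<n i<q)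

  digits-injective : ∀ {i j} → x i ≡ x j → y i ≡ y j → z i ≡ z j → i ≡ j
  digits-injective {i} {j} xx yy zz = begin
    i                                        ≡⟨ m≡m%n+[m/n]*n i p ⟩
    x i + i / p * p                          ≡⟨ cong (λ w → x i + w * p) (m≡m%n+[m/n]*n (i / p) p) ⟩
    x i + (y i + z i * p) * p                ≡⟨ cong₂ (λ a b → a + b * p) xx (cong₂ (λ a b → a + b * p) yy zz) ⟩
    x j + (y j + z j * p) * p                ≡⟨ cong (λ w → x j + w * p) (m≡m%n+[m/n]*n (j / p) p) ⟨
    x j + j / p * p                          ≡⟨ m≡m%n+[m/n]*n j p ⟨
    j                                        ∎
    where open ≡-Reasoning

  points-equal : ∀ {i j l} → i < q → j < q → Incident i l → Incident j l → x i ≡ x j → i ≡ j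
  points-equal {i} {j} {l} i<q j<q (iy , iz) (jy , jz) xx = digits-injective xx
    (∣⇒residues≡ (subst (p ∣_) (+-assoc (y i) _ (y l)) iy)
      (subst (p ∣_) (trans (+-assoc (y j) _ (y l)) (cong (λ w → y j + (w * x l + y l)) (sym xx))) jy) (m%n<n (i / p) p) (m%n<n (j / p) p))
    (∣⇒residues≡ (subst (p ∣_) (+-assoc (z i) _ (z l)) iz)
      (subst (p ∣_) (trans (+-assoc (z j) _ (z l)) (cong (λ w → z j + (w * w * x l + z l)) (sym xx))) jz) (z< i<q) (z< j<q))

  lines-equal : ∀ {i l k} → l < q → k < q → Incident i l → Incident i k → x l ≡ x k → l ≡ k
  lines-equal {i} {l} {k} l<q k<q (ly , lz) (ky , kz) xx = digits-injective xx
    (∣⇒residues≡ (subst (p ∣_) (+-comm _ (y l)) ly)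
      (subst (p ∣_) (trans (+-comm _ (y k)) (cong (λ w → y k + (y i + x i * w)) (sym xx))) ky) (m%n<n (l / p) p) (m%n<n (k / p) p))
    (∣⇒residues≡ (subst (p ∣_) (+-comm _ (z l)) lz)
      (subst (p ∣_) (trans (+-comm _ (z k)) (cong (λ w → z k + (z i + x i * x i * w)) (sym xx))) kz) (z< l<q) (z< k<q))

  noHexagon : ∀ {i₁ i₂ i₃ l₁ l₂ l₃} → i₁ < q → i₂ < q → i₃ < q → l₁ < q → l₂ < q →
    i₁ ≢ i₃ → i₂ ≢ i₃ → l₁ ≢ l₂ →
    Incident i₁ l₂ → Incident i₁ l₃ → Incident i₂ l₁ → Incident i₂ l₃ → Incident i₃ l₁ → Incident i₃ l₂ → ⊥
  noHexagon {i₁} {i₂} {i₃} {l₁} {l₂} {l₃} i₁< i₂< i₃< l₁< l₂< i₁≢i₃ i₂≢i₃ l₁≢l₂ h₁₂ h₁₃ h₂₁ h₂₃ h₃₁ h₃₂ =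
    Sum.[ (λ eq → i₁≢i₃ (sym (points-equal {i₃} {i₁} {l₂} i₃< i₁< h₃₂ h₁₂ eq)))
        , Sum.[ (λ eq → i₂≢i₃ (sym (points-equal {i₃} {i₂} {l₁} i₃< i₂< h₃₁ h₂₁ eq)))
              , (λ eq → l₁≢l₂ (lines-equal {i₃} {l₁} {l₂} l₁< l₂< h₃₁ h₃₂ eq)) ] ]
      (hexagon-degenerate pr {x i₁} {x i₂} {x i₃} {y i₁} {y i₂} {y i₃} {z i₁} {z i₂} {z i₃}
        {x l₁} {x l₂} {x l₃} {y l₁} {y l₂} {y l₃} {z l₁} {z l₂} {z l₃}
        (m%n<n i₁ p) (m%n<n i₂ p) (m%n<n i₃ p) (m%n<n l₁ p) (m%n<n l₂ p)
        (proj₁ h₁₂) (proj₁ h₁₃) (proj₁ h₂₃) (proj₁ h₂₁) (proj₁ h₃₁) (proj₁ h₃₂)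
        (proj₂ h₁₂) (proj₂ h₁₃) (proj₂ h₂₃) (proj₂ h₂₁) (proj₂ h₃₁) (proj₂ h₃₂))

  complete : ∀ s → ∃[ c ] c < p × p ∣ s + c
  -- `s * (p − 1)` represents `−s` modulo `p`.
  complete s = s * pred p % p , m%n<n (s * pred p) p , ∣m+n∣m⇒∣n (subst (p ∣_) sum (n∣m*n s)) (n∣m*n (s * pred p / p))
    where
    open ≡-Reasoning
    sum : s * p ≡ s * pred p / p * p + (s + s * pred p % p)
    sum = begin
      s * p                                              ≡⟨ cong (s *_) (suc-pred p) ⟨
      s * suc (pred p)                                   ≡⟨ *-suc s (pred p) ⟩
      s + s * pred p                                     ≡⟨ cong (λ w → s + w) (m≡m%n+[m/n]*n (s * pred p) p) ⟩
      s + (s * pred p % p + s * pred p / p * p)          ≡⟨ +-assoc s _ _ ⟨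
      (s + s * pred p % p) + s * pred p / p * p          ≡⟨ +-comm _ (s * pred p / p * p) ⟩
      s * pred p / p * p + (s + s * pred p % p)          ∎

  encode : ℕ → ℕ → ℕ → ℕ
  encode d c m = (d * p + c) * p + m

  incident-encode : ∀ i {d c m} → d < p → c < p → m < p →
    p ∣ (y i + x i * m) + c → p ∣ (z i + x i * x i * m) + d → Incident i (encode d c m)
  incident-encode i {d} {c} {m} d<p c<p m<p h h′ =
    subst₂ (λ m c → p ∣ (y i + x i * m) + c) (sym x≡) (sym y≡) h ,
    subst₂ (λ m d → p ∣ (z i + x i * x i * m) + d) (sym x≡) (sym z≡) h′
    where
    x≡ : x (encode d c m) ≡ m
    x≡ = [q*d+r]%d≡r (d * p + c) p m<p
    quotient≡ : encode d c m / p ≡ d * p + c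
    quotient≡ = [q*d+r]/d≡q (d * p + c) p m<p
    y≡ : y (encode d c m) ≡ c
    y≡ = trans (cong (_% p) quotient≡) ([q*d+r]%d≡r d p c<p)
    z≡ : z (encode d c m) ≡ d
    z≡ = trans (cong (_/ p) quotient≡) ([q*d+r]/d≡q d p c<p)

  open ≤-Reasoning

  -- For every slope the two equations can be solved for `c` and `d`, so each of the `p` slopes
  -- contributes a line through `i`.
  p≤∑-incident : ∀ i → p ≤ ∑[ l < q ] ⟦ does (incident? i l) ⟧
  p≤∑-incident i = begin
    p                                                                   ≡⟨ *-identityʳ p ⟨
    p * 1                                                               ≡⟨ ∑-const p 1 ⟨
    ∑[ m < p ] 1                                                        ≤⟨ ∑-mono< p (λ m m<p → oneLine m m<p) ⟩
    ∑[ m < p ] ∑[ d < p ] ∑[ c < p ] I (encode d c m)                   ≡⟨ ∑-swap p p _ ⟩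
    ∑[ d < p ] ∑[ m < p ] ∑[ c < p ] I (encode d c m)                   ≡⟨ ∑-cong p (λ d → ∑-swap p p _) ⟩
    ∑[ d < p ] ∑[ c < p ] ∑[ m < p ] I (encode d c m)                   ≡⟨ ∑-digits p p (λ e → ∑[ m < p ] I (e * p + m)) ⟨
    ∑[ e < p * p ] ∑[ m < p ] I (e * p + m)                             ≡⟨ ∑-digits (p * p) p I ⟨
    ∑[ l < q ] I l                                                      ∎
    where
    I : ℕ → ℕ
    I l = ⟦ does (incident? i l) ⟧
    oneLine : ∀ m → m < p → 1 ≤ ∑[ d < p ] ∑[ c < p ] I (encode d c m)
    oneLine m m<p =
      let (c , c<p , h)  = complete (y i + x i * m)
          (d , d<p , h′) = complete (z i + x i * x i * m)
      in begin
        1                                          ≡⟨ ⟦⟧-true (does⁺ (incident? i (encode d c m)) (incident-encode i d<p c<p m<p h h′)) ⟨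
        I (encode d c m)                           ≤⟨ term≤∑ p (λ c → I (encode d c m)) c<p ⟩
        ∑[ c < p ] I (encode d c m)                ≤⟨ term≤∑ p (λ d → ∑[ c < p ] I (encode d c m)) d<p ⟩
        ∑[ d < p ] ∑[ c < p ] I (encode d c m)     ∎

  -- Vertices below `q` are points, the next `q` are lines, and all further vertices stay isolated;
  -- so one prime serves every `n ≥ 2 q`.
  joined : ∀ {n} → Fin n → Fin n → Bool
  joined u v = (toℕ u <ᵇ q) ∧ ((q ≤ᵇ toℕ v) ∧ ((toℕ v ∸ q <ᵇ q) ∧ does (incident? (toℕ u) (toℕ v ∸ q))))

  joined-unpack : ∀ {n} (u v : Fin n) → T (joined u v) → toℕ u < q × q ≤ toℕ v × toℕ v ∸ q < q × Incident (toℕ u) (toℕ v ∸ q)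
  joined-unpack u v h =
    let (h₁ , h′)  = split {toℕ u <ᵇ q} h
        (h₂ , h″)  = split {q ≤ᵇ toℕ v} h′
        (h₃ , h₄)  = split {toℕ v ∸ q <ᵇ q} h″
    in <ᵇ⇒< (toℕ u) q h₁ , ≤ᵇ⇒≤ q (toℕ v) h₂ , <ᵇ⇒< (toℕ v ∸ q) q h₃ , does⁻ (incident? (toℕ u) (toℕ v ∸ q)) h₄

  graph : ∀ n → OrderedGraph n
  graph n = graphOf {n} joined

  graph-noHexagon : ∀ n → ¬ Hexagon (graph n)
  graph-noHexagon n (hexagon {u₁} {u₂} {u₃} {v₁} {v₂} {v₃} u₁<u₂ u₂<u₃ u₃<v₁ u₃<v₂ v₁<v₃ v₂≢v₁ v₂≢v₃ u₁v₂ u₁v₃ u₂v₁ u₂v₃ u₃v₁ u₃v₂) =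
    let u₂<v₁ = <-trans u₂<u₃ u₃<v₁
        u₁<v₂ = <-trans u₁<u₂ (<-trans u₂<u₃ u₃<v₂)
        (i₁< , q≤v₂ , l₂< , h₁₂) = joined-unpack u₁ v₂ (graphOf⁻ joined {u₁} {v₂} u₁<v₂ u₁v₂)
        (_ , _ , _ , h₁₃)        = joined-unpack u₁ v₃ (graphOf⁻ joined {u₁} {v₃} (<-trans (<-trans u₁<u₂ u₂<v₁) v₁<v₃) u₁v₃)
        (i₂< , q≤v₁ , l₁< , h₂₁) = joined-unpack u₂ v₁ (graphOf⁻ joined {u₂} {v₁} u₂<v₁ u₂v₁)
        (_ , _ , _ , h₂₃)        = joined-unpack u₂ v₃ (graphOf⁻ joined {u₂} {v₃} (<-trans u₂<v₁ v₁<v₃) u₂v₃)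
        (i₃< , _ , _ , h₃₁)      = joined-unpack u₃ v₁ (graphOf⁻ joined {u₃} {v₁} u₃<v₁ u₃v₁)
        (_ , _ , _ , h₃₂)        = joined-unpack u₃ v₂ (graphOf⁻ joined {u₃} {v₂} u₃<v₂ u₃v₂)
    in noHexagon {toℕ u₁} {toℕ u₂} {toℕ u₃} {toℕ v₁ ∸ q} {toℕ v₂ ∸ q} {toℕ v₃ ∸ q} i₁< i₂< i₃< l₁< l₂<
         (<⇒≢ (<-trans u₁<u₂ u₂<u₃)) (<⇒≢ u₂<u₃)
         (λ eq → v₂≢v₁ (Fin.toℕ-injective (∸-cancelʳ-≡ q≤v₂ q≤v₁ (sym eq))))
         h₁₂ h₁₃ h₂₁ h₂₃ h₃₁ h₃₂

  graph-edges : ∀ {n} → q + q ≤ n → q * p ≤ edgeCount (graph n)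
  graph-edges {n} 2q≤n = begin
    q * p                                                    ≡⟨ ∑-const q p ⟨
    ∑[ i < q ] p                                             ≤⟨ ∑-mono q (λ i → p≤∑-incident i) ⟩
    ∑[ i < q ] ∑[ l < q ] ⟦ does (incident? i l) ⟧           ≤⟨ ∑-mono< q (λ i i<q → ∑-mono< q (λ l l<q → ⟦⟧-mono {does (incident? i l)} {upper G i (q + l)} (edge i l i<q l<q))) ⟩
    ∑[ i < q ] ∑[ l < q ] ⟦ upper G i (q + l) ⟧              ≤⟨ ∑-mono q (λ i → m≤n+m _ (∑[ j < q ] ⟦ upper G i j ⟧)) ⟩
    ∑[ i < q ] (∑[ j < q ] ⟦ upper G i j ⟧ + ∑[ l < q ] ⟦ upper G i (q + l) ⟧) ≡⟨ ∑-cong q (λ i → sym (∑-append q q (λ j → ⟦ upper G i j ⟧))) ⟩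
    ∑[ i < q ] ∑[ j < q + q ] ⟦ upper G i j ⟧                ≤⟨ ∑-mono q (λ i → ∑-prefix (λ j → ⟦ upper G i j ⟧) 2q≤n) ⟩
    ∑[ i < q ] ∑[ j < n ] ⟦ upper G i j ⟧                    ≤⟨ ∑-prefix _ (≤-trans (m≤m+n q q) 2q≤n) ⟩
    ∑[ i < n ] ∑[ j < n ] ⟦ upper G i j ⟧                    ≡⟨ edgeCount≡∑ G ⟨
    edgeCount G                                              ∎
    where
    G : OrderedGraph n
    G = graph n
    edge : ∀ i l → i < q → l < q → T (does (incident? i l)) → T (upper G i (q + l))
    edge i l i<q l<q h = adj⇒upper G (<-≤-trans i<q (m≤m+n q l)) (<-≤-trans (+-monoʳ-< q l<q) 2q≤n) adjacent
      where
      adjacent : ∀ u v → toℕ u ≡ i → toℕ v ≡ q + l → Adj G u v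
      adjacent u v refl v≡q+l = graphOf⁺ joined (subst (toℕ u <_) (sym v≡q+l) (<-≤-trans i<q (m≤m+n q l)))
        (join {toℕ u <ᵇ q} (<⇒<ᵇ i<q) (join {q ≤ᵇ toℕ v} (≤⇒≤ᵇ (subst (q ≤_) (sym v≡q+l) (m≤m+n q l)))
          (subst (λ w → T ((w <ᵇ q) ∧ does (incident? (toℕ u) w))) (sym (trans (cong (_∸ q) v≡q+l) (m+n∸m≡n q l))) (join {l <ᵇ q} (<⇒<ᵇ l<q) h))))

-- Primes between consecutive powers of four

nC0≡1 : ∀ n → n C 0 ≡ 1
nC0≡1 n = trans (nCk≡nC[n∸k] {0} {n} z≤n) (nCn≡1 n)

[1+k]*[1+n]C[1+k]≡[1+n]*nCk : ∀ n k → suc k * (suc n C suc k) ≡ suc n * (n C k)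
[1+k]*[1+n]C[1+k]≡[1+n]*nCk zero    zero    = refl
[1+k]*[1+n]C[1+k]≡[1+n]*nCk zero    (suc k) = *-zeroʳ k
[1+k]*[1+n]C[1+k]≡[1+n]*nCk (suc n) zero    = trans (*-identityˡ _) (trans (nC1≡n (2 + n)) (sym (trans (cong ((2 + n) *_) (nC0≡1 (suc n))) (*-identityʳ (2 + n)))))
[1+k]*[1+n]C[1+k]≡[1+n]*nCk (suc n) (suc k) = begin
  (2 + k) * ((2 + n) C (2 + k))                          ≡⟨ cong ((2 + k) *_) (nCk+nC[k+1]≡[n+1]C[k+1] (suc n) (suc k)) ⟨
  (2 + k) * (x + suc n C (2 + k))                        ≡⟨ expand k x _ ⟩
  x + (suc k * x + (2 + k) * (suc n C (2 + k)))          ≡⟨ cong (x +_) (cong₂ _+_ ([1+k]*[1+n]C[1+k]≡[1+n]*nCk n k) ([1+k]*[1+n]C[1+k]≡[1+n]*nCk n (suc k))) ⟩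
  x + (suc n * (n C k) + suc n * (n C suc k))            ≡⟨ cong (x +_) (*-distribˡ-+ (suc n) (n C k) _) ⟨
  x + suc n * (n C k + n C suc k)                        ≡⟨ cong (λ y → x + suc n * y) (nCk+nC[k+1]≡[n+1]C[k+1] n k) ⟩
  x + suc n * x                                          ∎
  where
  open ≡-Reasoning
  x : ℕ
  x = suc n C suc k
  expand : ∀ k x y → (2 + k) * (x + y) ≡ x + (suc k * x + (2 + k) * y)
  expand = solve-∀

∑-binomials : ∀ n → ∑[ k < suc n ] (n C k) ≡ 2 ^ n
∑-binomials zero    = refl
∑-binomials (suc n) = begin
  ∑[ k < 2 + n ] (suc n C k)                                              ≡⟨ ∑-front (suc n) (suc n C_) ⟩
  suc n C 0 + ∑[ k < suc n ] (suc n C suc k)                              ≡⟨ cong₂ _+_ (trans (nC0≡1 (suc n)) (sym (nC0≡1 n))) (∑-cong (suc n) (λ k → sym (nCk+nC[k+1]≡[n+1]C[k+1] n k))) ⟩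
  n C 0 + ∑[ k < suc n ] (n C k + n C suc k)                              ≡⟨ cong (n C 0 +_) (∑-+ (suc n) (n C_) ((n C_) ∘ suc)) ⟩
  n C 0 + (∑[ k < suc n ] (n C k) + ∑[ k < suc n ] (n C suc k))           ≡⟨ shuffle (n C 0) _ _ ⟩
  ∑[ k < suc n ] (n C k) + (n C 0 + ∑[ k < suc n ] (n C suc k))           ≡⟨ cong (∑ (suc n) (n C_) +_) (∑-front (suc n) (n C_)) ⟨
  ∑[ k < suc n ] (n C k) + (∑[ k < suc n ] (n C k) + n C suc n)           ≡⟨ cong (λ z → ∑ (suc n) (n C_) + (∑ (suc n) (n C_) + z)) (k>n⇒nCk≡0 (n<1+n n)) ⟩
  2 * ∑[ k < suc n ] (n C k)                                              ≡⟨ cong (2 *_) (∑-binomials n) ⟩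
  2 * 2 ^ n                                                               ∎
  where
  open ≡-Reasoning
  shuffle : ∀ a b c → a + (b + c) ≡ b + (a + c)
  shuffle = solve-∀

-- The hypothesis says 1/c = 1/a − 1/b.
harmonic-∣ : ∀ {a b c l} .{{_ : NonZero a}} .{{_ : NonZero b}} → b * c ≡ a * (b + c) → a ∣ l → b ∣ l → c ∣ l
harmonic-∣ {a} {b} {c} {l} eq (divides s l≡sa) (divides t l≡tb) =
  ∣m+n∣m⇒∣n (subst (c ∣_) difference (m∣m*n s)) (m∣m*n t)
  where
  open ≡-Reasoning
  move₁ : ∀ a b c s → a * b * (c * s) ≡ b * c * (s * a)
  move₁ = solve-∀
  move₂ : ∀ a b c l → a * (b + c) * l ≡ a * c * l + a * b * l
  move₂ = solve-∀
  move₃ : ∀ a b c t l → a * c * (t * b) + a * b * l ≡ a * b * (c * t + l)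
  move₃ = solve-∀
  difference : c * s ≡ c * t + l
  difference = *-cancelˡ-≡ _ _ (a * b) {{m*n≢0 a b}} (begin
    a * b * (c * s)                 ≡⟨ move₁ a b c s ⟩
    b * c * (s * a)                 ≡⟨ cong₂ _*_ eq (sym l≡sa) ⟩
    a * (b + c) * l                 ≡⟨ move₂ a b c l ⟩
    a * c * l + a * b * l           ≡⟨ cong (λ z → a * c * z + a * b * l) l≡tb ⟩
    a * c * (t * b) + a * b * l     ≡⟨ move₃ a b c t l ⟩
    a * b * (c * t + l)             ∎)

-- In the Leibniz triangle the reciprocal of an entry is the sum of the reciprocals of the two
-- entries below it. The factor `suc k` is introduced so that the absorption identity can be applied
-- to both rows.
leibniz : ∀ n k → suc (suc n) * (suc n C k) * (suc (suc n) * (suc n C suc k)) ≡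
  suc n * (n C k) * (suc (suc n) * (suc n C k) + suc (suc n) * (suc n C suc k))
leibniz n k = *-cancelˡ-≡ _ _ (suc k) (begin
  suc k * (N * x * (N * y))                      ≡⟨ move₁ k N x y ⟩
  N * N * x * (suc k * y)                        ≡⟨ cong (N * N * x *_) ([1+k]*[1+n]C[1+k]≡[1+n]*nCk n k) ⟩
  N * N * x * (suc n * z)                        ≡⟨ move₂ N x (suc n * z) ⟩
  suc n * z * N * (N * x)                        ≡⟨ cong (suc n * z * N *_) ([1+k]*[1+n]C[1+k]≡[1+n]*nCk (suc n) k) ⟨
  suc n * z * N * (suc k * (N C suc k))          ≡⟨ cong (λ w → suc n * z * N * (suc k * w)) (nCk+nC[k+1]≡[n+1]C[k+1] (suc n) k) ⟨
  suc n * z * N * (suc k * (x + y))              ≡⟨ move₃ k N (suc n * z) x y ⟩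
  suc k * (suc n * z * (N * x + N * y))          ∎)
  where
  open ≡-Reasoning
  N x y z : ℕ
  N = suc (suc n)
  x = suc n C k
  y = suc n C suc k
  z = n C k
  move₁ : ∀ k N x y → suc k * (N * x * (N * y)) ≡ N * N * x * (suc k * y)
  move₁ = solve-∀
  move₂ : ∀ N x w → N * N * x * w ≡ w * N * (N * x)
  move₂ = solve-∀
  move₃ : ∀ k N w x y → w * N * (suc k * (x + y)) ≡ suc k * (w * (N * x + N * y))
  move₃ = solve-∀

CommonMultiple : ℕ → ℕ → Set
CommonMultiple m l = ∀ j → 0 < j → j ≤ m → j ∣ l

nCk>0 : ∀ {n k} → k ≤ n → 0 < n C k
nCk>0 {n}     {zero}  _         = subst (0 <_) (sym (nC0≡1 n)) (s≤s z≤n)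
nCk>0 {suc n} {suc k} (s≤s k≤n) = subst (0 <_) (nCk+nC[k+1]≡[n+1]C[k+1] n k) (≤-trans (nCk>0 k≤n) (m≤m+n _ _))

-- The outermost entry of a row of the triangle is `suc n` itself; `harmonic-∣` passes divisibility
-- on to the next entry of the row.
[1+n]*nCk∣commonMultiple : ∀ {l} k n → k ≤ n → CommonMultiple (suc n) l → suc n * (n C k) ∣ l
[1+n]*nCk∣commonMultiple {l} zero    n       _         common = subst (_∣ l) (sym (trans (cong (suc n *_) (nC0≡1 n)) (*-identityʳ (suc n)))) (common (suc n) (s≤s z≤n) ≤-refl)
[1+n]*nCk∣commonMultiple {l} (suc k) (suc n) (s≤s k≤n) common =
  harmonic-∣ {{m*n≢0 (suc n) (n C k) {{_}} {{>-nonZero (nCk>0 k≤n)}}}} {{m*n≢0 (2 + n) (suc n C k) {{_}} {{>-nonZero (nCk>0 (m≤n⇒m≤1+n k≤n))}}}}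
    (leibniz n k)
    ([1+n]*nCk∣commonMultiple k n k≤n (λ j 0<j j≤ → common j 0<j (m≤n⇒m≤1+n j≤)))
    ([1+n]*nCk∣commonMultiple k (suc n) (m≤n⇒m≤1+n k≤n) common)

-- The `n + 1` entries of the row sum to `(n + 1) 2ⁿ`, and each divides `l`; so `l` is at least
-- their average.
2^n≤commonMultiple : ∀ n {l} .{{_ : NonZero l}} → CommonMultiple (suc n) l → 2 ^ n ≤ l
2^n≤commonMultiple n {l} common = *-cancelˡ-≤ (suc n) (begin
  suc n * 2 ^ n                              ≡⟨ cong (suc n *_) (∑-binomials n) ⟨
  suc n * ∑[ k < suc n ] (n C k)             ≡⟨ ∑-*ˡ (suc n) (suc n) (n C_) ⟨
  ∑[ k < suc n ] (suc n * (n C k))           ≤⟨ ∑-mono< (suc n) (λ k k<1+n → ∣⇒≤ ([1+n]*nCk∣commonMultiple k n (≤-pred k<1+n) common)) ⟩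
  ∑[ k < suc n ] l                           ≡⟨ ∑-const (suc n) l ⟩
  suc n * l                                  ∎)
  where open ≤-Reasoning

-- Products of primes in an interval

primePart : ℕ → ℕ
primePart i = if does (prime? i) then i else 1

-- The interval is `(m , m + j]`; with `m = 0` this is the primorial of `j`.
primesIn : ℕ → ℕ → ℕ
primesIn m zero    = 1
primesIn m (suc j) = primesIn m j * primePart (suc (m + j))

primePart-prime : ∀ {p} → Prime p → primePart p ≡ p
primePart-prime {p} pr with prime? p
... | yes _  = refl
... | no ¬pr = contradiction pr ¬pr

primePart-cases : ∀ i → (Prime i × primePart i ≡ i) ⊎ primePart i ≡ 1
primePart-cases i with prime? i
... | yes pr = inj₁ (pr , refl)
... | no  _  = inj₂ refl

primePart>0 : ∀ i → 0 < primePart i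
primePart>0 i with primePart-cases i
... | inj₁ (pr , eq) = subst (0 <_) (sym eq) (>-nonZero⁻¹ i {{prime⇒nonZero pr}})
... | inj₂ eq        = subst (0 <_) (sym eq) (s≤s z≤n)

primesIn>0 : ∀ m j → 0 < primesIn m j
primesIn>0 m zero    = s≤s z≤n
primesIn>0 m (suc j) = *-mono-≤ (primesIn>0 m j) (primePart>0 (suc (m + j)))

primesIn-+ : ∀ m i j → primesIn m (i + j) ≡ primesIn m i * primesIn (m + i) j
primesIn-+ m i zero    = trans (cong (primesIn m) (+-identityʳ i)) (sym (*-identityʳ _))
primesIn-+ m i (suc j) = trans (cong (primesIn m) (+-suc i j))
  (trans (cong₂ _*_ (primesIn-+ m i j) (cong (primePart ∘ suc) (sym (+-assoc m i j)))) (*-assoc (primesIn m i) _ _))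

prime∣primesIn : ∀ m j {p} → Prime p → m < p → p ≤ m + j → p ∣ primesIn m j
prime∣primesIn m zero    pr m<p p≤m = contradiction (≤-trans p≤m (≤-reflexive (+-identityʳ m))) (<⇒≱ m<p)
prime∣primesIn m (suc j) {p} pr m<p p≤ with m≤n⇒m<n∨m≡n (≤-trans p≤ (≤-reflexive (+-suc m j)))
... | inj₁ (s≤s p≤m+j) = ∣-trans (prime∣primesIn m j pr m<p p≤m+j) (m∣m*n _)
... | inj₂ refl        = ∣-trans (∣-reflexive (sym (primePart-prime pr))) (n∣m*n (primesIn m j))

prime∣primesIn⇒≤ : ∀ m j {p} → Prime p → p ∣ primesIn m j → p ≤ m + j
prime∣primesIn⇒≤ m zero    pr p∣1 = contradiction (subst Prime (∣1⇒≡1 p∣1) pr) ¬prime[1]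
prime∣primesIn⇒≤ m (suc j) {p} pr p∣ with euclidsLemma (primesIn m j) _ pr p∣
... | inj₁ p∣Q = ≤-trans (prime∣primesIn⇒≤ m j pr p∣Q) (+-monoʳ-≤ m (n≤1+n j))
... | inj₂ p∣q with primePart-cases (suc (m + j))
...   | inj₁ (_ , eq) = ≤-trans (∣⇒≤ (subst (p ∣_) eq p∣q)) (≤-reflexive (sym (+-suc m j)))
...   | inj₂ eq       = contradiction (subst Prime (∣1⇒≡1 (subst (p ∣_) eq p∣q)) pr) ¬prime[1]

-- A new prime `m + j + 1` exceeds all prime factors of the product so far, hence it divides the
-- cofactor.
primesIn∣ : ∀ m j {x} → (∀ {p} → Prime p → m < p → p ≤ m + j → p ∣ x) → primesIn m j ∣ x
primesIn∣ m zero    _ = 1∣ _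
primesIn∣ m (suc j) {x} all with primesIn∣ m j (λ pr m<p p≤ → all pr m<p (≤-trans p≤ (+-monoʳ-≤ m (n≤1+n j))))
... | divides q x≡qQ with primePart-cases (suc (m + j))
...   | inj₂ eq        = divides q (trans x≡qQ (cong (q *_) (sym (trans (cong (primesIn m j *_) eq) (*-identityʳ _)))))
...   | inj₁ (pr , eq) with euclidsLemma q (primesIn m j) pr (subst (suc (m + j) ∣_) x≡qQ (all pr (s≤s (m≤m+n m j)) (≤-reflexive (sym (+-suc m j)))))
...     | inj₁ (divides r q≡rp) = divides r (trans x≡qQ (trans (cong (_* primesIn m j) q≡rp)
                                    (trans (swap r (suc (m + j)) (primesIn m j)) (cong (λ z → r * (primesIn m j * z)) (sym eq)))))
  where
  swap : ∀ r p Q → r * p * Q ≡ r * (Q * p)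
  swap = solve-∀
...     | inj₂ p∣Q = contradiction (prime∣primesIn⇒≤ m j pr p∣Q) (<⇒≱ ≤-refl)

central*m!*m!≡[m+m]! : ∀ m → ((m + m) C m) * (m ! * m !) ≡ (m + m) !
central*m!*m!≡[m+m]! m = begin
  ((m + m) C m) * (m ! * m !)                  ≡⟨ cong (λ k → ((m + m) C m) * (m ! * k !)) (m+n∸m≡n m m) ⟨
  ((m + m) C m) * d                            ≡⟨ cong (_* d) (nCk≡n!/k![n-k]! (m≤m+n m m)) ⟩
  (m + m) ! / d * d                          ≡⟨ m/n*n≡m (k![n∸k]!∣n! (m≤m+n m m)) ⟩
  (m + m) !                                  ∎
  where
  open ≡-Reasoning
  d : ℕ
  d = m ! * (m + m ∸ m) !
  instance
    d≢0 : NonZero d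
    d≢0 = m !* (m + m ∸ m) !≢0

prime∣m!⇒≤ : ∀ m {p} → Prime p → p ∣ m ! → p ≤ m
prime∣m!⇒≤ zero    pr p∣1 = contradiction (subst Prime (∣1⇒≡1 p∣1) pr) ¬prime[1]
prime∣m!⇒≤ (suc m) pr p∣ with euclidsLemma (suc m) (m !) pr p∣
... | inj₁ p∣1+m = ∣⇒≤ p∣1+m
... | inj₂ p∣m!  = m≤n⇒m≤1+n (prime∣m!⇒≤ m pr p∣m!)

m∣n! : ∀ {m n} .{{_ : NonZero m}} → m ≤ n → m ∣ n !
m∣n! {suc m} m≤n = ∣-trans (m∣m*n (m !)) (m≤n⇒m!∣n! m≤n)

-- A prime in `(m , 2 m]` divides `(2 m) !` but not `m !`.
primesIn[m,m]∣central : ∀ m → primesIn m m ∣ (m + m) C m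
primesIn[m,m]∣central m = primesIn∣ m m divide
  where
  divide : ∀ {p} → Prime p → m < p → p ≤ m + m → p ∣ (m + m) C m
  divide {p} pr m<p p≤ with euclidsLemma ((m + m) C m) (m ! * m !) pr
    (subst (p ∣_) (sym (central*m!*m!≡[m+m]! m)) (m∣n! {{prime⇒nonZero pr}} p≤))
  ... | inj₁ p∣C = p∣C
  ... | inj₂ p∣m!m! with euclidsLemma (m !) (m !) pr p∣m!m!
  ...   | inj₁ p∣m! = contradiction (prime∣m!⇒≤ m pr p∣m!) (<⇒≱ m<p)
  ...   | inj₂ p∣m! = contradiction (prime∣m!⇒≤ m pr p∣m!) (<⇒≱ m<p)

-- Powers of two suffice, and they make every step an exact doubling. The new primes divide the
-- central binomial coefficient, which is a single term of the row sum `2 ^ (m + m)`.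
primorial[2^k]≤ : ∀ k → primesIn 0 (2 ^ k) ≤ 2 ^ (2 * 2 ^ k)
primorial[2^k]≤ zero    = s≤s z≤n
primorial[2^k]≤ (suc k) = begin
  primesIn 0 (2 * m)              ≡⟨ cong (λ z → primesIn 0 (m + z)) (+-identityʳ m) ⟩
  primesIn 0 (m + m)              ≡⟨ primesIn-+ 0 m m ⟩
  primesIn 0 m * primesIn m m     ≤⟨ *-mono-≤ (primorial[2^k]≤ k) (∣⇒≤ {{>-nonZero (nCk>0 (m≤m+n m m))}} (primesIn[m,m]∣central m)) ⟩
  2 ^ (2 * m) * ((m + m) C m)     ≤⟨ *-monoʳ-≤ (2 ^ (2 * m)) (term≤∑ (suc (m + m)) ((m + m) C_) (s≤s (m≤m+n m m))) ⟩
  2 ^ (2 * m) * ∑ (suc (m + m)) ((m + m) C_) ≡⟨ cong (2 ^ (2 * m) *_) (∑-binomials (m + m)) ⟩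
  2 ^ (2 * m) * 2 ^ (m + m)       ≡⟨ ^-distribˡ-+-* 2 (2 * m) (m + m) ⟨
  2 ^ (2 * m + (m + m))           ≡⟨ cong (2 ^_) (twice m) ⟩
  2 ^ (2 * (2 * m))               ∎
  where
  open ≤-Reasoning
  m : ℕ
  m = 2 ^ k
  twice : ∀ m → 2 * m + (m + m) ≡ 2 * (2 * m)
  twice = solve-∀

primeFactor : ∀ j → 1 < j → ∃[ p ] ∃[ q ] Prime p × j ≡ p * q
primeFactor 1 (s≤s ())
primeFactor j@(2+ _) _ with factorise j
... | record { factors = [] ; isFactorisation = () }
... | record { factors = p ∷ ps ; isFactorisation = eq ; factorsPrime = pr ∷ _ } = p , product ps , pr , eq

prime>1 : ∀ {p} → Prime p → 1 < p
prime>1 {p} pr = nonTrivial⇒n>1 p {{prime⇒nonTrivial pr}}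

-- A number up to `2 ^ k` has at most `k` prime factors with multiplicity, and here each of them
-- divides `s !`.
smooth∣power : ∀ s k j → 0 < j → j ≤ 2 ^ k → (∀ {p} → Prime p → p ∣ j → p ≤ s) → j ∣ (s !) ^ k
smooth∣power s zero    j 0<j j≤1 _ = ∣-reflexive (≤-antisym j≤1 0<j)
smooth∣power s (suc k) j 0<j j≤ smooth with m≤n⇒m<n∨m≡n 0<j
... | inj₂ refl = 1∣ _
... | inj₁ 1<j with primeFactor j 1<j
...   | p , zero  , pr , refl = contradiction (subst (1 <_) (*-zeroʳ p) 1<j) λ ()
...   | p , q@(suc _) , pr , refl = *-pres-∣ (m∣n! {{prime⇒nonZero pr}} (smooth pr (m∣m*n q)))
  (smooth∣power s k q (s≤s z≤n) (*-cancelˡ-≤ 2 (≤-trans (*-monoˡ-≤ q (prime>1 pr)) j≤)) (λ pr′ p′∣q → smooth pr′ (∣-trans p′∣q (n∣m*n p))))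

bigPrimeFactor? : ∀ s j → 0 < j → Dec (∃[ p ] p < suc j × Prime p × p ∣ j × s < p)
bigPrimeFactor? s j _ = anyUpTo? (λ p → prime? p ×-dec ((p ∣? j) ×-dec (s <? p))) (suc j)

-- If `j ≤ s²` has a prime factor above `s`, then the cofactor is at most `s` and divides `s !`,
-- while the prime is covered by the primorial. Otherwise `smooth∣power` applies.
commonMultiple : ∀ s k n → 0 < k → s * s ≤ 2 ^ k → (∀ {p} → Prime p → p ≤ s * s → p ≤ n) → CommonMultiple (s * s) (primesIn 0 n * (s !) ^ k)
commonMultiple s k n 0<k s²≤ small j 0<j j≤s² with bigPrimeFactor? s j 0<j
... | no none = ∣-trans (smooth∣power s k j 0<j (≤-trans j≤s² s²≤) smooth) (n∣m*n (primesIn 0 n))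
  where
  smooth : ∀ {p} → Prime p → p ∣ j → p ≤ s
  smooth {p} pr p∣j = ≮⇒≥ (λ s<p → none (p , s≤s (∣⇒≤ {{>-nonZero 0<j}} p∣j) , pr , p∣j , s<p))
... | yes (p , s≤s p≤j , pr , divides q refl , s<p) = subst (_∣ primesIn 0 n * (s !) ^ k) (*-comm p q) (*-pres-∣ (prime∣primesIn 0 n pr (≤-trans (s≤s z≤n) (prime>1 pr)) (small pr (≤-trans p≤j j≤s²))) q∣)
  where
  q≤s : q ≤ s
  q≤s = ≮⇒≥ (λ s<q → <⇒≱ (*-mono-< s<q s<p) j≤s²)
  q≢0 : NonZero q
  q≢0 = m*n≢0⇒m≢0 q {{>-nonZero 0<j}}
  q∣ : q ∣ (s !) ^ k
  q∣ = ∣-trans (m∣n! {{q≢0}} q≤s) (subst (λ i → s ! ∣ (s !) ^ i) (suc-pred k {{>-nonZero 0<k}}) (m∣m*n _))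

n!≤n^n : ∀ n → n ! ≤ n ^ n
n!≤n^n n = bounded n ≤-refl
  where
  bounded : ∀ {m} k → k ≤ m → k ! ≤ m ^ k
  bounded zero    _   = s≤s z≤n
  bounded (suc k) k<m = *-mono-≤ k<m (bounded k (<⇒≤ k<m))

-- Eight is the least `u` with this property; at seven both sides are 128.
2[1+u]²<2^u : ∀ {u} → 8 ≤ u → 2 * (suc u * suc u) < 2 ^ u
2[1+u]²<2^u 8≤u with m≤n⇒∃[o]m+o≡n 8≤u
... | v , refl = shifted v
  where
  growth : ∀ v → 2 * ((10 + v) * (10 + v)) + (124 + 32 * v + 2 * (v * v)) ≡ 2 * (2 * ((9 + v) * (9 + v)))
  growth = solve-∀
  double : ∀ {x y z} → x ≤ 2 * y → y < z → x < 2 * z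
  double x≤ y<z = ≤-<-trans x≤ (*-monoʳ-< 2 y<z)
  shifted : ∀ v → 2 * (suc (8 + v) * suc (8 + v)) < 2 ^ (8 + v)
  shifted zero    = ≤ᵇ⇒≤ 163 256 _
  shifted (suc v) = double {x = 2 * (suc (9 + v) * suc (9 + v))} (≤-trans (m≤m+n _ (124 + 32 * v + 2 * (v * v))) (≤-reflexive (growth v))) (shifted v)

-- If all primes up to 4ᵗ were at most n = 4ᵗ⁻¹, then with s = 2ᵗ the number n# · s!²ᵗ, which is less than
-- 2 ^ (4ᵗ − 1), would be a common multiple of 1, …, 4ᵗ.
prime-between : ∀ u → 8 ≤ u → ∃[ p ] Prime p × 4 ^ u < p × p ≤ 4 ^ suc u
prime-between u 8≤u with anyUpTo? (λ p → prime? p ×-dec (4 ^ u <? p)) (suc (4 ^ suc u))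
... | yes (p , s≤s p≤ , pr , n<p) = p , pr , n<p , p≤
... | no none = contradiction exponents (<⇒≱ tooSmall)
  where
  open ≤-Reasoning
  t s n k : ℕ
  t = suc u
  s = 2 ^ t
  n = 4 ^ u
  k = 2 * t
  n≡ : n ≡ 2 ^ (2 * u)
  n≡ = ^-*-assoc 2 2 u
  s²≡2^k : s * s ≡ 2 ^ k
  s²≡2^k = trans (sym (^-distribˡ-+-* 2 t t)) (cong (λ z → 2 ^ (t + z)) (sym (+-identityʳ t)))
  s²≡4n : s * s ≡ 4 * n
  s²≡4n = trans s²≡2^k (sym (^-*-assoc 2 2 t))
  small : ∀ {p} → Prime p → p ≤ s * s → p ≤ n
  small {p} pr p≤ = ≮⇒≥ (λ n<p → none (p , s≤s (≤-trans p≤ (≤-reflexive s²≡4n)) , pr , n<p))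
  multiple : ℕ
  multiple = primesIn 0 n * (s !) ^ k
  instance
    multiple≢0 : NonZero multiple
    multiple≢0 = m*n≢0 (primesIn 0 n) ((s !) ^ k) {{>-nonZero (primesIn>0 0 n)}} {{m^n≢0 (s !) k {{s !≢0}}}}
  upperExponent : ℕ
  upperExponent = 2 * n + t * s * k
  multiple≤ : multiple ≤ 2 ^ upperExponent
  multiple≤ = begin
    primesIn 0 n * (s !) ^ k                 ≤⟨ *-mono-≤ (≤-trans (≤-reflexive (cong (primesIn 0) n≡)) (primorial[2^k]≤ (2 * u))) (^-monoˡ-≤ k (n!≤n^n s)) ⟩
    2 ^ (2 * 2 ^ (2 * u)) * (s ^ s) ^ k      ≡⟨ cong₂ _*_ (cong (λ z → 2 ^ (2 * z)) (sym n≡)) (trans (cong (_^ k) (^-*-assoc 2 t s)) (^-*-assoc 2 (t * s) k)) ⟩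
    2 ^ (2 * n) * 2 ^ (t * s * k)            ≡⟨ ^-distribˡ-+-* 2 (2 * n) (t * s * k) ⟨
    2 ^ upperExponent                        ∎
  1+pred : suc (pred (s * s)) ≡ s * s
  1+pred = suc-pred (s * s) {{m*n≢0 s s {{m^n≢0 2 t}} {{m^n≢0 2 t}}}}
  exponents : s * s ≤ suc upperExponent
  exponents = begin
    s * s                                  ≡⟨ 1+pred ⟨
    suc (pred (s * s))       ≤⟨ s≤s (≮⇒≥ λ upper< → <⇒≱ (^-monoʳ-< 2 (s≤s (s≤s z≤n)) upper<)
                                                (≤-trans (2^n≤commonMultiple _ (λ j 0<j j≤ → commonMultiple s k n (s≤s z≤n) (≤-reflexive s²≡2^k) small j 0<j (≤-trans j≤ (≤-reflexive 1+pred)))) multiple≤)) ⟩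
    suc upperExponent                      ∎
  regroup : ∀ t s → t * s * (2 * t) ≡ s * (2 * (t * t))
  regroup = solve-∀
  half : ∀ b → 2 * (b * b) + 2 * b * b ≡ 4 * (b * b)
  half = solve-∀
  n≡2^u*2^u : n ≡ 2 ^ u * 2 ^ u
  n≡2^u*2^u = trans n≡ (trans (cong (λ z → 2 ^ (u + z)) (+-identityʳ u)) (^-distribˡ-+-* 2 u u))
  -- `2 * n` is half of `s * s`. The other half is `s * 2 ^ u`, and it has to exceed
  -- `1 + t * s * k`, that is, `1 + s * (2 t²)`.
  tooSmall : suc upperExponent < s * s
  tooSmall = begin-strict
    suc (2 * n + t * s * k)                ≡⟨ +-suc (2 * n) (t * s * k) ⟨
    2 * n + suc (t * s * k)                ≡⟨ cong (λ z → 2 * n + suc z) (regroup t s) ⟩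
    2 * n + suc (s * (2 * (t * t)))        <⟨ +-monoʳ-< (2 * n) (n<1+n _) ⟩
    2 * n + (2 + s * (2 * (t * t)))        ≤⟨ +-monoʳ-≤ (2 * n) (+-monoˡ-≤ (s * (2 * (t * t))) (^-monoʳ-≤ 2 {1} {t} (s≤s z≤n))) ⟩
    2 * n + (s + s * (2 * (t * t)))        ≡⟨ cong (2 * n +_) (*-suc s (2 * (t * t))) ⟨
    2 * n + s * suc (2 * (t * t))          ≤⟨ +-monoʳ-≤ (2 * n) (*-monoʳ-≤ s (2[1+u]²<2^u 8≤u)) ⟩
    2 * n + s * 2 ^ u                      ≡⟨ cong (λ z → 2 * z + s * 2 ^ u) n≡2^u*2^u ⟩
    2 * (2 ^ u * 2 ^ u) + 2 * 2 ^ u * 2 ^ u ≡⟨ half (2 ^ u) ⟩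
    4 * (2 ^ u * 2 ^ u)                    ≡⟨ cong (4 *_) n≡2^u*2^u ⟨
    4 * n                                  ≡⟨ s²≡4n ⟨
    s * s                                  ∎

-- Bordered six-cycles

cyclicSuc? : ∀ {n} (i j : Fin n) → Dec (CyclicSuc i j)
cyclicSuc? {n} i j = (toℕ j ≟ suc (toℕ i)) ⊎-dec ((suc (toℕ i) ≟ n) ×-dec (toℕ j ≟ 0))

steps⇒< : ∀ {m n} (f : Fin (suc m) → Fin n) → (∀ i → f (inject₁ i) Fin.< f (suc i)) → ∀ {i j} → i Fin.< j → f i Fin.< f j
steps⇒< {suc m} f step {zero}  {suc zero}    _         = step zero
steps⇒< {suc m} f step {zero}  {suc (suc j)} _         = <-trans (step zero) (steps⇒< (f ∘ suc) (step ∘ suc) {zero} {suc j} (s≤s z≤n))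
steps⇒< {suc m} f step {suc i} {suc j}       (s≤s i<j) = steps⇒< (f ∘ suc) (step ∘ suc) i<j

-- The six-vertex graph with parts {0,1,2} and {3,4,5} in which 3 + opp i is the only vertex of the second
-- part that is not adjacent to i.
module Model (opp : Fin 3 → Fin 3) where

  side : Fin 6 → Fin 3 ⊎ Fin 3
  side = splitAt 3

  cross : Fin 3 ⊎ Fin 3 → Fin 3 ⊎ Fin 3 → Bool
  cross (inj₁ u) (inj₂ v) = not (does (v Fin.≟ opp u))
  cross _        _        = false

  model : OrderedGraph 6
  model = graphOf (λ i j → cross (side i) (side j))

  part : Fin 6 → Fin 2
  part i = Sum.[ (λ _ → 0F) , (λ _ → 1F) ]′ (side i)

  -- Gathering these facts about explicit tables in one decidable proposition lets each of the three
  -- bordered cycles be verified by evaluation.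
  IsModelOf : Vec (Fin 6) 6 → Vec (Fin 6) 6 → Set
  IsModelOf cycle position =
    (∀ i → lookup cycle (lookup position i) ≡ i) × (∀ i → lookup position (lookup cycle i) ≡ i) ×
    (∀ i j → (Adj model (lookup cycle i) (lookup cycle j) → CyclicSuc i j ⊎ CyclicSuc j i) ×
             (CyclicSuc i j ⊎ CyclicSuc j i → Adj model (lookup cycle i) (lookup cycle j))) ×
    (∀ i j → part i ≡ part j → ¬ Adj model i j) × Adj model 0F 5F × Adj model 2F 3F

  isModelOf? : ∀ cycle position → Dec (IsModelOf cycle position)
  isModelOf? cycle position =
    Fin.all? (λ i → lookup cycle (lookup position i) Fin.≟ i) ×-dec
    Fin.all? (λ i → lookup position (lookup cycle i) Fin.≟ i) ×-dec
    Fin.all? (λ i → Fin.all? λ j → let adjacent = T? (OrderedGraph.adj model (lookup cycle i) (lookup cycle j))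
                                       consecutive = cyclicSuc? i j ⊎-dec cyclicSuc? j i
                                   in (adjacent →-dec consecutive) ×-dec (consecutive →-dec adjacent)) ×-dec
    Fin.all? (λ i → Fin.all? λ j → (part i Fin.≟ part j) →-dec ¬? (T? (OrderedGraph.adj model i j))) ×-dec
    T? (OrderedGraph.adj model 0F 5F) ×-dec T? (OrderedGraph.adj model 2F 3F)

  _≤₆?_ : (i j : Fin 6) → Dec (i Fin.≤ j)
  i ≤₆? j = i Fin.≤? j

  model-bordered : ∀ cycle position → {True (isModelOf? cycle position)} → IsBorderedCycle model
  model-bordered cycle position {witness} = fromModel (toWitness witness)
    where
    fromModel : IsModelOf cycle position → IsBorderedCycle model
    fromModel (inverseˡ , inverseʳ , adjacent , independent , outer , inner) = record
      { isCycle  = s≤s (s≤s (s≤s z≤n)) , permutation (lookup cycle) (lookup position) inverseˡ inverseʳ ,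
                   λ i j → mk⇔ (proj₁ (adjacent i j)) (proj₂ (adjacent i j))
      ; χ<≡2     = record { partition = partition ; minimal = minimal }
      ; bordered = partition , (2F , 3F , (refl , from-yes (Fin.all? λ j → (part j Fin.≟ 0F) →-dec (j ≤₆? 2F)))
                                        , (refl , from-yes (Fin.all? λ j → (part j Fin.≟ 1F) →-dec (3F ≤₆? j))) , inner)
                             , (0F , 5F , (refl , from-yes (Fin.all? λ j → (part j Fin.≟ 0F) →-dec (0F ≤₆? j)))
                                        , (refl , from-yes (Fin.all? λ j → (part j Fin.≟ 1F) →-dec (j ≤₆? 5F))) , outer)
      }
      where
      partition : IntervalPartition model 2
      partition = record
        { part        = part
        ; monotone    = λ {i} {j} → from-yes (Fin.all? λ i → Fin.all? λ j → (i ≤₆? j) →-dec (part i Fin.≤? part j)) i j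
        ; surjective  = λ { 0F → 0F , refl ; 1F → 3F , refl }
        ; independent = λ {i} {j} → independent i j
        }
      minimal : ∀ c′ → IntervalPartition model c′ → 2 ≤ c′
      minimal zero          𝓟 with IntervalPartition.part 𝓟 0F
      ... | ()
      -- A single interval would contain both ends of the outer border.
      minimal (suc zero)    𝓟 = contradiction outer (IntervalPartition.independent 𝓟 {0F} {5F} (unique _ _))
        where
        unique : (i j : Fin 1) → i ≡ j
        unique 0F 0F = refl
      minimal (suc (suc _)) 𝓟 = s≤s (s≤s z≤n)

  containsModel : ∀ {n} {G : OrderedGraph n} (a b : Fin 3 → Fin n) → a 0F Fin.< a 1F → a 1F Fin.< a 2F → a 2F Fin.< b 0F →
    b 0F Fin.< b 1F → b 1F Fin.< b 2F → (∀ i j → j ≢ opp i → Adj G (a i) (b j)) → G ContainsSubgraph model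
  containsModel {n} {G} a b a₀<a₁ a₁<a₂ a₂<b₀ b₀<b₁ b₁<b₂ edges = record
    { embed     = embed
    ; injective = λ {i} {j} → embed-injective i j
    ; monotone  = λ {i} {j} → embed-monotone i j
    ; edge      = λ {i} {j} → edge i j
    }
    where
    embed : Fin 6 → Fin n
    embed i = Sum.[ a , b ]′ (side i)
    embed-< : ∀ {i j} → i Fin.< j → embed i Fin.< embed j
    embed-< = steps⇒< embed λ { 0F → a₀<a₁ ; 1F → a₁<a₂ ; 2F → a₂<b₀ ; 3F → b₀<b₁ ; 4F → b₁<b₂ }
    embed-injective : ∀ i j → embed i ≡ embed j → i ≡ j
    embed-injective i j eq with Fin.<-cmp i j
    ... | tri< i<j _ _ = contradiction (cong toℕ eq) (<⇒≢ (embed-< i<j))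
    ... | tri≈ _ i≡j _ = i≡j
    ... | tri> _ _ j<i = contradiction (cong toℕ (sym eq)) (<⇒≢ (embed-< j<i))
    embed-monotone : ∀ i j → i Fin.≤ j → embed i Fin.≤ embed j
    embed-monotone i j i≤j with m≤n⇒m<n∨m≡n i≤j
    ... | inj₁ i<j = <⇒≤ (embed-< i<j)
    ... | inj₂ i≡j = ≤-reflexive (cong (toℕ ∘ embed) (Fin.toℕ-injective i≡j))
    forward : ∀ x y → T (cross x y) → Adj G (Sum.[ a , b ]′ x) (Sum.[ a , b ]′ y)
    forward (inj₁ u) (inj₂ v) h = edges u v (λ eq → T-not⁻ h (does⁺ (v Fin.≟ opp u) eq))
    edge : ∀ i j → Adj model i j → Adj G (embed i) (embed j)
    edge i j h with Fin.<-cmp i j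
    ... | tri< i<j _ _ = forward (side i) (side j) (graphOf⁻ (λ i j → cross (side i) (side j)) i<j h)
    ... | tri≈ _ i≡j _ = contradiction h (OrderedGraph.~-irrefl model i≡j)
    ... | tri> _ _ j<i = OrderedGraph.~-sym G (forward (side j) (side i)
                           (graphOf⁻ (λ i j → cross (side i) (side j)) j<i (OrderedGraph.~-sym model {i} {j} h)))

fin3 : ∀ {A : Set} → A → A → A → Fin 3 → A
fin3 x y z 0F = x
fin3 x y z 1F = y
fin3 x y z 2F = z

ContainsBordered : ∀ {n} → OrderedGraph n → Set
ContainsBordered G = Σ[ H ∈ OrderedGraph 6 ] IsBorderedCycle H × G ContainsSubgraph H

hexagon⇒bordered : ∀ {n} {G : OrderedGraph n} → Hexagon G → ContainsBordered G
hexagon⇒bordered {G = G} (hexagon {u₁} {u₂} {u₃} {v₁} {v₂} {v₃} u₁<u₂ u₂<u₃ u₃<v₁ u₃<v₂ v₁<v₃ v₂≢v₁ v₂≢v₃ u₁v₂ u₁v₃ u₂v₁ u₂v₃ u₃v₁ u₃v₂)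
  with Fin.<-cmp v₂ v₁ | Fin.<-cmp v₂ v₃
-- In all three cases the first vector runs through `u₁`, `v₂`, `u₃`, `v₁`, `u₂`, `v₃`, numbered
-- according to the order of the `vᵢ`; the second vector is its inverse.
... | tri< v₂<v₁ _ _ | _ = model , model-bordered (0F ∷ 3F ∷ 2F ∷ 4F ∷ 1F ∷ 5F ∷ []) (0F ∷ 4F ∷ 2F ∷ 1F ∷ 3F ∷ 5F ∷ []) ,
    containsModel {G = G} (fin3 u₁ u₂ u₃) (fin3 v₂ v₁ v₃) u₁<u₂ u₂<u₃ u₃<v₂ v₂<v₁ v₁<v₃ edges
  where
  opp = fin3 1F 0F 2F
  open Model opp
  edges : ∀ i j → j ≢ opp i → Adj G (fin3 u₁ u₂ u₃ i) (fin3 v₂ v₁ v₃ j)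
  edges 0F 0F _ = u₁v₂
  edges 0F 1F h = contradiction refl h
  edges 0F 2F _ = u₁v₃
  edges 1F 0F h = contradiction refl h
  edges 1F 1F _ = u₂v₁
  edges 1F 2F _ = u₂v₃
  edges 2F 0F _ = u₃v₂
  edges 2F 1F _ = u₃v₁
  edges 2F 2F h = contradiction refl h
... | tri≈ _ v₂≡v₁ _ | _ = contradiction v₂≡v₁ v₂≢v₁
... | tri> _ _ v₁<v₂ | tri< v₂<v₃ _ _ = model , model-bordered (0F ∷ 4F ∷ 2F ∷ 3F ∷ 1F ∷ 5F ∷ []) (0F ∷ 4F ∷ 2F ∷ 3F ∷ 1F ∷ 5F ∷ []) ,
    containsModel {G = G} (fin3 u₁ u₂ u₃) (fin3 v₁ v₂ v₃) u₁<u₂ u₂<u₃ u₃<v₁ v₁<v₂ v₂<v₃ edges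
  where
  opp = fin3 0F 1F 2F
  open Model opp
  edges : ∀ i j → j ≢ opp i → Adj G (fin3 u₁ u₂ u₃ i) (fin3 v₁ v₂ v₃ j)
  edges 0F 0F h = contradiction refl h
  edges 0F 1F _ = u₁v₂
  edges 0F 2F _ = u₁v₃
  edges 1F 0F _ = u₂v₁
  edges 1F 1F h = contradiction refl h
  edges 1F 2F _ = u₂v₃
  edges 2F 0F _ = u₃v₁
  edges 2F 1F _ = u₃v₂
  edges 2F 2F h = contradiction refl h
... | tri> _ _ v₁<v₂ | tri≈ _ v₂≡v₃ _ = contradiction v₂≡v₃ v₂≢v₃
... | tri> _ _ v₁<v₂ | tri> _ _ v₃<v₂ = model , model-bordered (0F ∷ 5F ∷ 2F ∷ 3F ∷ 1F ∷ 4F ∷ []) (0F ∷ 4F ∷ 2F ∷ 3F ∷ 5F ∷ 1F ∷ []) ,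
    containsModel {G = G} (fin3 u₁ u₂ u₃) (fin3 v₁ v₃ v₂) u₁<u₂ u₂<u₃ u₃<v₁ v₁<v₃ v₃<v₂ edges
  where
  opp = fin3 0F 2F 1F
  open Model opp
  edges : ∀ i j → j ≢ opp i → Adj G (fin3 u₁ u₂ u₃ i) (fin3 v₁ v₃ v₂ j)
  edges 0F 0F h = contradiction refl h
  edges 0F 1F _ = u₁v₃
  edges 0F 2F _ = u₁v₂
  edges 1F 0F _ = u₂v₁
  edges 1F 1F _ = u₂v₃
  edges 1F 2F h = contradiction refl h
  edges 2F 0F _ = u₃v₁
  edges 2F 1F h = contradiction refl h
  edges 2F 2F _ = u₃v₂

-- From bordered cycles to hexagons

Ascending : ∀ {n} → (Fin 3 → Fin n) → Fin 3 → Fin 3 → Fin 3 → Set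
Ascending a i j k = (a i Fin.< a j × a j Fin.< a k) × (i ≢ j × i ≢ k × j ≢ k)

sort3 : ∀ {n} (a : Fin 3 → Fin n) → (∀ {i j} → a i ≡ a j → i ≡ j) → ∃[ i ] ∃[ j ] ∃[ k ] Ascending a i j k
sort3 a injective with compare 0F 1F (λ ()) | compare 0F 2F (λ ()) | compare 1F 2F (λ ())
  where
  compare : ∀ i j → i ≢ j → a i Fin.< a j ⊎ a j Fin.< a i
  compare i j i≢j with Fin.<-cmp (a i) (a j)
  ... | tri< lt _ _ = inj₁ lt
  ... | tri≈ _ eq _ = contradiction (injective eq) i≢j
  ... | tri> _ _ gt = inj₂ gt
... | inj₁ 0<1 | _        | inj₁ 1<2 = 0F , 1F , 2F , (0<1 , 1<2) , (λ ()) , (λ ()) , (λ ())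
... | inj₁ 0<1 | inj₁ 0<2 | inj₂ 2<1 = 0F , 2F , 1F , (0<2 , 2<1) , (λ ()) , (λ ()) , (λ ())
... | inj₁ 0<1 | inj₂ 2<0 | inj₂ 2<1 = 2F , 0F , 1F , (2<0 , 0<1) , (λ ()) , (λ ()) , (λ ())
... | inj₂ 1<0 | inj₁ 0<2 | _        = 1F , 0F , 2F , (1<0 , 0<2) , (λ ()) , (λ ()) , (λ ())
... | inj₂ 1<0 | inj₂ 2<0 | inj₁ 1<2 = 1F , 2F , 0F , (1<2 , 2<0) , (λ ()) , (λ ()) , (λ ())
... | inj₂ 1<0 | inj₂ 2<0 | inj₂ 2<1 = 2F , 1F , 0F , (2<1 , 1<0) , (λ ()) , (λ ()) , (λ ())

exhaust : ∀ {i j k : Fin 3} → i ≢ j → i ≢ k → j ≢ k → ∀ l → l ≡ i ⊎ l ≡ j ⊎ l ≡ k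
exhaust {i} {j} {k} i≢j i≢k j≢k l = toWitness {a? = all} _ i j k l i≢j i≢k j≢k
  where
  all : Dec (∀ (i j k l : Fin 3) → i ≢ j → i ≢ k → j ≢ k → l ≡ i ⊎ l ≡ j ⊎ l ≡ k)
  all = Fin.all? λ i → Fin.all? λ j → Fin.all? λ k → Fin.all? λ l →
    ¬? (i Fin.≟ j) →-dec (¬? (i Fin.≟ k) →-dec (¬? (j Fin.≟ k) →-dec ((l Fin.≟ i) ⊎-dec ((l Fin.≟ j) ⊎-dec (l Fin.≟ k)))))

-- Let `i` and `k` label the smallest and the largest of the `a`. If `b k < b i`, then either `b i`
-- is the largest of the `b`, and the outer border would join opposite vertices, or `b k` is the
-- smallest, and the inner border would.
labelled⇒hexagon : ∀ {n} {H : OrderedGraph n} (a b : Fin 3 → Fin n) →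
  (∀ {i j} → a i ≡ a j → i ≡ j) → (∀ {i j} → b i ≡ b j → i ≡ j) → (∀ i j → a i Fin.< b j) → (∀ {i j} → i ≢ j → Adj H (a i) (b j)) →
  (∀ i → (∀ j → a i Fin.≤ a j) → (∀ j → b j Fin.≤ b i) → ⊥) →
  (∀ i → (∀ j → a j Fin.≤ a i) → (∀ j → b i Fin.≤ b j) → ⊥) → Hexagon H
labelled⇒hexagon {H = H} a b a-injective b-injective a<b edge noOuter noInner with sort3 a a-injective
... | i , j , k , (aᵢ<aⱼ , aⱼ<aₖ) , (i≢j , i≢k , j≢k) =
  hexagon aᵢ<aⱼ aⱼ<aₖ (a<b k i) (a<b k j) bᵢ<bₖ (i≢j ∘ sym ∘ b-injective) (j≢k ∘ b-injective)
    (edge i≢j) (edge i≢k) (edge (≢-sym i≢j)) (edge j≢k) (edge (≢-sym i≢k)) (edge (≢-sym j≢k))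
  where
  forAll : ∀ {P : Fin 3 → Set} → P i → P j → P k → ∀ l → P l
  forAll {P} pᵢ pⱼ pₖ l with exhaust i≢j i≢k j≢k l
  ... | inj₁ refl        = pᵢ
  ... | inj₂ (inj₁ refl) = pⱼ
  ... | inj₂ (inj₂ refl) = pₖ
  bᵢ<bₖ : b i Fin.< b k
  bᵢ<bₖ with Fin.<-cmp (b i) (b k)
  ... | tri< lt _ _ = lt
  ... | tri≈ _ eq _ = contradiction (b-injective eq) i≢k
  ... | tri> _ _ bₖ<bᵢ with <-cmp (toℕ (b j)) (toℕ (b i))
  ...   | tri< bⱼ<bᵢ _ _ = ⊥-elim (noOuter i (forAll ≤-refl (<⇒≤ aᵢ<aⱼ) (<⇒≤ (<-trans aᵢ<aⱼ aⱼ<aₖ))) (forAll ≤-refl (<⇒≤ bⱼ<bᵢ) (<⇒≤ bₖ<bᵢ)))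
  ...   | tri≈ _ eq _    = contradiction (b-injective (Fin.toℕ-injective eq)) (≢-sym i≢j)
  ...   | tri> _ _ bᵢ<bⱼ = ⊥-elim (noInner k (forAll (<⇒≤ (<-trans aᵢ<aⱼ aⱼ<aₖ)) (<⇒≤ aⱼ<aₖ) ≤-refl) (forAll (<⇒≤ bₖ<bᵢ) (<⇒≤ (<-trans bₖ<bᵢ bᵢ<bⱼ)) ≤-refl))

hexagon-image : ∀ {m n} {H : OrderedGraph m} {G : OrderedGraph n} → G ContainsSubgraph H → Hexagon H → Hexagon G
hexagon-image {G = G} contains (hexagon u₁<u₂ u₂<u₃ u₃<v₁ u₃<v₂ v₁<v₃ v₂≢v₁ v₂≢v₃ u₁v₂ u₁v₃ u₂v₁ u₂v₃ u₃v₁ u₃v₂) =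
  hexagon {G = G} (strict u₁<u₂) (strict u₂<u₃) (strict u₃<v₁) (strict u₃<v₂) (strict v₁<v₃) (v₂≢v₁ ∘ injective) (v₂≢v₃ ∘ injective)
    (edge u₁v₂) (edge u₁v₃) (edge u₂v₁) (edge u₂v₃) (edge u₃v₁) (edge u₃v₂)
  where
  open _ContainsSubgraph_ contains
  strict : ∀ {i j} → i Fin.< j → embed i Fin.< embed j
  strict i<j = ≤∧≢⇒< (monotone (<⇒≤ i<j)) (λ eq → <⇒≢ i<j (cong toℕ (injective (Fin.toℕ-injective eq))))

-- Two ways of reading off the six positions of a cycle as alternating triples in which α i is opposite β i.
evens odds oddsOpposite evensOpposite : Fin 3 → Fin 6
evens         = fin3 0F 2F 4F
oddsOpposite  = fin3 3F 5F 1F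
odds          = fin3 1F 3F 5F
evensOpposite = fin3 4F 0F 2F

IsAlternating : (α β : Fin 3 → Fin 6) → Set
IsAlternating α β =
  (∀ i j → α i ≡ α j → i ≡ j) × (∀ i j → β i ≡ β j → i ≡ j) ×
  (∀ i j → i ≢ j → CyclicSuc (α i) (β j) ⊎ CyclicSuc (β j) (α i)) ×
  (∀ i → ¬ (CyclicSuc (α i) (β i) ⊎ CyclicSuc (β i) (α i))) ×
  (∀ k → (∃[ i ] k ≡ α i) ⊎ (∃[ i ] k ≡ β i))

isAlternating? : ∀ α β → Dec (IsAlternating α β)
isAlternating? α β =
  Fin.all? (λ i → Fin.all? λ j → (α i Fin.≟ α j) →-dec (i Fin.≟ j)) ×-dec
  Fin.all? (λ i → Fin.all? λ j → (β i Fin.≟ β j) →-dec (i Fin.≟ j)) ×-dec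
  Fin.all? (λ i → Fin.all? λ j → ¬? (i Fin.≟ j) →-dec (cyclicSuc? (α i) (β j) ⊎-dec cyclicSuc? (β j) (α i))) ×-dec
  Fin.all? (λ i → ¬? (cyclicSuc? (α i) (β i) ⊎-dec cyclicSuc? (β i) (α i))) ×-dec
  Fin.all? (λ k → Fin.any? (λ i → k Fin.≟ α i) ⊎-dec Fin.any? (λ i → k Fin.≟ β i))

fin2 : ∀ (x : Fin 2) → x ≡ 0F ⊎ x ≡ 1F
fin2 0F = inj₁ refl
fin2 1F = inj₂ refl

module _ {H : OrderedGraph 6} (σ : Permutation′ 6)
  (consecutive : ∀ i j → Adj H (σ ⟨$⟩ʳ i) (σ ⟨$⟩ʳ j) ⇔ (CyclicSuc i j ⊎ CyclicSuc j i))
  (𝓟 : IntervalPartition H 2) where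

  open IntervalPartition 𝓟

  private
    w : Fin 6 → Fin 6
    w i = σ ⟨$⟩ʳ i

  otherPart : ∀ {i j} → CyclicSuc i j ⊎ CyclicSuc j i → part (w i) ≢ part (w j)
  otherPart {i} {j} c eq = independent eq (Equivalence.from (consecutive i j) c)

  otherPart₀ : ∀ {i j} → CyclicSuc i j ⊎ CyclicSuc j i → part (w i) ≡ 0F → part (w j) ≡ 1F
  otherPart₀ {j = j} c wᵢ≡0 with fin2 (part (w j))
  ... | inj₁ wⱼ≡0 = contradiction (trans wᵢ≡0 (sym wⱼ≡0)) (otherPart c)
  ... | inj₂ wⱼ≡1 = wⱼ≡1

  otherPart₁ : ∀ {i j} → CyclicSuc i j ⊎ CyclicSuc j i → part (w i) ≡ 1F → part (w j) ≡ 0F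
  otherPart₁ {j = j} c wᵢ≡1 with fin2 (part (w j))
  ... | inj₁ wⱼ≡0 = wⱼ≡0
  ... | inj₂ wⱼ≡1 = contradiction (trans wᵢ≡1 (sym wⱼ≡1)) (otherPart c)

  -- A labelled vertex that is extreme in its part coincides with the end of a border there. If two
  -- such vertices were opposite, the border would be an edge between `a i` and `b i`, which the
  -- cycle lacks.
  alternating⇒hexagon : HasInnerBorder 𝓟 → HasOuterBorder 𝓟 → ∀ α β → IsAlternating α β →
    (∀ i → part (w (α i)) ≡ 0F) → (∀ i → part (w (β i)) ≡ 1F) → Hexagon H
  alternating⇒hexagon (iu , iv , (iu∈U , iu-last) , (iv∈V , iv-first) , inner) (ou , ov , (ou∈U , ou-first) , (ov∈V , ov-last) , outer)
    α β (α-injective , β-injective , near , opposite , covering) α∈U β∈V =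
    labelled⇒hexagon a b (α-injective _ _ ∘ w-injective) (β-injective _ _ ∘ w-injective) a<b
      (λ {i} {j} i≢j → Equivalence.from (consecutive (α i) (β j)) (near i j i≢j))
      (λ i a-min b-max → nonadjacent i (subst₂ (Adj H)
        (≤-antisym′ (ou-first (a i) (α∈U i)) (belowU ou∈U a-min)) (≤-antisym′ (aboveV ov∈V b-max) (ov-last (b i) (β∈V i))) outer))
      (λ i a-max b-min → nonadjacent i (subst₂ (Adj H)
        (≤-antisym′ (aboveU iu∈U a-max) (iu-last (a i) (α∈U i))) (≤-antisym′ (iv-first (b i) (β∈V i)) (belowV iv∈V b-min)) inner))
    where
    a b : Fin 3 → Fin 6
    a = w ∘ α
    b = w ∘ β
    w-injective : ∀ {i j} → w i ≡ w j → i ≡ j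
    w-injective {i} {j} eq = trans (sym (Permutation.inverseˡ σ)) (trans (cong (σ ⟨$⟩ˡ_) eq) (Permutation.inverseˡ σ))
    ≤-antisym′ : ∀ {i j : Fin 6} → i Fin.≤ j → j Fin.≤ i → i ≡ j
    ≤-antisym′ i≤j j≤i = Fin.toℕ-injective (≤-antisym i≤j j≤i)
    a<b : ∀ i j → a i Fin.< b j
    a<b i j = ≰⇒> λ b≤a → contradiction (subst₂ Fin._≤_ (β∈V j) (α∈U i) (monotone b≤a)) λ ()
    nonadjacent : ∀ i → ¬ Adj H (a i) (b i)
    nonadjacent i h = opposite i (Equivalence.to (consecutive (α i) (β i)) h)
    position : ∀ u → (∃[ i ] u ≡ a i) ⊎ (∃[ i ] u ≡ b i)
    position u = Sum.map (λ (i , eq) → i , trans (sym (Permutation.inverseʳ σ)) (cong w eq)) (λ (i , eq) → i , trans (sym (Permutation.inverseʳ σ)) (cong w eq)) (covering (σ ⟨$⟩ˡ u))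
    inU : ∀ {u} → part u ≡ 0F → ∃[ i ] u ≡ a i
    inU {u} u∈U with position u
    ... | inj₁ p          = p
    ... | inj₂ (i , refl) = contradiction (trans (sym u∈U) (β∈V i)) λ ()
    inV : ∀ {v} → part v ≡ 1F → ∃[ i ] v ≡ b i
    inV {v} v∈V with position v
    ... | inj₁ (i , refl) = contradiction (trans (sym v∈V) (α∈U i)) λ ()
    ... | inj₂ p          = p
    belowU : ∀ {i u} → part u ≡ 0F → (∀ j → a i Fin.≤ a j) → a i Fin.≤ u
    belowU u∈U h with inU u∈U
    ... | j , refl = h j
    aboveU : ∀ {i u} → part u ≡ 0F → (∀ j → a j Fin.≤ a i) → u Fin.≤ a i
    aboveU u∈U h with inU u∈U
    ... | j , refl = h j
    belowV : ∀ {i v} → part v ≡ 1F → (∀ j → b i Fin.≤ b j) → b i Fin.≤ v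
    belowV v∈V h with inV v∈V
    ... | j , refl = h j
    aboveV : ∀ {i v} → part v ≡ 1F → (∀ j → b j Fin.≤ b i) → v Fin.≤ b i
    aboveV v∈V h with inV v∈V
    ... | j , refl = h j

  -- Consecutive vertices lie in different parts, so the part of `w 0F` decides whether the first
  -- interval holds the even or the odd positions.
  borders⇒hexagon : HasInnerBorder 𝓟 → HasOuterBorder 𝓟 → Hexagon H
  borders⇒hexagon inner outer = Sum.[
      (λ w₀ → let w₁ = otherPart₀ step₀ w₀
                  w₂ = otherPart₁ step₁ w₁
                  w₃ = otherPart₀ step₂ w₂
                  w₄ = otherPart₁ step₃ w₃
                  w₅ = otherPart₀ step₄ w₄
              in alternating⇒hexagon inner outer evens oddsOpposite (from-yes (isAlternating? evens oddsOpposite))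
                   (λ { 0F → w₀ ; 1F → w₂ ; 2F → w₄ }) (λ { 0F → w₃ ; 1F → w₅ ; 2F → w₁ }))
    , (λ w₀ → let w₁ = otherPart₁ step₀ w₀
                  w₂ = otherPart₀ step₁ w₁
                  w₃ = otherPart₁ step₂ w₂
                  w₄ = otherPart₀ step₃ w₃
                  w₅ = otherPart₁ step₄ w₄
              in alternating⇒hexagon inner outer odds evensOpposite (from-yes (isAlternating? odds evensOpposite))
                   (λ { 0F → w₁ ; 1F → w₃ ; 2F → w₅ }) (λ { 0F → w₄ ; 1F → w₀ ; 2F → w₂ })) ]
    (fin2 (part (w 0F)))
    where
    Step : Fin 6 → Fin 6 → Set
    Step i j = CyclicSuc i j ⊎ CyclicSuc j i
    step₀ : Step 0F 1F
    step₀ = inj₁ (inj₁ refl)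
    step₁ : Step 1F 2F
    step₁ = inj₁ (inj₁ refl)
    step₂ : Step 2F 3F
    step₂ = inj₁ (inj₁ refl)
    step₃ : Step 3F 4F
    step₃ = inj₁ (inj₁ refl)
    step₄ : Step 4F 5F
    step₄ = inj₁ (inj₁ refl)

bordered⇒hexagon : ∀ {H : OrderedGraph 6} → IsBorderedCycle H → Hexagon H
bordered⇒hexagon bc =
  let (_ , σ , consecutive) = IsBorderedCycle.isCycle bc
      (𝓟 , inner , outer)   = IsBorderedCycle.bordered bc
  in borders⇒hexagon σ consecutive 𝓟 inner outer

avoids⇒¬hexagon : ∀ {n} {G : OrderedGraph n} → G AvoidsFamily 𝓒ᴮ 6 → ¬ Hexagon G
avoids⇒¬hexagon avoids h = let (H , bordered , contains) = hexagon⇒bordered h in avoids H (refl , bordered) contains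

¬hexagon⇒avoids : ∀ {n} {G : OrderedGraph n} → ¬ Hexagon G → G AvoidsFamily 𝓒ᴮ 6
¬hexagon⇒avoids none H (refl , bordered) contains = none (hexagon-image contains (bordered⇒hexagon bordered))

-- The extremal function

-- Functions are enumerated up to a pointwise relation, there being no function extensionality.
functions : ∀ {A : Set} → List A → ∀ n → List (Fin n → A)
functions xs zero    = (λ ()) ∷ []
functions xs (suc n) = cartesianProductWith _◂_ xs (functions xs n)

functions-complete : ∀ {A : Set} (_≈_ : A → A → Set) (xs : List A) n (f : Fin n → A) →
  (∀ i → ∃[ x ] x ∈ xs × x ≈ f i) → ∃[ g ] g ∈ functions xs n × (∀ i → g i ≈ f i)
functions-complete _≈_ xs zero    f _     = (λ ()) , here refl , λ ()
functions-complete _≈_ xs (suc n) f match =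
  let (x , x∈ , x≈)  = match zero
      (g , g∈ , g≈) = functions-complete _≈_ xs n (f ∘ suc) (match ∘ suc)
  in x ◂ g , ∈-cartesianProductWith⁺ _◂_ x∈ g∈ , λ { zero → x≈ ; (suc i) → g≈ i }

bools : List Bool
bools = true ∷ false ∷ []

graphs : ∀ n → List (OrderedGraph n)
graphs n = map graphOf (functions (functions bools n) n)

graphOf-adj : ∀ {n} (G : OrderedGraph n) (R : Fin n → Fin n → Bool) → (∀ i j → R i j ≡ OrderedGraph.adj G i j) →
  ∀ i j → (Adj (graphOf R) i j → Adj G i j) × (Adj G i j → Adj (graphOf R) i j)
graphOf-adj G R R≡ i j with Fin.<-cmp i j
... | tri< i<j _ _ = (λ e → subst T (R≡ i j) (graphOf⁻ R i<j e)) , (λ e → graphOf⁺ R i<j (subst T (sym (R≡ i j)) e))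
... | tri≈ _ i≡j _ = (λ e → contradiction e (OrderedGraph.~-irrefl (graphOf R) i≡j)) , (λ e → contradiction e (OrderedGraph.~-irrefl G i≡j))
... | tri> _ _ j<i =
  (λ e → OrderedGraph.~-sym G (subst T (R≡ j i) (graphOf⁻ R j<i (OrderedGraph.~-sym (graphOf R) {i} {j} e)))) ,
  (λ e → OrderedGraph.~-sym (graphOf R) {j} {i} (graphOf⁺ R j<i (subst T (sym (R≡ j i)) (OrderedGraph.~-sym G e))))

-- The listed graph agrees with `G` in adjacency only. This is enough because `edgeCount-mono` and
-- `hexagon-mono` depend on nothing else.
graphs-complete : ∀ {n} (G : OrderedGraph n) → ∃[ G′ ] G′ ∈ graphs n ×
  (∀ i j → (Adj G′ i j → Adj G i j) × (Adj G i j → Adj G′ i j))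
graphs-complete {n} G =
  let (R , R∈ , R≡) = functions-complete (λ f g → ∀ j → f j ≡ g j) (functions bools n) n (OrderedGraph.adj G)
                        (λ i → functions-complete _≡_ bools n (OrderedGraph.adj G i) (λ j → bool (OrderedGraph.adj G i j)))
  in graphOf R , ∈-map⁺ graphOf R∈ , graphOf-adj G R R≡
  where
  bool : ∀ b → ∃[ x ] x ∈ bools × x ≡ b
  bool true  = true , here refl , refl
  bool false = false , there (here refl) , refl

edgeCount-mono : ∀ {n} (G G′ : OrderedGraph n) → (∀ i j → Adj G i j → Adj G′ i j) → edgeCount G ≤ edgeCount G′
edgeCount-mono {n} G G′ h = subst₂ _≤_ (sym (edgeCount≡∑ G)) (sym (edgeCount≡∑ G′))
  (∑-mono n (λ i → ∑-mono< n (λ j j<n → ⟦⟧-mono {upper G i j} {upper G′ i j} (λ p →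
    let (i<j , u , v , u≡i , v≡j , e) = upper⇒adj G p in
    adj⇒upper G′ i<j j<n (λ u′ v′ u′≡i v′≡j → subst₂ (Adj G′)
      (Fin.toℕ-injective (trans u≡i (sym u′≡i))) (Fin.toℕ-injective (trans v≡j (sym v′≡j))) (h u v e))))))

hexagon-mono : ∀ {n} {G G′ : OrderedGraph n} → (∀ i j → Adj G i j → Adj G′ i j) → Hexagon G → Hexagon G′
hexagon-mono {G = G} {G′} h = hexagon-image {H = G} {G = G′} record
  { embed = λ i → i ; injective = λ eq → eq ; monotone = λ i≤j → i≤j ; edge = λ {i} {j} → h i j }

-- Avoiding the family quantifies over all ordered graphs and their embeddings; a hexagon is a
-- finite search, which makes the candidates for the maximum a filtered list.
hexagon? : ∀ {n} (G : OrderedGraph n) → Dec (Hexagon G)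
hexagon? G = map′
  (λ (_ , _ , a , _ , b , _ , c , _ , d , _ , e , f , g , h , i , j , k , l , m) → hexagon {G = G} a b c d e f g h i j k l m)
  (λ (hexagon a b c d e f g h i j k l m) → _ , _ , a , _ , b , _ , c , _ , d , _ , e , f , g , h , i , j , k , l , m)
  (Fin.any? λ u₁ → Fin.any? λ u₂ → (u₁ Fin.<? u₂) ×-dec (Fin.any? λ u₃ → (u₂ Fin.<? u₃) ×-dec
    (Fin.any? λ v₁ → (u₃ Fin.<? v₁) ×-dec (Fin.any? λ v₂ → (u₃ Fin.<? v₂) ×-dec (Fin.any? λ v₃ → (v₁ Fin.<? v₃) ×-dec
      (¬? (v₂ Fin.≟ v₁) ×-dec (¬? (v₂ Fin.≟ v₃) ×-dec
        (adj? u₁ v₂ ×-dec (adj? u₁ v₃ ×-dec (adj? u₂ v₁ ×-dec (adj? u₂ v₃ ×-dec (adj? u₃ v₁ ×-dec adj? u₃ v₂))))))))))))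
  where
  adj? : ∀ i j → Dec (Adj G i j)
  adj? i j = T? (OrderedGraph.adj G i j)

emptyGraph : ∀ n → OrderedGraph n
emptyGraph n = graphOf (λ _ _ → false)

emptyGraph-noHexagon : ∀ n → ¬ Hexagon (emptyGraph n)
emptyGraph-noHexagon n (hexagon {u₁} {v₃ = v₃} u₁<u₂ u₂<u₃ u₃<v₁ _ v₁<v₃ _ _ _ u₁v₃ _ _ _ _) =
  graphOf⁻ (λ _ _ → false) {u₁} {v₃} (<-trans (<-trans (<-trans u₁<u₂ u₂<u₃) u₃<v₁) v₁<v₃) u₁v₃

hexagonFreeGraphs : ∀ n → List (OrderedGraph n)
hexagonFreeGraphs n = filter (λ G → ¬? (hexagon? G)) (graphs n)

extremalGraph : ∀ n → OrderedGraph n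
extremalGraph n = argmax edgeCount (emptyGraph n) (hexagonFreeGraphs n)

extremal-noHexagon : ∀ n → ¬ Hexagon (extremalGraph n)
extremal-noHexagon n = argmax-all edgeCount {P = λ G → ¬ Hexagon G} (emptyGraph-noHexagon n) (all-filter (λ G → ¬? (hexagon? G)) (graphs n))

extremal-maximal : ∀ {n} (G : OrderedGraph n) → ¬ Hexagon G → edgeCount G ≤ edgeCount (extremalGraph n)
extremal-maximal {n} G none =
  let (G′ , G′∈ , same) = graphs-complete G
      G′-none = none ∘ hexagon-mono {G = G′} {G} (λ i j → proj₁ (same i j))
  in ≤-trans (edgeCount-mono G G′ (λ i j → proj₂ (same i j)))
       (All.lookup (f[xs]≤f[argmax] {f = edgeCount} (emptyGraph n) (hexagonFreeGraphs n)) (∈-filter⁺ (λ G → ¬? (hexagon? G)) G′∈ G′-none))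

ex : ℕ → ℕ
ex n = edgeCount (extremalGraph n)

ex-isEx : ∀ n → IsEx n (𝓒ᴮ 6) (ex n)
ex-isEx n = record
  { attained = extremalGraph n , ¬hexagon⇒avoids {G = extremalGraph n} (extremal-noHexagon n) , refl
  ; maximal  = λ G avoids → extremal-maximal G (avoids⇒¬hexagon {G = G} avoids)
  }

ex-isO : IsO ex 4 3
ex-isO = let (K , 0<K , bound) = edgeCount³≤ in
  K , 0<K , 1 , λ n 1≤n → bound 1≤n (extremalGraph n) (extremal-noHexagon n)

-- The base is kept as a variable b so that powers of 64 are never unfolded.
module _ {b : ℕ} (b≡64 : b ≡ 64) where

  private
    1<b : 1 < b
    1<b = subst (1 <_) (sym b≡64) (s≤s (s≤s z≤n))

    bᵏ≡ : ∀ k → b ^ k ≡ 4 ^ k * (4 ^ k * 4 ^ k)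
    bᵏ≡ k = trans (cong (_^ k) b≡64) (trans (^-distribʳ-* k 4 16) (cong (4 ^ k *_) (^-distribʳ-* k 4 4)))

  -- Ten is the threshold 8 of `prime-between` plus the two powers of `b` that make room for the
  -- graph.
  exponent : ∀ {n} → b ^ 10 ≤ n → ∃[ u ] 8 ≤ u × b ^ (2 + u) ≤ n × n < b ^ (3 + u)
  exponent {n} b¹⁰≤n with bracket b 1<b n (≤-trans (m^n>0 b {{>-nonZero (<⇒≤ 1<b)}} 10) b¹⁰≤n)
  ... | k , bᵏ≤n , n<bᵏ⁺¹ = split-off k (≮⇒≥ k≮10) bᵏ≤n n<bᵏ⁺¹
    where
    k≮10 : ¬ (k < 10)
    k≮10 k<10 = <⇒≱ n<bᵏ⁺¹ (≤-trans (^-monoʳ-≤ b {{>-nonZero (<⇒≤ 1<b)}} k<10) b¹⁰≤n)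
    split-off : ∀ k → 10 ≤ k → b ^ k ≤ n → n < b ^ suc k → ∃[ u ] 8 ≤ u × b ^ (2 + u) ≤ n × n < b ^ (3 + u)
    split-off (suc (suc u)) (s≤s (s≤s 8≤u)) lo hi = u , 8≤u , lo , hi

  -- The base is 4³, so `p ≤ 4 ^ suc u` turns into `p³ ≤ b ^ suc u`. One more power of `b` covers
  -- the doubling to points and lines, and a third one the rounding of `n`.
  manyEdges : ∀ n → b ^ 10 ≤ n → ∃[ a ] n ≤ b * (b * (b * (a * (a * a)))) × a * (a * (a * a)) ≤ ex n
  manyEdges n b¹⁰≤n with exponent b¹⁰≤n
  ... | u , 8≤u , lo , hi with prime-between u 8≤u
  ...   | p , pr , a<p , p≤4a = 4 ^ u , ≤-trans (<⇒≤ hi) (≤-reflexive (cong (λ x → b * (b * (b * x))) (bᵏ≡ u))) , (begin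
    a * (a * (a * a))           ≤⟨ *-mono-≤ (<⇒≤ a<p) (*-mono-≤ (<⇒≤ a<p) (*-mono-≤ (<⇒≤ a<p) (<⇒≤ a<p))) ⟩
    p * (p * (p * p))           ≡⟨ regroup p ⟩
    p * p * p * p               ≤⟨ Wenger.graph-edges pr room ⟩
    edgeCount (Wenger.graph pr n) ≤⟨ extremal-maximal (Wenger.graph pr n) (Wenger.graph-noHexagon pr n) ⟩
    ex n                        ∎)
    where
    open ≤-Reasoning
    a : ℕ
    a = 4 ^ u
    regroup : ∀ p → p * (p * (p * p)) ≡ p * p * p * p
    regroup = solve-∀
    cube≤bᵘ⁺¹ : p * p * p ≤ b ^ suc u
    cube≤bᵘ⁺¹ = begin
      p * p * p                                          ≡⟨ *-assoc p p p ⟩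
      p * (p * p)                                        ≤⟨ *-mono-≤ p≤4a (*-mono-≤ p≤4a p≤4a) ⟩
      4 ^ suc u * (4 ^ suc u * 4 ^ suc u)                ≡⟨ bᵏ≡ (suc u) ⟨
      b ^ suc u                                          ∎
    room : p * p * p + p * p * p ≤ n
    room = begin
      p * p * p + p * p * p      ≡⟨ cong (p * p * p +_) (+-identityʳ (p * p * p)) ⟨
      2 * (p * p * p)            ≤⟨ *-mono-≤ 1<b cube≤bᵘ⁺¹ ⟩
      b ^ (2 + u)                ≤⟨ lo ⟩
      n                          ∎

  -- From `n ≤ b³ a³` follows `n⁴ ≤ b¹² a¹² = (b⁴ a⁴)³`, whence the constant `b⁴`.
  ex-isΩ-base : IsΩ ex 4 3
  ex-isΩ-base = K , m<n⇒0<K , b ^ 10 , bound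
    where
    K : ℕ
    K = b * (b * (b * b))
    m<n⇒0<K : 0 < K
    m<n⇒0<K = *-mono-≤ (<⇒≤ 1<b) (*-mono-≤ (<⇒≤ 1<b) (*-mono-≤ (<⇒≤ 1<b) (<⇒≤ 1<b)))
    powers : ∀ b a → let x = b * (b * (b * (a * (a * a)))) ; y = b * (b * (b * b)) * (a * (a * (a * a))) in
      x * (x * (x * (x * 1))) ≡ y * (y * (y * 1))
    powers = solve-∀
    bound : ∀ n → b ^ 10 ≤ n → n ^ 4 ≤ (K * ex n) ^ 3
    bound n b¹⁰≤n = let (a , n≤ , a⁴≤) = manyEdges n b¹⁰≤n in begin
      n ^ 4                                        ≤⟨ ^-monoˡ-≤ 4 n≤ ⟩
      (b * (b * (b * (a * (a * a))))) ^ 4          ≡⟨ powers b a ⟩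
      (K * (a * (a * (a * a)))) ^ 3                ≤⟨ ^-monoˡ-≤ 3 (*-monoʳ-≤ K a⁴≤) ⟩
      (K * ex n) ^ 3                               ∎
      where open ≤-Reasoning

theorem3 : Σ[ ex ∈ (ℕ → ℕ) ] (∀ n → IsEx n (𝓒ᴮ 6) (ex n)) × IsΘ ex 4 3
theorem3 = ex , ex-isEx , ex-isO , ex-isΩ-base refl
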